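{- For every $\varepsilon>0$ there exists $n_0$ such that for every integer $n\ge n_0$ the following holds. Every graph $G$ on $n$ vertices with minimum degree $\delta(G)\geq (1/2+\varepsilon)n$ contains at least $(1-\varepsilon)\,\mathrm{reg}_{even}(G)/2$ pairwise edge-disjoint Hamilton cycles.
   Context: All graphs are finite and simple. For a graph $G$ and an integer $r\ge 0$, an $r$-factor of $G$ is a spanning $r$-regular subgraph of $G$. $\mathrm{reg}_{even}(G)$ denotes the largest even integer $r$ such that $G$ contains an $r$-factor. -}

module Defs where

open import Data.Nat using (ℕ; zero; suc; _≤_; _∸_)
open import Data.Nat.Divisibility using (_∣_)
open import Data.Nat.ListAction using (sum)
open import Data.Bool using (Bool; true; false; if_then_else_)
open import Data.Fin using (Fin; toℕ)
open import Data.List using (List; map; allFin)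
open import Data.Product using (Σ; ∃; _×_; _,_)
open import Data.Sum using (_⊎_)
open import Data.Empty using (⊥)
open import Relation.Binary.PropositionalEquality using (_≡_; _≢_)
open import Function.Definitions using (Injective)

record Graph (n : ℕ) : Set where
  field
    adj   : Fin n → Fin n → Bool
    sym   : ∀ u v → adj u v ≡ adj v u
    irrefl : ∀ v → adj v v ≡ false
open Graph public

Adj : ∀ {n} → Graph n → Fin n → Fin n → Set
Adj G u v = adj G u v ≡ true

degree : ∀ {n} → Graph n → Fin n → ℕ
degree {n} G v = sum (map (λ w → if adj G v w then 1 else 0) (allFin n))

SpanningSubgraph : ∀ {n} → Graph n → Graph n → Set
SpanningSubgraph {n} F G = ∀ (u v : Fin n) → Adj F u v → Adj G u v

IsFactor : ∀ {n} → ℕ → Graph n → Graph n → Set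
IsFactor {n} r G F = SpanningSubgraph F G × (∀ (v : Fin n) → degree F v ≡ r)

HasFactor : ∀ {n} → ℕ → Graph n → Set
HasFactor {n} r G = Σ (Graph n) (IsFactor r G)

Even : ℕ → Set
Even r = 2 ∣ r

IsRegEven : ∀ {n} → Graph n → ℕ → Set
IsRegEven G r =
  Even r × HasFactor r G × (∀ r′ → Even r′ → HasFactor r′ G → r′ ≤ r)

-- A Hamilton cycle of G, given by a cyclic ordering σ of all vertices
-- (σ injective, hence a bijection of Fin n) with consecutive vertices
-- adjacent, including σ(n-1) ~ σ(0).  Requires n ≥ 3.
record HamiltonCycle {n : ℕ} (G : Graph n) : Set where
  field
    three≤n : 3 ≤ n
    σ       : Fin n → Fin n
    σ-inj   : Injective _≡_ _≡_ σ
    σ-adj   : ∀ (i j : Fin n) →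
              (toℕ j ≡ suc (toℕ i) ⊎ (toℕ i ≡ n ∸ 1 × toℕ j ≡ 0)) →
              Adj G (σ i) (σ j)
open HamiltonCycle public

CycleEdge : ∀ {n} {G : Graph n} → HamiltonCycle G → Fin n → Fin n → Set
CycleEdge {n} C u v =
  ∃ λ (i : Fin n) → ∃ λ (j : Fin n) →
    (toℕ j ≡ suc (toℕ i) ⊎ (toℕ i ≡ n ∸ 1 × toℕ j ≡ 0)) ×
    ((σ C i ≡ u × σ C j ≡ v) ⊎ (σ C i ≡ v × σ C j ≡ u))

EdgeDisjoint : ∀ {n} {G : Graph n} {k : ℕ} → (Fin k → HamiltonCycle G) → Set
EdgeDisjoint {n} {G} {k} Cs =
  ∀ (a b : Fin k) → a ≢ b → ∀ (u v : Fin n) →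
    CycleEdge (Cs a) u v → CycleEdge (Cs b) u v → ⊥

{-# OPTIONS --safe #-}
module Submission where

-- Cut most of an r-factor F into about r/2 edge-disjoint linear forests with few paths: colour the
-- vertices by ℤ/p so that every vertex sees every colour equally often. The edges of a fixed colour
-- difference d form an almost regular digraph, which König's theorem splits into matchings; deleting the
-- edges into one colour class makes each matching acyclic, and rotating this class over the matchings
-- makes every vertex a path end in few forests only.
-- The forests are completed with edges of a reserve: from groups of forests one member each is sacrificed,
-- and these and the edges of G outside all forests form the reserve. As deg u + deg v ≥ (1 + 2ε) n,
-- linearly many consecutive pairs (x , y) of a forest satisfy ux, vy ∈ G, and for a good choice of the
-- sacrificed members, linearly many have ux and vy in the reserve, for all u, v and all remaining forests.
-- A shortest path with ends b, a can then be inserted between x and y (as b ~ x, a ~ y) until boundedly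
-- many paths are left. The paths are closed up to a cyclic ordering with boundedly many gaps, and each gap
-- (a , b) is closed by replacing it and xy with ax and by, with a fresh reserve for each of these
-- boundedly many rounds. Edges are claimed greedily; overloaded vertices are avoided.
-- All choices that are random in the usual argument are made greedily, keeping an eighth-moment potential
-- from increasing. If r < ε n, then Dirac's theorem can instead be applied r/2 times.

-- Eighth moments are forced by the number of conditions on a single choice: one for each of at most
-- n orderings and each pair u, v, hence up to n³. With bounded mean-zero steps, a potential of
-- degree 2k bounds every drift D by D²ᵏ = O(n³ nᵏ), which gives D = o(n) only for k > 3. That ux
-- and vy both lie in the reserve is not a linear condition on the sacrificed members. So a round
-- sacrifices two members of each group: the first choice frees ux for a fixed share of the places,
-- the second frees vy for a share of these. A round costs two of the 2 + q members of a group. If N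
-- rounds are to cost only a small share, groups must have far more than N members, so N has to be a
-- constant before gaps are closed. Merging leaves N paths with N depending on the group size;
-- therefore the cycles are regrouped into larger groups in between. The number of colours is prime
-- so that every nonzero difference generates ℤ/p, and cutting a single class destroys all directed
-- cycles. Only differences below p/2 occur, so an edge gets at most one direction.

module Rationals where

  open import Data.Nat as ℕ using (ℕ; zero; suc)
  import Data.Nat.Properties as ℕₚ
  import Data.Nat.Tactic.RingSolver as ℕ-Ring
  open import Data.Integer as ℤ using (+_; -[1+_]; +[1+_])
  import Data.Integer.Properties as ℤₚ
  import Data.Integer.Tactic.RingSolver as ℤ-Ring
  open import Data.Rational using (ℚ; mkℚ; 0ℚ; 1ℚ; ½; _/_; _+_; _-_; _*_; _≤_; _<_; *<*; ↧ₙ_; toℚᵘ)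
  import Data.Rational as ℚ
  import Data.Rational.Properties as ℚₚ
  open import Data.Rational.Unnormalised as ℚᵘ using (ℚᵘ; mkℚᵘ; _≃_; *≤*)
  import Data.Rational.Unnormalised.Properties as ℚᵘₚ
  open import Relation.Binary.PropositionalEquality

  ≤-unnormalised : ∀ {p q} {p′ q′ : ℚᵘ} → toℚᵘ p ≃ p′ → toℚᵘ q ≃ q′ → p ≤ q → p′ ℚᵘ.≤ q′
  ≤-unnormalised p≃ q≃ p≤q = ℚᵘₚ.≤-respʳ-≃ q≃ (ℚᵘₚ.≤-respˡ-≃ p≃ (ℚₚ.toℚᵘ-mono-≤ p≤q))

  ≤-normalised : ∀ {p q} {p′ q′ : ℚᵘ} → toℚᵘ p ≃ p′ → toℚᵘ q ≃ q′ → p′ ℚᵘ.≤ q′ → p ≤ q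
  ≤-normalised p≃ q≃ p′≤q′ = ℚₚ.toℚᵘ-cancel-≤ (ℚᵘₚ.≤-respʳ-≃ (ℚᵘₚ.≃-sym q≃) (ℚᵘₚ.≤-respˡ-≃ (ℚᵘₚ.≃-sym p≃) p′≤q′))

  drop-≤ : ∀ {p q} → p ℚᵘ.≤ q → ℚᵘ.↥ p ℤ.* ℚᵘ.↧ q ℤ.≤ ℚᵘ.↥ q ℤ.* ℚᵘ.↧ p
  drop-≤ (*≤* h) = h

  -- A positive rational is at least the reciprocal of its denominator. So the denominator of `ε`
  -- serves as `ε⁻¹` from here on, for a possibly smaller `ε`, and all bounds become inequalities in
  -- ℕ.
  degree-bound : ∀ ε → 0ℚ < ε → ∀ n d → (½ + ε) * (+ n / 1) ≤ (+ d / 1) →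
                 (↧ₙ ε ℕ.+ 2) ℕ.* n ℕ.≤ 2 ℕ.* ↧ₙ ε ℕ.* d
  degree-bound ε@(mkℚ (+ zero)   e-1 c) (*<* (ℤ.+<+ ())) n d h
  degree-bound ε@(mkℚ -[1+ _ ]   e-1 c) (*<* ()) n d h
  degree-bound ε@(mkℚ +[1+ a ]   e-1 c) pos n d h = ℤ.drop‿+≤+ (ℤₚ.≤-trans (ℤ.+≤+ weaker) (subst₂ ℤ._≤_ left right (drop-≤ unnormalised)))
    where
    e = suc e-1
    unnormalised : (mkℚᵘ (+ 1) 1 ℚᵘ.+ mkℚᵘ +[1+ a ] e-1) ℚᵘ.* mkℚᵘ (+ n) 0 ℚᵘ.≤ mkℚᵘ (+ d) 0
    unnormalised = ≤-unnormalised
      (ℚᵘₚ.≃-trans (ℚₚ.toℚᵘ-homo-* (½ + ε) (+ n / 1)) (ℚᵘₚ.*-cong (ℚₚ.toℚᵘ-homo-+ ½ ε) (ℚₚ.toℚᵘ-fromℚᵘ (mkℚᵘ (+ n) 0))))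
      (ℚₚ.toℚᵘ-fromℚᵘ (mkℚᵘ (+ d) 0)) h
    weaker : (e ℕ.+ 2) ℕ.* n ℕ.≤ (e ℕ.+ suc a ℕ.* 2) ℕ.* n
    weaker = ℕₚ.*-monoˡ-≤ n (ℕₚ.+-monoʳ-≤ e (ℕₚ.m≤m+n 2 (a ℕ.* 2)))
    left : (((+ 1 ℤ.* + e ℤ.+ +[1+ a ] ℤ.* + 2) ℤ.* + n) ℤ.* + 1) ≡ + ((e ℕ.+ suc a ℕ.* 2) ℕ.* n)
    left = trans (ℤₚ.*-identityʳ _) (trans (cong (ℤ._* + n) (cong₂ ℤ._+_ (ℤₚ.*-identityˡ (+ e)) (sym (ℤₚ.pos-* (suc a) 2)))) (sym (ℤₚ.pos-* (e ℕ.+ suc a ℕ.* 2) n)))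
    right : + d ℤ.* + (2 ℕ.* e ℕ.* 1) ≡ + (2 ℕ.* e ℕ.* d)
    right = trans (sym (ℤₚ.pos-* d (2 ℕ.* e ℕ.* 1))) (cong +_ (lem d e))
      where
      lem : ∀ d e → d ℕ.* (2 ℕ.* e ℕ.* 1) ≡ 2 ℕ.* e ℕ.* d
      lem = ℕ-Ring.solve-∀

  -- The way back: as the numerator of `ε` is at least 1, it is permitted to lose r / (2 · `↧ₙ ε`)
  -- of the r / 2 cycles.
  count-bound : ∀ ε → 0ℚ < ε → ∀ r k → ↧ₙ ε ℕ.* r ℕ.≤ 2 ℕ.* ↧ₙ ε ℕ.* k ℕ.+ r →
                (1ℚ - ε) * (+ r / 2) ≤ (+ k / 1)
  count-bound ε@(mkℚ (+ zero)   e-1 c) (*<* (ℤ.+<+ ())) r k h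
  count-bound ε@(mkℚ -[1+ _ ]   e-1 c) (*<* ()) r k h
  count-bound ε@(mkℚ +[1+ a ]   e-1 c) pos r k h = ≤-normalised
      (ℚᵘₚ.≃-trans (ℚₚ.toℚᵘ-homo-* (1ℚ - ε) (+ r / 2)) (ℚᵘₚ.*-cong
        (ℚᵘₚ.≃-trans (ℚₚ.toℚᵘ-homo-+ 1ℚ (ℚ.- ε)) (ℚᵘₚ.+-congʳ (mkℚᵘ (+ 1) 0) (ℚₚ.toℚᵘ-homo‿- ε))) (ℚₚ.toℚᵘ-fromℚᵘ (mkℚᵘ (+ r) 1))))
      (ℚₚ.toℚᵘ-fromℚᵘ (mkℚᵘ (+ k) 0)) (*≤* bound)
    where
    e = suc e-1
    bound : (((+ 1 ℤ.* + e ℤ.+ -[1+ a ] ℤ.* + 1) ℤ.* + r) ℤ.* + 1) ℤ.≤ + k ℤ.* + (1 ℕ.* e ℕ.* 2)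
    bound = subst₂ ℤ._≤_ (sym left) (sym right) (ℤₚ.≤-trans (ℤₚ.+-monoˡ-≤ (ℤ.- + (suc a ℕ.* r)) (ℤ.+≤+ h))
      (ℤₚ.≤-trans (ℤₚ.≤-reflexive regroup) (ℤₚ.≤-trans (ℤₚ.+-monoʳ-≤ (+ (2 ℕ.* e ℕ.* k)) (ℤₚ.neg-mono-≤ (ℤ.+≤+ (ℕ.z≤n {a ℕ.* r})))) (ℤₚ.≤-reflexive (ℤₚ.+-identityʳ _)))))
      where
      left : (((+ 1 ℤ.* + e ℤ.+ -[1+ a ] ℤ.* + 1) ℤ.* + r) ℤ.* + 1) ≡ + (e ℕ.* r) ℤ.+ ℤ.- + (suc a ℕ.* r)
      left = trans (lem (+ e) (+ suc a) (+ r)) (cong₂ (λ x y → x ℤ.+ ℤ.- y) (sym (ℤₚ.pos-* e r)) (sym (ℤₚ.pos-* (suc a) r)))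
        where
        lem : ∀ e a r → (((+ 1 ℤ.* e ℤ.+ (ℤ.- a) ℤ.* + 1) ℤ.* r) ℤ.* + 1) ≡ e ℤ.* r ℤ.+ ℤ.- (a ℤ.* r)
        lem = ℤ-Ring.solve-∀
      right : + k ℤ.* + (1 ℕ.* e ℕ.* 2) ≡ + (2 ℕ.* e ℕ.* k)
      right = trans (sym (ℤₚ.pos-* k (1 ℕ.* e ℕ.* 2))) (cong +_ (lem k e))
        where
        lem : ∀ k e → k ℕ.* (1 ℕ.* e ℕ.* 2) ≡ 2 ℕ.* e ℕ.* k
        lem = ℕ-Ring.solve-∀
      regroup : + (2 ℕ.* e ℕ.* k ℕ.+ r) ℤ.+ ℤ.- + (suc a ℕ.* r) ≡ + (2 ℕ.* e ℕ.* k) ℤ.+ ℤ.- + (a ℕ.* r)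
      regroup = trans (cong₂ (λ x y → x ℤ.+ ℤ.- y) (ℤₚ.pos-+ (2 ℕ.* e ℕ.* k) r) (ℤₚ.pos-+ r (a ℕ.* r))) (lem (+ (2 ℕ.* e ℕ.* k)) (+ r) (+ (a ℕ.* r)))
        where
        lem : ∀ x r y → x ℤ.+ r ℤ.+ ℤ.- (r ℤ.+ y) ≡ x ℤ.+ ℤ.- y
        lem = ℤ-Ring.solve-∀

-- Greedy choices controlled by an eighth-moment potential

module EighthMoment where

  open import Data.Nat as ℕ using (ℕ; zero; suc; z≤n)
  import Data.Nat.Properties as ℕₚ
  import Data.Nat.Tactic.RingSolver as ℕ-Ring
  import Algebra.Properties.Semiring.Sum ℕₚ.+-*-semiring as ℕ-Sum
  open import Data.Fin using (Fin; zero; suc)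
  open import Data.Product using (∃; _,_; _×_)
  open import Function using (_∘_; _⟨_⟩_)
  open import Data.Sum using (_⊎_; inj₁; inj₂)
  open import Data.Empty using (⊥-elim)
  open import Relation.Nullary using (yes; no)
  open import Relation.Binary.PropositionalEquality
  open import Data.Integer as ℤ using (ℤ; +_; -[1+_]; 0ℤ; ∣_∣; _+_; _*_; _≤_; _-_; -_)
  import Data.Integer.Properties as ℤₚ
  import Data.Integer.Tactic.RingSolver as ℤ-Ring
  open import Algebra.Properties.Semiring.Sum ℤₚ.+-*-semiring using (sum; sum-syntax; sum-cong-≗; ∑-distrib-+; ∑-comm; *-distribˡ-sum)

  0≤* : ∀ {x y} → 0ℤ ≤ x → 0ℤ ≤ y → 0ℤ ≤ x * y
  0≤* {+ x} {+ y} _ _ = subst (0ℤ ≤_) (ℤₚ.pos-* x y) (ℤ.+≤+ z≤n)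

  0≤sq : ∀ x → 0ℤ ≤ x * x
  0≤sq (+ x)     = 0≤* {+ x} {+ x} (ℤ.+≤+ z≤n) (ℤ.+≤+ z≤n)
  0≤sq (-[1+ x ]) = ℤ.+≤+ z≤n

  0≤+ : ∀ {x y} → 0ℤ ≤ x → 0ℤ ≤ y → 0ℤ ≤ x + y
  0≤+ = ℤₚ.+-mono-≤

  0≤const : ∀ {k} → 0ℤ ≤ + k
  0≤const = ℤ.+≤+ z≤n

  slack : ∀ {A B} e → 0ℤ ≤ e → A + e ≡ B → A ≤ B
  slack {A} e h eq = subst₂ _≤_ (ℤₚ.+-identityʳ A) eq (ℤₚ.+-monoʳ-≤ A h)

  -- Opaque, so that conversion checking does not unfold integer multiplication.
  infix 8 _⁴
  opaque
    _⁴ : ℤ → ℤ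
    x ⁴ = (x * x) * (x * x)

    ⁴-def : ∀ x → x ⁴ ≡ (x * x) * (x * x)
    ⁴-def x = refl

  slope : ℤ → ℤ → ℤ → ℤ
  slope y Z₀ a = + 8 * ((Z * Z + + 10 * (a * Z) + + 2 * (a * a)) * (Z * y))
    where Z = y * y + Z₀

  step-bound : ℤ → ℤ → ℤ → ℤ → ℤ
  step-bound y ξ Z₀ a = (y * y + Z₀ + + 10 * a) ⁴ + slope y Z₀ a * ξ

  -- In expectation (y² + Z₀)⁴ grows at most to (y² + Z₀ + 10a)⁴ when y receives a mean-zero increment ξ
  -- with ξ² ≤ a: in the pointwise bound the only term of odd degree in ξ is linear.
  module _ (y ξ Z₀ d : ℤ) (0≤Z₀ : 0ℤ ≤ Z₀) (0≤d : 0ℤ ≤ d) where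
    private
      s a Z t Q u v : ℤ
      s = ξ * ξ
      a = d + s
      Z = y * y + Z₀
      t = + 2 * (y * ξ)
      Q = Z * Z + + 10 * (a * Z) + + 2 * (a * a)
      u = (Z + t + s) * (Z + t + s)
      v = Q + + 2 * (Z * t)
      -- From (t + s)² = 2t² + 2s² - (t - s)² and t² = 4(Z - Z₀)s follows u ≤ v, with difference
      -- `E₁`. In v² the variable t occurs only in 4QZt and in 4Z²t² ≤ 16aZ³; the latter is absorbed
      -- by (Z + 10a)⁴, with difference `E₃`.
      E₁ E₃ : ℤ
      E₁ = + 10 * (Z * d) + + 8 * (Z₀ * s) + + 2 * (d * (a + s)) + (t - s) * (t - s)
      E₃ = + 16 * ((Z * Z) * (Z * d + Z₀ * s))
           + (+ 4 * ((a * Z) * (Z * Z)) + + 200 * ((a * Z) * (a * Z)) + + 40 * ((a * a) * (a * Z))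
           + + 196 * ((a * a) * Q) + (+ 10 * (a * Z) + + 98 * (a * a)) * (+ 10 * (a * Z) + + 98 * (a * a)))
      0≤s = 0≤sq ξ
      0≤a : 0ℤ ≤ a
      0≤a = 0≤+ 0≤d 0≤s
      0≤Z : 0ℤ ≤ Z
      0≤Z = 0≤+ (0≤sq y) 0≤Z₀
      0≤Q : 0ℤ ≤ Q
      0≤Q = 0≤+ (0≤+ (0≤sq Z) (0≤* (0≤const {10}) (0≤* 0≤a 0≤Z))) (0≤* (0≤const {2}) (0≤* 0≤a 0≤a))
      0≤E₁ : 0ℤ ≤ E₁
      0≤E₁ = 0≤+ (0≤+ (0≤+ (0≤* (0≤const {10}) (0≤* 0≤Z 0≤d)) (0≤* (0≤const {8}) (0≤* 0≤Z₀ 0≤s)))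
               (0≤* (0≤const {2}) (0≤* 0≤d (0≤+ 0≤a 0≤s)))) (0≤sq (t - s))
      0≤E₃ : 0ℤ ≤ E₃
      0≤E₃ = 0≤+ (0≤* (0≤const {16}) (0≤* (0≤sq Z) (0≤+ (0≤* 0≤Z 0≤d) (0≤* 0≤Z₀ 0≤s))))
        (0≤+ (0≤+ (0≤+ (0≤+ (0≤* (0≤const {4}) (0≤* (0≤* 0≤a 0≤Z) (0≤sq Z)))
           (0≤* (0≤const {200}) (0≤sq (a * Z)))) (0≤* (0≤const {40}) (0≤* (0≤sq a) (0≤* 0≤a 0≤Z))))
           (0≤* (0≤const {196}) (0≤* (0≤sq a) 0≤Q))) (0≤sq (+ 10 * (a * Z) + + 98 * (a * a))))

      eq₁ : u + E₁ ≡ v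
      eq₁ = identity y ξ Z₀ d
        where
        identity : ∀ y ξ Z₀ d →
          let s = ξ * ξ; a = d + s; Z = y * y + Z₀; t = + 2 * (y * ξ) in
          (Z + t + s) * (Z + t + s)
            + (+ 10 * (Z * d) + + 8 * (Z₀ * s) + + 2 * (d * (a + s)) + (t - s) * (t - s))
          ≡ Z * Z + + 10 * (a * Z) + + 2 * (a * a) + + 2 * (Z * t)
        identity = ℤ-Ring.solve-∀

      eq₂ : u * u + E₁ * (+ 2 * u + E₁) ≡ v * v
      eq₂ = trans (identity u E₁) (cong (λ z → z * z) eq₁)
        where
        identity : ∀ u e → u * u + e * (+ 2 * u + e) ≡ (u + e) * (u + e)
        identity = ℤ-Ring.solve-∀

      eq₃ : (Z + + 10 * a) ⁴ + + 4 * (Q * (Z * t)) ≡ v * v + E₃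
      eq₃ = trans (cong (λ z → z + + 4 * (Q * (Z * t))) (⁴-def (Z + + 10 * a))) (trans (identity₁ Z a t) (cong (λ z → v * v + (+ 4 * ((Z * Z) * z) + R)) (identity₂ y ξ Z₀ d)))
        ⟨ trans ⟩ cong (λ z → v * v + z) (cong (λ z → z + R) (identity₃ (Z * Z) (Z * d + Z₀ * s)))
        where
        R = + 4 * ((a * Z) * (Z * Z)) + + 200 * ((a * Z) * (a * Z)) + + 40 * ((a * a) * (a * Z))
            + + 196 * ((a * a) * Q) + (+ 10 * (a * Z) + + 98 * (a * a)) * (+ 10 * (a * Z) + + 98 * (a * a))
        identity₁ : ∀ Z a t → let Q = Z * Z + + 10 * (a * Z) + + 2 * (a * a) in
          ((Z + + 10 * a) * (Z + + 10 * a)) * ((Z + + 10 * a) * (Z + + 10 * a)) + + 4 * (Q * (Z * t)) ≡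
          (Q + + 2 * (Z * t)) * (Q + + 2 * (Z * t)) +
          (+ 4 * ((Z * Z) * (+ 4 * (a * Z) - t * t)) +
           (+ 4 * ((a * Z) * (Z * Z)) + + 200 * ((a * Z) * (a * Z)) + + 40 * ((a * a) * (a * Z))
           + + 196 * ((a * a) * Q) + (+ 10 * (a * Z) + + 98 * (a * a)) * (+ 10 * (a * Z) + + 98 * (a * a))))
        identity₁ = ℤ-Ring.solve-∀
        identity₂ : ∀ y ξ Z₀ d →
          + 4 * ((d + ξ * ξ) * (y * y + Z₀)) - (+ 2 * (y * ξ)) * (+ 2 * (y * ξ))
          ≡ + 4 * ((y * y + Z₀) * d + Z₀ * (ξ * ξ))
        identity₂ = ℤ-Ring.solve-∀
        identity₃ : ∀ X Y → + 4 * (X * (+ 4 * Y)) ≡ + 16 * (X * Y)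
        identity₃ = ℤ-Ring.solve-∀

    eighth-moment-step : ((y + ξ) * (y + ξ) + Z₀) ⁴ ≤ step-bound y ξ Z₀ a
    eighth-moment-step = ℤₚ.≤-trans (ℤₚ.≤-reflexive (trans (cong _⁴ (identity y ξ Z₀)) (⁴-def (Z + t + s))))
        (ℤₚ.≤-trans (slack (E₁ * (+ 2 * u + E₁)) (0≤* 0≤E₁ (0≤+ (0≤* (0≤const {2}) (0≤sq (Z + t + s))) 0≤E₁)) eq₂)
          (slack E₃ 0≤E₃ (trans (sym eq₃) (cong (λ z → (Z + + 10 * a) ⁴ + z) (reorder Q Z y ξ)))))
      where
      identity : ∀ y ξ Z₀ → (y + ξ) * (y + ξ) + Z₀ ≡ y * y + Z₀ + + 2 * (y * ξ) + ξ * ξ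
      identity = ℤ-Ring.solve-∀
      reorder : ∀ Q Z y ξ → + 4 * (Q * (Z * (+ 2 * (y * ξ)))) ≡ (+ 8 * (Q * (Z * y))) * ξ
      reorder = ℤ-Ring.solve-∀

  ∑-mono : ∀ {n} {f g : Fin n → ℤ} → (∀ i → f i ≤ g i) → sum f ≤ sum g
  ∑-mono {zero}  h = ℤₚ.≤-refl
  ∑-mono {suc n} h = ℤₚ.+-mono-≤ (h zero) (∑-mono (h ∘ suc))

  ∑-≤-average : ∀ {q} (X : Fin (suc q) → ℤ) Y → sum X ≤ ∑[ e < suc q ] Y → ∃ λ e → X e ≤ Y
  ∑-≤-average {zero} X Y h =
    zero , subst₂ _≤_ (ℤₚ.+-identityʳ (X zero)) (ℤₚ.+-identityʳ Y) h
  ∑-≤-average {suc q} X Y h with X zero ℤ.≤? Y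
  ... | yes p = zero , p
  ... | no ¬p with ∑-≤-average {q} (X ∘ suc) Y (cancel h (ℤₚ.<⇒≤ (ℤₚ.≰⇒> ¬p)))
    where
    cancel : ∀ {a b c d} → a + b ≤ c + d → c ≤ a → b ≤ d
    cancel {a} {b} {c} {d} p r =
      subst₂ _≤_ (identity a b) (identity a d) (ℤₚ.+-monoʳ-≤ (- a) (ℤₚ.≤-trans p (ℤₚ.+-monoˡ-≤ d r)))
      where
      identity : ∀ a b → - a + (a + b) ≡ b
      identity = ℤ-Ring.solve-∀
  ...   | e , p = suc e , p

  module _ {N q : ℕ} (a : ℤ) (0≤a : 0ℤ ≤ a) where

    private
      K : ℤ
      K = + 10 * a

    potential : ℤ → (Fin N → ℤ) → ℤ
    potential Z₀ y = ∑[ c < N ] ((y c * y c + Z₀) ⁴)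

    -- Summed over all options `e`, the linear terms of `eighth-moment-step` cancel because the
    -- increments have mean zero. Hence some option does not exceed the bound without these terms.
    greedy-step : ∀ Z₀ → 0ℤ ≤ Z₀ → (ξ : Fin N → Fin (suc q) → ℤ) →
                  (∀ c e → ξ c e * ξ c e ≤ a) → (∀ c → sum (ξ c) ≡ 0ℤ) → (y : Fin N → ℤ) →
                  ∃ λ e → potential Z₀ (λ c → y c + ξ c e) ≤ potential (Z₀ + K) y
    greedy-step Z₀ 0≤Z₀ ξ bound mean y = ∑-≤-average _ _ (begin
      ∑[ e < suc q ] ∑[ c < N ] term c e      ≡⟨ ∑-comm (λ e c → term c e) ⟩
      ∑[ c < N ] ∑[ e < suc q ] term c e      ≤⟨ ∑-mono (λ c → begin
        ∑[ e < suc q ] term c e                               ≤⟨ ∑-mono (step c) ⟩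
        ∑[ e < suc q ] (goal c + L c * ξ c e)                 ≡⟨ ∑-distrib-+ (λ _ → goal c) (λ e → L c * ξ c e) ⟩
        (∑[ e < suc q ] goal c) + ∑[ e < suc q ] (L c * ξ c e) ≡⟨ cong (λ z → (∑[ e < suc q ] goal c) + z)
                                                                 (trans (sym (*-distribˡ-sum (L c) (ξ c)))
                                                                 (trans (cong (L c *_) (mean c)) (ℤₚ.*-zeroʳ (L c)))) ⟩
        (∑[ e < suc q ] goal c) + 0ℤ                          ≡⟨ ℤₚ.+-identityʳ _ ⟩
        ∑[ e < suc q ] goal c                                 ∎) ⟩
      ∑[ c < N ] ∑[ e < suc q ] goal c        ≡⟨ ∑-comm (λ c (e : Fin (suc q)) → goal c) ⟩
      ∑[ e < suc q ] potential (Z₀ + K) y     ∎)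
      where
      open ℤₚ.≤-Reasoning
      term : Fin N → Fin (suc q) → ℤ
      term c e = ((y c + ξ c e) * (y c + ξ c e) + Z₀) ⁴
      goal : Fin N → ℤ
      goal c = (y c * y c + (Z₀ + K)) ⁴
      L : Fin N → ℤ
      L c = slope (y c) Z₀ a
      step : ∀ c e → term c e ≤ goal c + L c * ξ c e
      step c e = ℤₚ.≤-trans
        (subst (λ z → term c e ≤ step-bound (y c) (ξ c e) Z₀ z) (identity a (ξ c e * ξ c e))
          (eighth-moment-step (y c) (ξ c e) Z₀ (a - ξ c e * ξ c e) 0≤Z₀ (ℤₚ.i≤j⇒0≤j-i (bound c e))))
        (ℤₚ.≤-reflexive (cong (λ z → z ⁴ + L c * ξ c e) (ℤₚ.+-assoc (y c * y c) Z₀ K)))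
        where
        identity : ∀ a s → a - s + s ≡ a
        identity = ℤ-Ring.solve-∀

    0≤T*K : ∀ T → 0ℤ ≤ + T * K
    0≤T*K T = 0≤* {+ T} {K} (0≤const {T}) (0≤* {+ 10} {a} (0≤const {10}) 0≤a)

    -- `Z₀` prepays the steps to come: it starts as `T * K`, and each step spends `K`.
    greedy-choice : ∀ T (ξ : Fin T → Fin N → Fin (suc q) → ℤ) →
                    (∀ g c e → ξ g c e * ξ g c e ≤ a) → (∀ g c → sum (ξ g c) ≡ 0ℤ) → (y : Fin N → ℤ) →
                    ∃ λ (f : Fin T → Fin (suc q)) →
                      potential 0ℤ (λ c → y c + ∑[ g < T ] ξ g c (f g)) ≤ potential (+ T * K) y
    greedy-choice zero ξ bound mean y = (λ ()) , ℤₚ.≤-reflexive (sum-cong-≗ λ c → fourth c (ℤₚ.+-identityʳ (y c)))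
      where
      fourth : ∀ c {z} → z ≡ y c → (z * z + 0ℤ) ⁴ ≡ (y c * y c + + 0 * K) ⁴
      fourth c refl = refl
    greedy-choice (suc T) ξ bound mean y = assemble
      (greedy-step (+ T * K) (0≤T*K T) (ξ zero) (bound zero) (mean zero) y)
      where
      identity : ∀ T K → T * K + K ≡ (+ 1 + T) * K
      identity = ℤ-Ring.solve-∀
      next : + T * K + K ≡ + suc T * K
      next = identity (+ T) K
      extend : Fin (suc q) → (Fin T → Fin (suc q)) → Fin (suc T) → Fin (suc q)
      extend e f zero    = e
      extend e f (suc g) = f g
      assemble : (∃ λ e → potential (+ T * K) (λ c → y c + ξ zero c e) ≤ potential (+ T * K + K) y) →
                ∃ λ (f : Fin (suc T) → Fin (suc q)) →
                  potential 0ℤ (λ c → y c + ∑[ g < suc T ] ξ g c (f g)) ≤ potential (+ suc T * K) y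
      assemble (e , p) = finish (greedy-choice T (ξ ∘ suc) (bound ∘ suc) (mean ∘ suc) (λ c → y c + ξ zero c e))
        where
        finish : (∃ λ (f : Fin T → Fin (suc q)) →
                   potential 0ℤ (λ c → (y c + ξ zero c e) + ∑[ g < T ] ξ (suc g) c (f g))
                     ≤ potential (+ T * K) (λ c → y c + ξ zero c e)) →
                 ∃ λ (f : Fin (suc T) → Fin (suc q)) →
                   potential 0ℤ (λ c → y c + ∑[ g < suc T ] ξ g c (f g)) ≤ potential (+ suc T * K) y
        finish (f , r) = extend e f , ℤₚ.≤-trans (ℤₚ.≤-reflexive (sum-cong-≗ regroup))
                            (ℤₚ.≤-trans r (subst (λ k → potential (+ T * K) (λ c → y c + ξ zero c e) ≤ potential k y) next p))
          where
          regroup : ∀ c → ((y c + ∑[ g < suc T ] ξ g c (extend e f g)) * (y c + ∑[ g < suc T ] ξ g c (extend e f g)) + 0ℤ) ⁴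
                        ≡ (((y c + ξ zero c e) + ∑[ g < T ] ξ (suc g) c (f g)) * ((y c + ξ zero c e) + ∑[ g < T ] ξ (suc g) c (f g)) + 0ℤ) ⁴
          regroup c = cong (λ z → (z * z + 0ℤ) ⁴) (sym (ℤₚ.+-assoc (y c) (ξ zero c e) _))

  ∑-const : ∀ n x → ∑[ i < n ] x ≡ + n * x
  ∑-const zero    x = sym (ℤₚ.*-zeroˡ x)
  ∑-const (suc n) x = trans (cong (λ z → x + z) (∑-const n x)) (identity (+ n) x)
    where
    identity : ∀ n x → x + n * x ≡ (+ 1 + n) * x
    identity = ℤ-Ring.solve-∀

  ∑-nonneg : ∀ {n} {f : Fin n → ℤ} → (∀ i → 0ℤ ≤ f i) → 0ℤ ≤ sum f
  ∑-nonneg {zero}  h = ℤₚ.≤-refl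
  ∑-nonneg {suc n} h = 0≤+ (h zero) (∑-nonneg (h ∘ suc))

  term≤∑ : ∀ {n} (f : Fin n → ℤ) → (∀ i → 0ℤ ≤ f i) → ∀ i → f i ≤ sum f
  term≤∑ {suc n} f h zero = slack (sum (f ∘ suc)) (∑-nonneg (h ∘ suc)) refl
  term≤∑ {suc n} f h (suc i) =
    ℤₚ.≤-trans (term≤∑ (f ∘ suc) (h ∘ suc) i) (slack (f zero) (h zero) (ℤₚ.+-comm (sum (f ∘ suc)) (f zero)))

  ∑-pos : ∀ {n} (f : Fin n → ℕ) → ∑[ i < n ] (+ f i) ≡ + ℕ-Sum.sum f
  ∑-pos {zero}  f = refl
  ∑-pos {suc n} f = cong (λ z → + f zero + z) (∑-pos (f ∘ suc))

  ∑-minus : ∀ {n} (f g : Fin n → ℤ) → ∑[ i < n ] (f i - g i) ≡ sum f - sum g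
  ∑-minus {zero}  f g = refl
  ∑-minus {suc n} f g = trans (cong (λ z → f zero - g zero + z) (∑-minus (f ∘ suc) (g ∘ suc)))
                              (identity (f zero) (g zero) (sum (f ∘ suc)) (sum (g ∘ suc)))
    where
    identity : ∀ a b c d → a - b + (c - d) ≡ a + c - (b + d)
    identity = ℤ-Ring.solve-∀

  opaque
    fourth : ℕ → ℕ
    fourth x = (x ℕ.* x) ℕ.* (x ℕ.* x)

    fourth-def : ∀ x → fourth x ≡ (x ℕ.* x) ℕ.* (x ℕ.* x)
    fourth-def x = refl

  pos-fourth : ∀ x → (+ x) ⁴ ≡ + fourth x
  pos-fourth x = subst (λ z → (+ x) ⁴ ≡ + z) (sym (fourth-def x)) (trans (⁴-def (+ x)) (trans (cong₂ _*_ (sym (ℤₚ.pos-* x x)) (sym (ℤₚ.pos-* x x))) (sym (ℤₚ.pos-* (x ℕ.* x) (x ℕ.* x)))))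

  square-abs : ∀ x → x * x ≡ + (∣ x ∣ ℕ.* ∣ x ∣)
  square-abs (+ x)      = sym (ℤₚ.pos-* x x)
  square-abs (-[1+ x ]) = refl

  abs-difference : ∀ {a b A} → a ℕ.≤ A → b ℕ.≤ A → ∣ + a - + b ∣ ℕ.≤ A
  abs-difference {a} {b} p q = subst (ℕ._≤ _) (cong ∣_∣ (sym (ℤₚ.m-n≡m⊖n a b)))
    (ℕₚ.≤-trans (ℤₚ.∣m⊝n∣≤m⊔n a b) (ℕₚ.⊔-lub p q))

  ≤-+-abs : ∀ a b → a ℕ.≤ b ℕ.+ ∣ + a - + b ∣
  ≤-+-abs a b = subst (λ z → a ℕ.≤ b ℕ.+ ∣ z ∣) (sym (ℤₚ.m-n≡m⊖n a b)) (case (ℕₚ.≤-total b a))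
    where
    case : b ℕ.≤ a ⊎ a ℕ.≤ b → a ℕ.≤ b ℕ.+ ∣ a ℤ.⊖ b ∣
    case (inj₁ b≤a) = subst (λ z → a ℕ.≤ b ℕ.+ ∣ z ∣) (sym (ℤₚ.⊖-≥ b≤a)) (ℕₚ.≤-reflexive (sym (ℕₚ.m+[n∸m]≡n b≤a)))
    case (inj₂ a≤b) = ℕₚ.≤-trans a≤b (ℕₚ.m≤m+n b _)

  0≤⁴ : ∀ x → 0ℤ ≤ x ⁴
  0≤⁴ x = subst (0ℤ ≤_) (sym (⁴-def x)) (0≤sq (x * x))

  -- With `y = 0` the potential starts at N · (T · 10b)⁴. At the end every single summand, the
  -- eighth power of one drift, is still below this.
  small-drift : ∀ {N q T} b (ξ : Fin T → Fin N → Fin (suc q) → ℤ) →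
    (∀ g c e → ξ g c e * ξ g c e ≤ + b) → (∀ g c → sum (ξ g c) ≡ 0ℤ) →
    ∃ λ (f : Fin T → Fin (suc q)) → ∀ c → let D = ∣ ∑[ g < T ] ξ g c (f g) ∣ in
      fourth (D ℕ.* D) ℕ.≤ N ℕ.* fourth (T ℕ.* (10 ℕ.* b))
  small-drift {N} {q} {T} b ξ bound mean = finish (greedy-choice (+ b) 0≤const T ξ bound mean (λ _ → 0ℤ))
    where
    K : ℤ
    K = + 10 * + b
    drift : (Fin T → Fin (suc q)) → Fin N → ℤ
    drift f c = ∑[ g < T ] ξ g c (f g)
    TK : 0ℤ * 0ℤ + + T * K ≡ + (T ℕ.* (10 ℕ.* b))
    TK = trans (ℤₚ.+-identityˡ (+ T * K)) (trans (cong (λ z → + T * z) (sym (ℤₚ.pos-* 10 b))) (sym (ℤₚ.pos-* T _)))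
    finish : (∃ λ f → potential {N} {q} (+ b) 0≤const 0ℤ (λ c → 0ℤ + drift f c)
                        ≤ potential {N} {q} (+ b) 0≤const (+ T * K) (λ _ → 0ℤ)) →
             ∃ λ f → ∀ c → fourth (∣ drift f c ∣ ℕ.* ∣ drift f c ∣) ℕ.≤ N ℕ.* fourth (T ℕ.* (10 ℕ.* b))
    finish (f , p) = f , λ c → ℤ.drop‿+≤+ (ℤₚ.≤-trans (ℤₚ.≤-reflexive (lower c)) (ℤₚ.≤-trans
        (term≤∑ (λ c → ((0ℤ + drift f c) * (0ℤ + drift f c) + 0ℤ) ⁴) (λ c → 0≤⁴ _) c)
        (ℤₚ.≤-trans p (ℤₚ.≤-reflexive upper))))
      where
      lower : ∀ c → + fourth (∣ drift f c ∣ ℕ.* ∣ drift f c ∣) ≡ ((0ℤ + drift f c) * (0ℤ + drift f c) + 0ℤ) ⁴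
      lower c = trans (sym (pos-fourth _)) (cong _⁴ (trans (sym (square-abs (drift f c)))
        (trans (cong (λ z → z * z) (sym (ℤₚ.+-identityˡ (drift f c)))) (sym (ℤₚ.+-identityʳ _)))))
      upper : ∑[ c < N ] ((0ℤ * 0ℤ + + T * K) ⁴) ≡ + (N ℕ.* fourth (T ℕ.* (10 ℕ.* b)))
      upper = trans (∑-const N ((0ℤ * 0ℤ + + T * K) ⁴)) (trans (cong (λ z → + N * z ⁴) TK)
        (trans (cong (λ z → + N * z) (pos-fourth (T ℕ.* (10 ℕ.* b)))) (sym (ℤₚ.pos-* N _))))

  -- One of `suc q` options is chosen in each of `T` groups, and each of `N` tests compares the
  -- chosen weight with the average over the options. Everything is multiplied by `suc q`, which
  -- makes the mean-zero increments integers.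
  module Discrepancy {T q N : ℕ} (B : ℕ) (w : Fin N → Fin T → Fin (suc q) → ℕ) (w≤B : ∀ c g e → w c g e ℕ.≤ B) where

    private
      A : ℕ
      A = suc q ℕ.* B
      ξ : Fin T → Fin N → Fin (suc q) → ℤ
      ξ g c e = + (suc q ℕ.* w c g e) - + ℕ-Sum.sum (w c g)

      ∑w≤A : ∀ {m} (f : Fin m → ℕ) → (∀ e → f e ℕ.≤ B) → ℕ-Sum.sum f ℕ.≤ m ℕ.* B
      ∑w≤A {zero}  f h = z≤n
      ∑w≤A {suc m} f h = ℕₚ.+-mono-≤ (h zero) (∑w≤A (f ∘ suc) (h ∘ suc))

      bound : ∀ g c e → ξ g c e * ξ g c e ≤ + (A ℕ.* A)
      bound g c e = ℤₚ.≤-trans (ℤₚ.≤-reflexive (square-abs (ξ g c e))) (ℤ.+≤+ (ℕₚ.*-mono-≤ ξ≤A ξ≤A))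
        where
        ξ≤A : ∣ ξ g c e ∣ ℕ.≤ A
        ξ≤A = abs-difference (ℕₚ.*-monoʳ-≤ (suc q) (w≤B c g e)) (∑w≤A (w c g) (w≤B c g))

      mean : ∀ g c → sum (ξ g c) ≡ 0ℤ
      mean g c = begin
        ∑[ e < suc q ] (+ (suc q ℕ.* w c g e) - + s)         ≡⟨ ∑-minus (λ e → + (suc q ℕ.* w c g e)) (λ _ → + s) ⟩
        ∑[ e < suc q ] (+ (suc q ℕ.* w c g e)) - ∑[ e < suc q ] (+ s)
          ≡⟨ cong₂ _-_ (trans (∑-pos (λ e → suc q ℕ.* w c g e)) (cong +_ (sym (ℕ-Sum.*-distribˡ-sum (suc q) (w c g)))))
                       (trans (∑-const (suc q) (+ s)) (sym (ℤₚ.pos-* (suc q) s))) ⟩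
        + (suc q ℕ.* s) - + (suc q ℕ.* s)                    ≡⟨ ℤₚ.+-inverseʳ (+ (suc q ℕ.* s)) ⟩
        0ℤ ∎
        where
        open ≡-Reasoning
        s = ℕ-Sum.sum (w c g)

    chosen total : (f : Fin T → Fin (suc q)) → Fin N → ℕ
    chosen f c = suc q ℕ.* ℕ-Sum.sum (λ g → w c g (f g))
    total  f c = ℕ-Sum.sum (λ g → ℕ-Sum.sum (w c g))

    discrepancy : (Fin T → Fin (suc q)) → Fin N → ℕ
    discrepancy f c = ∣ + chosen f c - + total f c ∣

    small-discrepancy : ∃ λ f → ∀ c →
      fourth (discrepancy f c ℕ.* discrepancy f c) ℕ.≤ N ℕ.* fourth (T ℕ.* (10 ℕ.* (A ℕ.* A)))
    small-discrepancy = finish (small-drift (A ℕ.* A) ξ bound mean)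
      where
      drift-eq : ∀ f c → ∑[ g < T ] ξ g c (f g) ≡ + chosen f c - + total f c
      drift-eq f c = trans (∑-minus (λ g → + (suc q ℕ.* w c g (f g))) (λ g → + ℕ-Sum.sum (w c g)))
          (cong₂ _-_ (trans (∑-pos (λ g → suc q ℕ.* w c g (f g))) (cong +_ (sym (ℕ-Sum.*-distribˡ-sum (suc q) (λ g → w c g (f g))))))
                     (∑-pos (λ g → ℕ-Sum.sum (w c g))))
      finish : (∃ λ f → ∀ c → let D = ∣ ∑[ g < T ] ξ g c (f g) ∣ in
                 fourth (D ℕ.* D) ℕ.≤ N ℕ.* fourth (T ℕ.* (10 ℕ.* (A ℕ.* A)))) →
               ∃ λ f → ∀ c → fourth (discrepancy f c ℕ.* discrepancy f c) ℕ.≤ N ℕ.* fourth (T ℕ.* (10 ℕ.* (A ℕ.* A)))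
      finish (f , p) = f , λ c → subst (λ z → fourth (∣ z ∣ ℕ.* ∣ z ∣) ℕ.≤ N ℕ.* fourth (T ℕ.* (10 ℕ.* (A ℕ.* A))))
                                       (drift-eq f c) (p c)

    balanced-choice : ∀ M n → N ℕ.* fourth (T ℕ.* (10 ℕ.* (A ℕ.* A))) ℕ.* fourth (M ℕ.* M) ℕ.< fourth (n ℕ.* n) →
      ∃ λ f → ∀ c → M ℕ.* chosen f c ℕ.≤ M ℕ.* total f c ℕ.+ n × M ℕ.* total f c ℕ.≤ M ℕ.* chosen f c ℕ.+ n
    balanced-choice M n large = finish small-discrepancy
      where
      open ℕₚ.≤-Reasoning
      fourth-square-mono : ∀ {x y} → x ℕ.≤ y → fourth (x ℕ.* x) ℕ.≤ fourth (y ℕ.* y)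
      fourth-square-mono {x} {y} h = subst₂ ℕ._≤_ (sym (fourth-def (x ℕ.* x))) (sym (fourth-def (y ℕ.* y))) (ℕₚ.*-mono-≤ (ℕₚ.*-mono-≤ sq sq) (ℕₚ.*-mono-≤ sq sq))
        where
        sq : x ℕ.* x ℕ.≤ y ℕ.* y
        sq = ℕₚ.*-mono-≤ h h
      identity : ∀ M d → ((M ℕ.* d ℕ.* (M ℕ.* d)) ℕ.* (M ℕ.* d ℕ.* (M ℕ.* d))) ℕ.* ((M ℕ.* d ℕ.* (M ℕ.* d)) ℕ.* (M ℕ.* d ℕ.* (M ℕ.* d)))
        ≡ ((d ℕ.* d) ℕ.* (d ℕ.* d)) ℕ.* ((d ℕ.* d) ℕ.* (d ℕ.* d)) ℕ.* (((M ℕ.* M) ℕ.* (M ℕ.* M)) ℕ.* ((M ℕ.* M) ℕ.* (M ℕ.* M)))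
      identity = ℕ-Ring.solve-∀
      scale : ∀ M d → fourth (M ℕ.* d ℕ.* (M ℕ.* d)) ≡ fourth (d ℕ.* d) ℕ.* fourth (M ℕ.* M)
      scale M d = trans (fourth-def _) (trans (identity M d) (sym (cong₂ ℕ._*_ (fourth-def (d ℕ.* d)) (fourth-def (M ℕ.* M)))))
      finish : (∃ λ f → ∀ c → fourth (discrepancy f c ℕ.* discrepancy f c) ℕ.≤ N ℕ.* fourth (T ℕ.* (10 ℕ.* (A ℕ.* A)))) →
        ∃ λ f → ∀ c → M ℕ.* chosen f c ℕ.≤ M ℕ.* total f c ℕ.+ n × M ℕ.* total f c ℕ.≤ M ℕ.* chosen f c ℕ.+ n
      finish (f , p) = f , λ c →
          (begin
            M ℕ.* chosen f c                              ≤⟨ ℕₚ.*-monoʳ-≤ M (≤-+-abs (chosen f c) (total f c)) ⟩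
            M ℕ.* (total f c ℕ.+ discrepancy f c)         ≡⟨ ℕₚ.*-distribˡ-+ M (total f c) _ ⟩
            M ℕ.* total f c ℕ.+ M ℕ.* discrepancy f c     ≤⟨ ℕₚ.+-monoʳ-≤ (M ℕ.* total f c) (small c) ⟩
            M ℕ.* total f c ℕ.+ n                         ∎) ,
          (begin
            M ℕ.* total f c                               ≤⟨ ℕₚ.*-monoʳ-≤ M (≤-+-abs (total f c) (chosen f c)) ⟩
            M ℕ.* (chosen f c ℕ.+ ∣ + total f c - + chosen f c ∣)
              ≡⟨ cong (λ z → M ℕ.* (chosen f c ℕ.+ z)) (ℤₚ.∣i-j∣≡∣j-i∣ (+ total f c) (+ chosen f c)) ⟩
            M ℕ.* (chosen f c ℕ.+ discrepancy f c)        ≡⟨ ℕₚ.*-distribˡ-+ M (chosen f c) _ ⟩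
            M ℕ.* chosen f c ℕ.+ M ℕ.* discrepancy f c    ≤⟨ ℕₚ.+-monoʳ-≤ (M ℕ.* chosen f c) (small c) ⟩
            M ℕ.* chosen f c ℕ.+ n                        ∎)
        where
          small : ∀ c → M ℕ.* discrepancy f c ℕ.≤ n
          small c with M ℕ.* discrepancy f c ℕ.≤? n
          ... | yes h = h
          ... | no ¬h = ⊥-elim (ℕₚ.<-irrefl refl (begin-strict
            fourth (n ℕ.* n)                                                ≤⟨ fourth-square-mono (ℕₚ.≰⇒≥ ¬h) ⟩
            fourth (M ℕ.* discrepancy f c ℕ.* (M ℕ.* discrepancy f c))      ≡⟨ scale M (discrepancy f c) ⟩
            fourth (discrepancy f c ℕ.* discrepancy f c) ℕ.* fourth (M ℕ.* M) ≤⟨ ℕₚ.*-monoˡ-≤ (fourth (M ℕ.* M)) (p c) ⟩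
            N ℕ.* fourth (T ℕ.* (10 ℕ.* (A ℕ.* A))) ℕ.* fourth (M ℕ.* M)    <⟨ large ⟩
            fourth (n ℕ.* n)                                                ∎))

module HamiltonPacking where

  open import Defs renaming (sym to adj-sym)
  open import Data.Nat
  open import Data.Nat.Properties
  open import Data.Nat.DivMod
  open import Data.Nat.Divisibility using (_∣_; divides; m%n≡0⇒n∣m; n∣m⇒m%n≡0; m≤n⇒m!∣n!; ∣-trans; ∣m+n∣m⇒∣n; ∣1⇒≡1; m∣m*n; ∣n⇒∣m*n)
  open import Data.Nat.Tactic.RingSolver using (solve-∀)
  open import Data.Bool using (Bool; true; false; _∧_; _∨_; not; if_then_else_)
  open import Data.Fin as Fin using (Fin; zero; suc; toℕ; fromℕ<; combine; remQuot; punchIn)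
  import Data.Fin.Properties as Fin
  open import Data.List using (List; []; _∷_; _++_; [_]; length; reverse; concat; map; lookup; allFin; tabulate)
  open import Data.List.Properties using (++-identityʳ; length-++; unfold-reverse; length-map; length-tabulate)
  open import Data.Product using (Σ; ∃; ∃₂; _×_; _,_; proj₁; proj₂; uncurry)
  open import Data.Sum using (_⊎_; inj₁; inj₂)
  open import Data.Empty using (⊥; ⊥-elim)
  open import Function using (_∘_; id; case_of_; _⟨_⟩_)
  open import Relation.Nullary using (¬_; Dec; yes; no; does; contradiction)
  open import Relation.Nullary.Decidable using (dec-true; _×-dec_)
  open import Relation.Binary.PropositionalEquality hiding ([_])
  open import Algebra.Properties.Semiring.Sum +-*-semiring using (sum; sum-syntax; sum-cong-≗; ∑-distrib-+; ∑-comm; *-distribˡ-sum; *-distribʳ-sum; ∑-permute)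
  import Data.Bool.Properties as Bool
  open import Data.List.Membership.Propositional using (_∈_)
  open import Data.List.Membership.Propositional.Properties using (∈-++⁻)
  open import Data.List.Relation.Unary.Any using (here; there)
  open import Data.Fin.Permutation.Components using (transpose)
  import Data.Fin.Permutation as Perm
  open import Data.Nat.Primality using (Prime; prime⇒nonZero; prime⇒nonTrivial; euclidsLemma; ¬prime[1])
  open import Data.Nat.Primality.Factorisation using (factorise)
  open import Data.Nat.Coprimality using (coprime-Bézout; prime⇒coprime)
  open import Data.Nat.GCD using (module Bézout)
  open import Data.List.Relation.Unary.All as All using (All)
  import Data.Nat.ListAction as ListAction
  open EighthMoment using (fourth; fourth-def; module Discrepancy)

  -- Sums over Fin n and over lists

  -- Linear arithmetic: `L ≤ R` is a nonnegative combination of known inequalities, and the ring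
  -- solver verifies the identity, in which `s` is the slack.
  lin : ∀ {L R A B} s → L ≤ R → A + R + s ≡ B + L → A ≤ B
  lin {L} {R} {A} {B} s h eq =
    +-cancelʳ-≤ R A B (≤-trans (m≤m+n (A + R) s) (≤-trans (≤-reflexive eq) (+-monoʳ-≤ B h)))

  ∑-mono : ∀ {n} {f g : Fin n → ℕ} → (∀ i → f i ≤ g i) → sum f ≤ sum g
  ∑-mono {zero}  h = z≤n
  ∑-mono {suc n} h = +-mono-≤ (h zero) (∑-mono (h ∘ suc))

  ∑-const : ∀ n c → ∑[ i < n ] c ≡ n * c
  ∑-const zero    c = refl
  ∑-const (suc n) c = cong (c +_) (∑-const n c)

  ∑-≤-const : ∀ {n} c {f : Fin n → ℕ} → (∀ i → f i ≤ c) → sum f ≤ n * c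
  ∑-≤-const {n} c h = ≤-trans (∑-mono h) (≤-reflexive (∑-const n c))

  ∑-zero : ∀ {n} {f : Fin n → ℕ} → (∀ i → f i ≡ 0) → sum f ≡ 0
  ∑-zero {n} h = trans (sum-cong-≗ h) (trans (∑-const n 0) (*-zeroʳ n))

  term≤∑ : ∀ {n} (f : Fin n → ℕ) i → f i ≤ sum f
  term≤∑ f zero    = m≤m+n _ _
  term≤∑ f (suc i) = ≤-trans (term≤∑ (f ∘ suc) i) (m≤n+m _ _)

  ∑-find-small : ∀ {n} c (f : Fin n → ℕ) → sum f < n * c → ∃ λ i → f i < c
  ∑-find-small {zero}  c f ()
  ∑-find-small {suc n} c f h with f zero <? c
  ... | yes p = zero , p
  ... | no ¬p with ∑-find-small {n} c (f ∘ suc)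
                     (+-cancelˡ-< c _ _ (≤-<-trans (+-monoˡ-≤ _ (≮⇒≥ ¬p)) h))
  ...   | i , q = suc i , q

  ∑-find-pos : ∀ {n} (f : Fin n → ℕ) → 0 < sum f → ∃ λ i → 0 < f i
  ∑-find-pos {zero}  f ()
  ∑-find-pos {suc n} f h with 0 <? f zero
  ... | yes p = zero , p
  ... | no ¬p with ∑-find-pos {n} (f ∘ suc) (subst (λ z → 0 < z + sum (f ∘ suc)) (n≤0⇒n≡0 (≮⇒≥ ¬p)) h)
  ...   | i , q = suc i , q

  ∑-combine : ∀ m n (f : Fin m → Fin n → ℕ) →
              ∑[ k < m * n ] uncurry f (remQuot n k) ≡ ∑[ i < m ] ∑[ j < n ] f i j
  ∑-combine zero    n f = refl
  ∑-combine (suc m) n f = trans (split n (m * n) _)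
      (cong₂ _+_ (sum-cong-≗ λ j → cong (uncurry f) (left j))
                 (trans (sum-cong-≗ λ k → cong (uncurry f) (right k)) (∑-combine m n (f ∘ suc))))
    where
    split : ∀ a b (g : Fin (a + b) → ℕ) → sum g ≡ ∑[ i < a ] g (i Fin.↑ˡ b) + ∑[ j < b ] g (a Fin.↑ʳ j)
    split zero    b g = refl
    split (suc a) b g = trans (cong (g zero +_) (split a b (g ∘ suc))) (sym (+-assoc (g zero) _ _))
    left : ∀ j → remQuot {suc m} n (j Fin.↑ˡ (m * n)) ≡ (zero , j)
    left j rewrite Fin.splitAt-↑ˡ n j (m * n) = refl
    right : ∀ k → remQuot {suc m} n (n Fin.↑ʳ k) ≡ (suc (proj₁ (remQuot {m} n k)) , proj₂ (remQuot {m} n k))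
    right k rewrite Fin.splitAt-↑ʳ n (m * n) k = refl

  ⟦_⟧ : Bool → ℕ
  ⟦ true ⟧  = 1
  ⟦ false ⟧ = 0

  ⟦⟧≤1 : ∀ b → ⟦ b ⟧ ≤ 1
  ⟦⟧≤1 true  = ≤-refl
  ⟦⟧≤1 false = z≤n

  ⟦∧⟧ : ∀ a b → ⟦ a ∧ b ⟧ ≡ ⟦ a ⟧ * ⟦ b ⟧
  ⟦∧⟧ true  b = sym (+-identityʳ _)
  ⟦∧⟧ false b = refl

  ⟦∨⟧ : ∀ a b → ⟦ a ∨ b ⟧ ≤ ⟦ a ⟧ + ⟦ b ⟧
  ⟦∨⟧ true  b = m≤m+n 1 _
  ⟦∨⟧ false b = ≤-refl

  ⟦not⟧ : ∀ a → ⟦ not a ⟧ + ⟦ a ⟧ ≡ 1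
  ⟦not⟧ true  = refl
  ⟦not⟧ false = refl

  ⟦⟧-pos : ∀ {b} → 0 < ⟦ b ⟧ → b ≡ true
  ⟦⟧-pos {true} _ = refl

  ⟦⟧-true : ∀ {b} → b ≡ true → ⟦ b ⟧ ≡ 1
  ⟦⟧-true refl = refl

  ⟦not⟧-zero : ∀ {b} → ⟦ not b ⟧ ≡ 0 → b ≡ true
  ⟦not⟧-zero {true} _ = refl

  ⟦⟧-mono : ∀ {a b} → (a ≡ true → b ≡ true) → ⟦ a ⟧ ≤ ⟦ b ⟧
  ⟦⟧-mono {true}  h rewrite h refl = ≤-refl
  ⟦⟧-mono {false} h = z≤n

  ∧-true : ∀ {a b} → a ∧ b ≡ true → a ≡ true × b ≡ true
  ∧-true {true} {true} refl = refl , refl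

  ∨-true : ∀ {a b} → a ∨ b ≡ true → a ≡ true ⊎ b ≡ true
  ∨-true {true}  _ = inj₁ refl
  ∨-true {false} h = inj₂ h

  ∨-introˡ : ∀ {a} b → a ≡ true → a ∨ b ≡ true
  ∨-introˡ b refl = refl

  ∨-introʳ : ∀ a {b} → b ≡ true → a ∨ b ≡ true
  ∨-introʳ true  _ = refl
  ∨-introʳ false h = h

  does-true : ∀ {p} {P : Set p} (d : Dec P) → does d ≡ true → P
  does-true (yes p) _ = p

  δ : ∀ {n} → Fin n → Fin n → ℕ
  δ u v = ⟦ does (u Fin.≟ v) ⟧

  δ-refl : ∀ {n} (u : Fin n) → δ u u ≡ 1
  δ-refl u = ⟦⟧-true (dec-true (u Fin.≟ u) refl)

  δ-pos : ∀ {n} {u v : Fin n} → 0 < δ u v → u ≡ v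
  δ-pos {u = u} {v} h = does-true (u Fin.≟ v) (⟦⟧-pos h)

  δ-suc : ∀ {n} (u v : Fin n) → δ (suc u) (suc v) ≡ δ u v
  δ-suc u v with u Fin.≟ v
  ... | yes _ = refl
  ... | no _  = refl

  ∑-δ : ∀ {n} (f : Fin n → ℕ) v → ∑[ u < n ] (δ v u * f u) ≡ f v
  ∑-δ {suc n} f zero = trans (cong₂ _+_ (*-identityˡ (f zero)) (∑-zero {n} λ _ → refl)) (+-identityʳ _)
  ∑-δ {suc n} f (suc v) = trans (sum-cong-≗ λ u → cong (_* f (suc u)) (δ-suc v u)) (∑-δ (f ∘ suc) v)

  ∑-δ-one : ∀ {n} (v : Fin n) → ∑[ u < n ] δ v u ≡ 1
  ∑-δ-one v = trans (sum-cong-≗ λ u → sym (*-identityʳ (δ v u))) (∑-δ (λ _ → 1) v)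

  δ-sym : ∀ {n} (u v : Fin n) → δ u v ≡ δ v u
  δ-sym u v with u Fin.≟ v | v Fin.≟ u
  ... | yes _ | yes _ = refl
  ... | no _  | no _  = refl
  ... | yes refl | no q = ⊥-elim (q refl)
  ... | no q | yes refl = ⊥-elim (q refl)

  ∑-unique : ∀ {n} (b : Fin n → Bool) → (∀ i j → b i ≡ true → b j ≡ true → i ≡ j) → ∑[ i < n ] ⟦ b i ⟧ ≤ 1
  ∑-unique {zero}  b h = z≤n
  ∑-unique {suc n} b h with b zero in eq
  ... | true  = ≤-reflexive (cong suc (∑-zero {n} λ i → lem i))
    where
    lem : ∀ i → ⟦ b (suc i) ⟧ ≡ 0
    lem i with b (suc i) in eq′
    ... | false = refl
    ... | true  with () ← h zero (suc i) eq eq′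
  ... | false = ∑-unique (b ∘ suc) λ i j p q → Fin.suc-injective (h (suc i) (suc j) p q)

  ∑-injective : ∀ {m n} (ι : Fin m → Fin n) → (∀ i j → ι i ≡ ι j → i ≡ j) → (f : Fin n → ℕ) →
                ∑[ i < m ] f (ι i) ≤ sum f
  ∑-injective {m} {n} ι inj f = begin
    ∑[ i < m ] f (ι i)                       ≡⟨ sum-cong-≗ (λ i → sym (∑-δ f (ι i))) ⟩
    ∑[ i < m ] ∑[ k < n ] (δ (ι i) k * f k)  ≡⟨ ∑-comm (λ i k → δ (ι i) k * f k) ⟩
    ∑[ k < n ] ∑[ i < m ] (δ (ι i) k * f k)  ≡⟨ sum-cong-≗ (λ k → sym (*-distribʳ-sum (f k) (λ i → δ (ι i) k))) ⟩
    ∑[ k < n ] ((∑[ i < m ] δ (ι i) k) * f k) ≤⟨ ∑-mono (λ k → ≤-trans (*-monoˡ-≤ (f k) (one k)) (≤-reflexive (*-identityˡ (f k)))) ⟩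
    sum f ∎
    where
    open ≤-Reasoning
    one : ∀ k → ∑[ i < m ] δ (ι i) k ≤ 1
    one k = ∑-unique (λ i → does (ι i Fin.≟ k)) λ i j p q →
              inj i j (trans (does-true (ι i Fin.≟ k) p) (sym (does-true (ι j Fin.≟ k) q)))

  lsum : ∀ {a} {A : Set a} → (A → ℕ) → List A → ℕ
  lsum g []      = 0
  lsum g (x ∷ l) = g x + lsum g l

  lsum-++ : ∀ {a} {A : Set a} (g : A → ℕ) l m → lsum g (l ++ m) ≡ lsum g l + lsum g m
  lsum-++ g []      m = refl
  lsum-++ g (x ∷ l) m = trans (cong (g x +_) (lsum-++ g l m)) (sym (+-assoc (g x) _ _))

  lsum-reverse : ∀ {a} {A : Set a} (g : A → ℕ) l → lsum g (reverse l) ≡ lsum g l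
  lsum-reverse g []      = refl
  lsum-reverse g (x ∷ l) = begin
    lsum g (reverse (x ∷ l))          ≡⟨ cong (lsum g) (unfold-reverse x l) ⟩
    lsum g (reverse l ++ [ x ])       ≡⟨ lsum-++ g (reverse l) [ x ] ⟩
    lsum g (reverse l) + (g x + 0)    ≡⟨ cong₂ _+_ (lsum-reverse g l) (+-identityʳ (g x)) ⟩
    lsum g l + g x                    ≡⟨ +-comm (lsum g l) (g x) ⟩
    g x + lsum g l                    ∎
    where open ≡-Reasoning

  lsum-mono : ∀ {a} {A : Set a} {f g : A → ℕ} → (∀ x → f x ≤ g x) → ∀ l → lsum f l ≤ lsum g l
  lsum-mono h []      = z≤n
  lsum-mono h (x ∷ l) = +-mono-≤ (h x) (lsum-mono h l)

  lsum-cong : ∀ {a} {A : Set a} {f g : A → ℕ} → (∀ x → f x ≡ g x) → ∀ l → lsum f l ≡ lsum g l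
  lsum-cong h []      = refl
  lsum-cong h (x ∷ l) = cong₂ _+_ (h x) (lsum-cong h l)

  lsum-const : ∀ {a} {A : Set a} c (l : List A) → lsum (λ _ → c) l ≡ length l * c
  lsum-const c []      = refl
  lsum-const c (x ∷ l) = cong (c +_) (lsum-const c l)

  lsum-+ : ∀ {a} {A : Set a} (f g : A → ℕ) l → lsum (λ x → f x + g x) l ≡ lsum f l + lsum g l
  lsum-+ f g []      = refl
  lsum-+ f g (x ∷ l) = trans (cong (f x + g x +_) (lsum-+ f g l)) (lem (f x) (g x) _ _)
    where
    lem : ∀ a b c d → a + b + (c + d) ≡ a + c + (b + d)
    lem = solve-∀

  lsum-* : ∀ {a} {A : Set a} c (f : A → ℕ) l → lsum (λ x → c * f x) l ≡ c * lsum f l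
  lsum-* c f []      = sym (*-zeroʳ c)
  lsum-* c f (x ∷ l) = trans (cong (c * f x +_) (lsum-* c f l)) (sym (*-distribˡ-+ c (f x) _))

  lsum-∑ : ∀ {a} {A : Set a} {n} (f : Fin n → A → ℕ) l →
           lsum (λ x → ∑[ i < n ] f i x) l ≡ ∑[ i < n ] lsum (f i) l
  lsum-∑ {n = n} f []      = sym (∑-zero {n} λ _ → refl)
  lsum-∑ f (x ∷ l) = trans (cong (sum (λ i → f i x) +_) (lsum-∑ f l)) (sym (∑-distrib-+ (λ i → f i x) _))

  lsum-concat : ∀ {a} {A : Set a} (g : A → ℕ) ls → lsum g (concat ls) ≡ lsum (lsum g) ls
  lsum-concat g []       = refl
  lsum-concat g (l ∷ ls) = trans (lsum-++ g l (concat ls)) (cong (lsum g l +_) (lsum-concat g ls))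

  lsum-find : ∀ {a} {A : Set a} (g : A → ℕ) l → 0 < lsum g l →
              ∃₂ λ pre x → ∃ λ post → l ≡ pre ++ x ∷ post × 0 < g x
  lsum-find g [] ()
  lsum-find g (x ∷ l) h with 0 <? g x
  ... | yes p = [] , x , l , refl , p
  ... | no ¬p with lsum-find g l (subst (λ z → 0 < z + lsum g l) (n≤0⇒n≡0 (≮⇒≥ ¬p)) h)
  ...   | pre , y , post , refl , q = x ∷ pre , y , post , refl , q

  lsum-find-small : ∀ {a} {A : Set a} c (g : A → ℕ) l → lsum g l < length l * c →
                    ∃₂ λ pre x → ∃ λ post → l ≡ pre ++ x ∷ post × g x < c
  lsum-find-small c g [] ()
  lsum-find-small c g (x ∷ l) h with g x <? c
  ... | yes p = [] , x , l , refl , p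
  ... | no ¬p with lsum-find-small c g l (+-cancelˡ-< c _ _ (≤-<-trans (+-monoˡ-≤ _ (≮⇒≥ ¬p)) h))
  ...   | pre , y , post , refl , q = x ∷ pre , y , post , refl , q

  lsum-remove : ∀ {a} {A : Set a} (g : A → ℕ) pre x post →
                lsum g (pre ++ x ∷ post) ≡ g x + lsum g (pre ++ post)
  lsum-remove g pre x post = begin
    lsum g (pre ++ x ∷ post)              ≡⟨ lsum-++ g pre (x ∷ post) ⟩
    lsum g pre + (g x + lsum g post)      ≡⟨ lem (lsum g pre) (g x) (lsum g post) ⟩
    g x + (lsum g pre + lsum g post)      ≡⟨ cong (g x +_) (sym (lsum-++ g pre post)) ⟩
    g x + lsum g (pre ++ post)            ∎
    where
    open ≡-Reasoning
    lem : ∀ a b c → a + (b + c) ≡ b + (a + c)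
    lem = solve-∀

  length-remove : ∀ {A : Set} pre (x : A) post → length (pre ++ x ∷ post) ≡ suc (length (pre ++ post))
  length-remove []        x post = refl
  length-remove (_ ∷ pre) x post = cong suc (length-remove pre x post)

  cnt : ∀ {n} → Fin n → List (Fin n) → ℕ
  cnt v = lsum (λ x → δ x v)

  -- With multiplicities instead of permutations, rotating, reversing and concatenating lists are
  -- matters of additivity.
  VertexOrder : ∀ {n} → List (Fin n) → Set
  VertexOrder l = ∀ v → cnt v l ≡ 1

  lsum-cnt : ∀ {n} (g : Fin n → ℕ) l → lsum g l ≡ ∑[ v < n ] (cnt v l * g v)
  lsum-cnt {n} g l = begin
    lsum g l                                    ≡⟨ lsum-cong (λ x → sym (∑-δ g x)) l ⟩
    lsum (λ x → ∑[ v < n ] (δ x v * g v)) l     ≡⟨ lsum-∑ (λ v x → δ x v * g v) l ⟩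
    ∑[ v < n ] lsum (λ x → δ x v * g v) l       ≡⟨ sum-cong-≗ (λ v → trans (lsum-cong (λ x → *-comm (δ x v) (g v)) l)
                                                       (trans (lsum-* (g v) (λ x → δ x v) l) (*-comm (g v) _))) ⟩
    ∑[ v < n ] (cnt v l * g v)                  ∎
    where open ≡-Reasoning

  lsum-ordering : ∀ {n} (g : Fin n → ℕ) {l} → VertexOrder l → lsum g l ≡ sum g
  lsum-ordering g {l} o = trans (lsum-cnt g l) (sum-cong-≗ λ v → trans (cong (_* g v) (o v)) (*-identityˡ (g v)))

  length-ordering : ∀ {n} {l : List (Fin n)} → VertexOrder l → length l ≡ n
  length-ordering {n} {l} o = begin
    length l          ≡⟨ sym (*-identityʳ _) ⟩
    length l * 1      ≡⟨ sym (lsum-const 1 l) ⟩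
    lsum (λ _ → 1) l  ≡⟨ lsum-ordering (λ _ → 1) {l} o ⟩
    ∑[ v < n ] 1      ≡⟨ ∑-const n 1 ⟩
    n * 1             ≡⟨ *-identityʳ n ⟩
    n                 ∎
    where open ≡-Reasoning

  -- It expresses counts of consecutive pairs as well as statements on all of them, the latter as
  -- the vanishing of a sum of failure indicators.
  pairSum : ∀ {a} {A : Set a} → (A → A → ℕ) → List A → ℕ
  pairSum f []          = 0
  pairSum f (x ∷ [])    = 0
  pairSum f (x ∷ y ∷ l) = f x y + pairSum f (y ∷ l)

  module _ {a} {A : Set a} where

    pairSum-mono : {f g : A → A → ℕ} → (∀ x y → f x y ≤ g x y) → ∀ l → pairSum f l ≤ pairSum g l
    pairSum-mono h []          = z≤n
    pairSum-mono h (x ∷ [])    = z≤n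
    pairSum-mono h (x ∷ y ∷ l) = +-mono-≤ (h x y) (pairSum-mono h (y ∷ l))

    pairSum-cong : {f g : A → A → ℕ} → (∀ x y → f x y ≡ g x y) → ∀ l → pairSum f l ≡ pairSum g l
    pairSum-cong h []          = refl
    pairSum-cong h (x ∷ [])    = refl
    pairSum-cong h (x ∷ y ∷ l) = cong₂ _+_ (h x y) (pairSum-cong h (y ∷ l))

    pairSum-+ : (f g : A → A → ℕ) → ∀ l → pairSum (λ x y → f x y + g x y) l ≡ pairSum f l + pairSum g l
    pairSum-+ f g []          = refl
    pairSum-+ f g (x ∷ [])    = refl
    pairSum-+ f g (x ∷ y ∷ l) = trans (cong (f x y + g x y +_) (pairSum-+ f g (y ∷ l))) (lem (f x y) (g x y) _ _)
      where
      lem : ∀ a b c d → a + b + (c + d) ≡ a + c + (b + d)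
      lem = solve-∀

    pairSum-∑ : ∀ {n} (f : Fin n → A → A → ℕ) l →
                pairSum (λ x y → ∑[ i < n ] f i x y) l ≡ ∑[ i < n ] pairSum (f i) l
    pairSum-∑ {n} f []          = sym (∑-zero {n} λ _ → refl)
    pairSum-∑ {n} f (x ∷ [])    = sym (∑-zero {n} λ _ → refl)
    pairSum-∑ f (x ∷ y ∷ l) =
      trans (cong (sum (λ i → f i x y) +_) (pairSum-∑ f (y ∷ l))) (sym (∑-distrib-+ (λ i → f i x y) _))

    pairSum-fst : (g : A → ℕ) → ∀ l → pairSum (λ x _ → g x) l ≤ lsum g l
    pairSum-fst g []          = z≤n
    pairSum-fst g (x ∷ [])    = z≤n
    pairSum-fst g (x ∷ y ∷ l) = +-monoʳ-≤ (g x) (pairSum-fst g (y ∷ l))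

    pairSum-snd-tail : (g : A → ℕ) → ∀ x l → pairSum (λ _ y → g y) (x ∷ l) ≡ lsum g l
    pairSum-snd-tail g x []      = refl
    pairSum-snd-tail g x (y ∷ l) = cong (g y +_) (pairSum-snd-tail g y l)

    pairSum-snd : (g : A → ℕ) → ∀ l → pairSum (λ _ y → g y) l ≤ lsum g l
    pairSum-snd g []      = z≤n
    pairSum-snd g (x ∷ l) = ≤-trans (≤-reflexive (pairSum-snd-tail g x l)) (m≤n+m _ (g x))

    lst : A → List A → A
    lst x []      = x
    lst x (y ∷ l) = lst y l

    lst-++ : ∀ x l y m → lst x (l ++ y ∷ m) ≡ lst y m
    lst-++ x []      y m = refl
    lst-++ x (z ∷ l) y m = lst-++ z l y m

    pairSum-++ : (f : A → A → ℕ) → ∀ x l y m →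
                 pairSum f (x ∷ l ++ y ∷ m) ≡ pairSum f (x ∷ l) + (f (lst x l) y + pairSum f (y ∷ m))
    pairSum-++ f x []      y m = refl
    pairSum-++ f x (z ∷ l) y m = trans (cong (f x z +_) (pairSum-++ f z l y m)) (sym (+-assoc (f x z) _ _))

    reverse-view : ∀ y l → ∃ λ r → reverse (y ∷ l) ≡ lst y l ∷ r × lst (lst y l) r ≡ y
    reverse-view y []      = [] , refl , refl
    reverse-view y (z ∷ l) with r , eq , last-r ← reverse-view z l =
      r ++ [ y ] , trans (unfold-reverse y (z ∷ l)) (cong (_++ [ y ]) eq) , lst-++ (lst z l) r y []

    pairSum-reverse : (f : A → A → ℕ) → (∀ x y → f x y ≡ f y x) → ∀ l → pairSum f (reverse l) ≡ pairSum f l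
    pairSum-reverse f s []      = refl
    pairSum-reverse f s (x ∷ l) = go x l
      where
      open ≡-Reasoning
      go : ∀ x l → pairSum f (reverse (x ∷ l)) ≡ pairSum f (x ∷ l)
      go x []      = refl
      go x (y ∷ l) with r , eq , last-r ← reverse-view y l = begin
        pairSum f (reverse (x ∷ y ∷ l))                       ≡⟨ cong (pairSum f) (unfold-reverse x (y ∷ l)) ⟩
        pairSum f (reverse (y ∷ l) ++ [ x ])                  ≡⟨ cong (λ t → pairSum f (t ++ [ x ])) eq ⟩
        pairSum f (lst y l ∷ r ++ [ x ])                      ≡⟨ pairSum-++ f (lst y l) r x [] ⟩
        pairSum f (lst y l ∷ r) + (f (lst (lst y l) r) x + 0) ≡⟨ cong₂ _+_ (trans (cong (pairSum f) (sym eq)) (go y l))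
                                                                  (trans (+-identityʳ _) (trans (cong (λ t → f t x) last-r) (s y x))) ⟩
        pairSum f (y ∷ l) + f x y                             ≡⟨ +-comm _ (f x y) ⟩
        f x y + pairSum f (y ∷ l)                             ∎

    pairSum-find : (f : A → A → ℕ) → ∀ x l → 0 < pairSum f (x ∷ l) →
                   ∃₂ λ pre y → ∃ λ post → l ≡ pre ++ y ∷ post × 0 < f (lst x pre) y
    pairSum-find f x (y ∷ l) h with 0 <? f x y
    ... | yes p = [] , y , l , refl , p
    ... | no ¬p with pairSum-find f y l (subst (λ z → 0 < z + pairSum f (y ∷ l)) (n≤0⇒n≡0 (≮⇒≥ ¬p)) h)
    ...   | pre , y′ , post , eq , q = y ∷ pre , y′ , post , cong (y ∷_) eq , q

    pairSum-fst-lst : (g : A → ℕ) → ∀ x l → pairSum (λ x _ → g x) (x ∷ l) + g (lst x l) ≡ lsum g (x ∷ l)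
    pairSum-fst-lst g x []      = sym (+-identityʳ (g x))
    pairSum-fst-lst g x (y ∷ l) = trans (+-assoc (g x) _ _) (cong (g x +_) (pairSum-fst-lst g y l))

    pairSum-* : ∀ c (f : A → A → ℕ) l → pairSum (λ x y → c * f x y) l ≡ c * pairSum f l
    pairSum-* c f []          = sym (*-zeroʳ c)
    pairSum-* c f (x ∷ [])    = sym (*-zeroʳ c)
    pairSum-* c f (x ∷ y ∷ l) = trans (cong (c * f x y +_) (pairSum-* c f (y ∷ l))) (sym (*-distribˡ-+ c (f x y) _))

    pairSum-lookup : (f : A → A → ℕ) → ∀ l (i j : Fin (length l)) → toℕ j ≡ suc (toℕ i) →
                     f (lookup l i) (lookup l j) ≤ pairSum f l
    pairSum-lookup f (x ∷ y ∷ l) zero (suc zero) _ = m≤m+n _ _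
    pairSum-lookup f (x ∷ y ∷ l) (suc i) (suc j) h =
      ≤-trans (pairSum-lookup f (y ∷ l) i j (suc-injective h)) (m≤n+m _ (f x y))

  threshold : (q B M : ℕ) → ℕ
  threshold q B M = fourth (10 * (suc q * B * (suc q * B))) * fourth (M * M)

  -- A deviation D satisfies D⁸ ≤ N (10 T A²)⁴ with A = `suc q * B`. Hence (M D)⁸ ≤ n³ · n⁴ ·
  -- `threshold q B M` < n⁸.
  balanced-choice : ∀ {T q N} B (w : Fin N → Fin T → Fin (suc q) → ℕ) → (∀ c g e → w c g e ≤ B) →
    ∀ M n → N ≤ n * n * n → T ≤ n → threshold q B M < n →
    ∃ λ (f : Fin T → Fin (suc q)) → ∀ c →
      M * (suc q * (∑[ g < T ] w c g (f g))) ≤ M * (∑[ g < T ] ∑[ e < suc q ] w c g e) + n ×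
      M * (∑[ g < T ] ∑[ e < suc q ] w c g e) ≤ M * (suc q * (∑[ g < T ] w c g (f g))) + n
  balanced-choice {T} {q} {N} B w w≤B M n N≤n³ T≤n large =
    Discrepancy.balanced-choice B w w≤B M n (begin-strict
      N * fourth (T * b) * fourth (M * M)                          ≤⟨ *-monoˡ-≤ (fourth (M * M)) (*-mono-≤ N≤n³ (fourth-mono (*-monoˡ-≤ b T≤n))) ⟩
      n * n * n * fourth (n * b) * fourth (M * M)                  ≡⟨ cong (λ z → n * n * n * z * fourth (M * M)) (fourth-* n b) ⟩
      n * n * n * (fourth n * fourth b) * fourth (M * M)           ≡⟨ regroup (n * n * n) (fourth n) (fourth b) (fourth (M * M)) ⟩
      threshold q B M * (n * n * n * fourth n)                     <⟨ *-monoˡ-< (n * n * n * fourth n) {{>-nonZero positive}} large ⟩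
      n * (n * n * n * fourth n)                                   ≡⟨ eighth ⟩
      fourth (n * n)                                               ∎)
    where
    open ≤-Reasoning
    b = 10 * (suc q * B * (suc q * B))
    regroup : ∀ a b c d → a * (b * c) * d ≡ c * d * (a * b)
    regroup = solve-∀
    fourth-mono : ∀ {x y} → x ≤ y → fourth x ≤ fourth y
    fourth-mono {x} {y} h = subst₂ _≤_ (sym (fourth-def x)) (sym (fourth-def y)) (*-mono-≤ (*-mono-≤ h h) (*-mono-≤ h h))
    fourth-* : ∀ x y → fourth (x * y) ≡ fourth x * fourth y
    fourth-* x y = trans (fourth-def (x * y)) (trans (identity x y) (sym (cong₂ _*_ (fourth-def x) (fourth-def y))))
      where
      identity : ∀ x y → (x * y * (x * y)) * (x * y * (x * y)) ≡ ((x * x) * (x * x)) * ((y * y) * (y * y))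
      identity = solve-∀
    0<n : 0 < n
    0<n = ≤-<-trans z≤n large
    positive : 0 < n * n * n * fourth n
    positive = subst (λ z → 0 < n * n * n * z) (sym (fourth-def n))
      (*-mono-≤ (*-mono-≤ (*-mono-≤ 0<n 0<n) 0<n) (*-mono-≤ (*-mono-≤ 0<n 0<n) (*-mono-≤ 0<n 0<n)))
    eighth : n * (n * n * n * fourth n) ≡ fourth (n * n)
    eighth = trans (cong (λ z → n * (n * n * n * z)) (fourth-def n)) (trans (identity n) (sym (fourth-def (n * n))))
      where
      identity : ∀ n → n * (n * n * n * ((n * n) * (n * n))) ≡ (n * n * (n * n)) * (n * n * (n * n))
      identity = solve-∀

  -- Closing a gap and inserting a path

  cycSum : ∀ {a} {A : Set a} → (A → A → ℕ) → List A → ℕ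
  cycSum f []      = 0
  cycSum f (x ∷ l) = f (lst x l) x + pairSum f (x ∷ l)

  module _ {a} {A : Set a} where

    cycSum-mono : {f g : A → A → ℕ} → (∀ x y → f x y ≤ g x y) → ∀ l → cycSum f l ≤ cycSum g l
    cycSum-mono h []      = z≤n
    cycSum-mono h (x ∷ l) = +-mono-≤ (h (lst x l) x) (pairSum-mono h (x ∷ l))

    cycSum-rotate : (f : A → A → ℕ) → ∀ x l y m → cycSum f ((x ∷ l) ++ y ∷ m) ≡ cycSum f ((y ∷ m) ++ x ∷ l)
    cycSum-rotate f x l y m
      rewrite lst-++ x l y m | lst-++ y m x l | pairSum-++ f x l y m | pairSum-++ f y m x l =
      swap (f (lst y m) x) (pairSum f (x ∷ l)) (f (lst x l) y) (pairSum f (y ∷ m))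
      where
      swap : ∀ a b c d → a + (b + (c + d)) ≡ c + (d + (a + b))
      swap = solve-∀

    -- Reversing the segment from `y` to `a` exchanges the pairs ab and xy of the cyclic sequence
    -- for ax and by. The pairs inside the segment are only turned round, which a symmetric `f` does
    -- not notice.
    cycSum-2-opt : (f : A → A → ℕ) → (∀ x y → f x y ≡ f y x) → ∀ b l y m →
      let a = lst y m ; x = lst b l in
      cycSum f ((b ∷ l) ++ reverse (y ∷ m)) + (f a b + f x y) ≡ cycSum f ((b ∷ l) ++ y ∷ m) + (f a x + f b y)
    cycSum-2-opt f s b l y m with r , eq , last-r ← reverse-view y m
      rewrite eq | lst-++ b l (lst y m) r | last-r | lst-++ b l y m
            | pairSum-++ f b l (lst y m) r | pairSum-++ f b l y m
            | trans (cong (pairSum f) (sym eq)) (pairSum-reverse f s (y ∷ m))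
            | s (lst b l) (lst y m) | s y b =
      swap (f b y) (pairSum f (b ∷ l)) (f (lst y m) (lst b l)) (pairSum f (y ∷ m)) (f (lst y m) b) (f (lst b l) y)
      where
      swap : ∀ a b c d e g → a + (b + (c + d)) + (e + g) ≡ e + (b + (g + d)) + (c + a)
      swap = solve-∀

  module _ {n : ℕ} where

    private
      V = Fin n

    isEdge : V → V → V → V → Bool
    isEdge u v x y = (does (u Fin.≟ x) ∧ does (v Fin.≟ y)) ∨ (does (u Fin.≟ y) ∧ does (v Fin.≟ x))

    addEdges : List (V × V) → (V → V → Bool) → V → V → Bool
    addEdges []             R x y = R x y
    addEdges ((u , v) ∷ es) R x y = isEdge u v x y ∨ addEdges es R x y

    Symmetric : (V → V → Bool) → Set
    Symmetric R = ∀ x y → R x y ≡ R y x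

    isEdge-sym : ∀ u v → Symmetric (isEdge u v)
    isEdge-sym u v x y = Bool.∨-comm (does (u Fin.≟ x) ∧ does (v Fin.≟ y)) _

    addEdges-sym : ∀ es {R} → Symmetric R → Symmetric (addEdges es R)
    addEdges-sym []             s x y = s x y
    addEdges-sym ((u , v) ∷ es) s x y = cong₂ _∨_ (isEdge-sym u v x y) (addEdges-sym es s x y)

    addEdges-⊇ : ∀ es {R x y} → R x y ≡ true → addEdges es R x y ≡ true
    addEdges-⊇ []       h = h
    addEdges-⊇ (e ∷ es) h = ∨-introʳ (isEdge (proj₁ e) (proj₂ e) _ _) (addEdges-⊇ es h)

    addEdges-∋ : ∀ {es R x y} → (x , y) ∈ es → addEdges es R x y ≡ true
    addEdges-∋ {x = x} {y} (here refl) rewrite dec-true (x Fin.≟ x) refl | dec-true (y Fin.≟ y) refl = refl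
    addEdges-∋ {e ∷ es} (there h) = ∨-introʳ (isEdge (proj₁ e) (proj₂ e) _ _) (addEdges-∋ h)

    addEdges-∈ : ∀ es {R x y} → addEdges es R x y ≡ true → R x y ≡ true ⊎ ((x , y) ∈ es ⊎ (y , x) ∈ es)
    addEdges-∈ [] h = inj₁ h
    addEdges-∈ ((u , v) ∷ es) {R} {x} {y} h with ∨-true {isEdge u v x y} h
    ... | inj₁ p with ∨-true {does (u Fin.≟ x) ∧ does (v Fin.≟ y)} p
    ...   | inj₁ q with q , r ← ∧-true q with refl ← does-true (u Fin.≟ x) q | refl ← does-true (v Fin.≟ y) r =
      inj₂ (inj₁ (here refl))
    ...   | inj₂ q with q , r ← ∧-true q with refl ← does-true (u Fin.≟ y) q | refl ← does-true (v Fin.≟ x) r =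
      inj₂ (inj₂ (here refl))
    addEdges-∈ ((u , v) ∷ es) {R} {x} {y} h | inj₂ p with addEdges-∈ es p
    ... | inj₁ q        = inj₁ q
    ... | inj₂ (inj₁ q) = inj₂ (inj₁ (there q))
    ... | inj₂ (inj₂ q) = inj₂ (inj₂ (there q))

    addEdges-++ : ∀ es fs R x y → addEdges (es ++ fs) R x y ≡ addEdges es (addEdges fs R) x y
    addEdges-++ []       fs R x y = refl
    addEdges-++ (e ∷ es) fs R x y = cong (isEdge (proj₁ e) (proj₂ e) x y ∨_) (addEdges-++ es fs R x y)

    -- In a list of used edges the first component is a path end, the second one the host it is attached to.
    endLoad : V → List (V × V) → ℕ
    endLoad v = lsum (λ e → δ (proj₁ e) v)

    -- Marks a place xy at which the gap (u , v) can be closed, or into which a path with ends u and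
    -- v fits.
    gain : (H : V → V → Bool) (u v : V) → V → V → ℕ
    gain H u v x y = ⟦ H u x ⟧ * ⟦ H v y ⟧

    gain-pos : ∀ {H u v x y} → 0 < gain H u v x y → H u x ≡ true × H v y ≡ true
    gain-pos {H} {u} {v} {x} {y} h with H u x | H v y
    ... | true | true = refl , refl

    gain≤1 : ∀ H u v x y → gain H u v x y ≤ 1
    gain≤1 H u v x y = *-mono-≤ (⟦⟧≤1 (H u x)) (⟦⟧≤1 (H v y))

    -- At each of the n - 1 pairs, ⟦a⟧ + ⟦b⟧ ≤ ⟦a⟧⟦b⟧ + 1. The last vertex starts no pair and the
    -- first one ends none, which costs 2 more and explains n + 1.
    pigeonhole-pairs : (A B : V → Bool) → ∀ {l} → VertexOrder l →
      ∑[ x < n ] ⟦ A x ⟧ + ∑[ y < n ] ⟦ B y ⟧ ≤ pairSum (λ x y → ⟦ A x ⟧ * ⟦ B y ⟧) l + n + 1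
    pigeonhole-pairs A B {[]} o = ≤-trans (≤-reflexive (cong₂ _+_ (sym (lsum-ordering (λ x → ⟦ A x ⟧) {[]} o)) (sym (lsum-ordering (λ x → ⟦ B x ⟧) {[]} o)))) z≤n
    pigeonhole-pairs A B {x ∷ l} o = begin
      ∑[ x < n ] ⟦ A x ⟧ + ∑[ y < n ] ⟦ B y ⟧
        ≡⟨ cong₂ _+_ (sym (lsum-ordering (λ x → ⟦ A x ⟧) {x ∷ l} o)) (sym (lsum-ordering (λ x → ⟦ B x ⟧) {x ∷ l} o)) ⟩
      lsum (λ x → ⟦ A x ⟧) (x ∷ l) + (⟦ B x ⟧ + lsum (λ x → ⟦ B x ⟧) l)
        ≡⟨ cong₂ (λ a b → a + (⟦ B x ⟧ + b)) (sym (pairSum-fst-lst (λ x → ⟦ A x ⟧) x l)) (sym (pairSum-snd-tail (λ x → ⟦ B x ⟧) x l)) ⟩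
      pairSum (λ x _ → ⟦ A x ⟧) (x ∷ l) + ⟦ A (lst x l) ⟧ + (⟦ B x ⟧ + pairSum (λ _ y → ⟦ B y ⟧) (x ∷ l))
        ≤⟨ +-mono-≤ (+-monoʳ-≤ (pairSum (λ x _ → ⟦ A x ⟧) (x ∷ l)) (⟦⟧≤1 (A (lst x l)))) (+-monoˡ-≤ _ (⟦⟧≤1 (B x))) ⟩
      pairSum (λ x _ → ⟦ A x ⟧) (x ∷ l) + 1 + (1 + pairSum (λ _ y → ⟦ B y ⟧) (x ∷ l))
        ≡⟨ swap (pairSum (λ x _ → ⟦ A x ⟧) (x ∷ l)) (pairSum (λ _ y → ⟦ B y ⟧) (x ∷ l)) ⟩
      (pairSum (λ x _ → ⟦ A x ⟧) (x ∷ l) + pairSum (λ _ y → ⟦ B y ⟧) (x ∷ l)) + 2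
        ≡⟨ cong (_+ 2) (sym (pairSum-+ (λ x _ → ⟦ A x ⟧) (λ _ y → ⟦ B y ⟧) (x ∷ l))) ⟩
      pairSum (λ x y → ⟦ A x ⟧ + ⟦ B y ⟧) (x ∷ l) + 2
        ≤⟨ +-monoˡ-≤ 2 (pairSum-mono (λ x y → or-and (A x) (B y)) (x ∷ l)) ⟩
      pairSum (λ x y → ⟦ A x ⟧ * ⟦ B y ⟧ + 1) (x ∷ l) + 2
        ≡⟨ cong (_+ 2) (trans (pairSum-+ (λ x y → ⟦ A x ⟧ * ⟦ B y ⟧) (λ _ _ → 1) (x ∷ l))
             (cong (pairSum (λ x y → ⟦ A x ⟧ * ⟦ B y ⟧) (x ∷ l) +_)
               (trans (pairSum-snd-tail (λ _ → 1) x l) (trans (lsum-const 1 l) (*-identityʳ _))))) ⟩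
      pairSum (λ x y → ⟦ A x ⟧ * ⟦ B y ⟧) (x ∷ l) + length l + 2
        ≡⟨ shift (pairSum (λ x y → ⟦ A x ⟧ * ⟦ B y ⟧) (x ∷ l)) (length l) ⟩
      pairSum (λ x y → ⟦ A x ⟧ * ⟦ B y ⟧) (x ∷ l) + length (x ∷ l) + 1
        ≡⟨ cong (λ z → pairSum (λ x y → ⟦ A x ⟧ * ⟦ B y ⟧) (x ∷ l) + z + 1) (length-ordering {l = x ∷ l} o) ⟩
      pairSum (λ x y → ⟦ A x ⟧ * ⟦ B y ⟧) (x ∷ l) + n + 1 ∎
      where
      open ≤-Reasoning
      swap : ∀ a b → a + 1 + (1 + b) ≡ a + b + 2
      swap = solve-∀
      shift : ∀ a b → a + b + 2 ≡ a + (1 + b) + 1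
      shift = solve-∀
      or-and : ∀ a b → ⟦ a ⟧ + ⟦ b ⟧ ≤ ⟦ a ⟧ * ⟦ b ⟧ + 1
      or-and true  true  = ≤-refl
      or-and true  false = ≤-refl
      or-and false true  = ≤-refl
      or-and false false = z≤n

    missing : (V → V → Bool) → V → V → ℕ
    missing R x y = ⟦ not (R x y) ⟧

    missing-mono : ∀ {R S} → (∀ x y → R x y ≡ true → S x y ≡ true) → ∀ x y → missing S x y ≤ missing R x y
    missing-mono {R} {S} h x y with R x y in eq
    ... | true  rewrite h x y eq = z≤n
    ... | false = ⟦⟧≤1 (not (S x y))

    missing-sym : ∀ {R} → Symmetric R → ∀ x y → missing R x y ≡ missing R y x
    missing-sym s x y = cong (λ b → ⟦ not b ⟧) (s x y)

    missing-zero : ∀ {R x y} → R x y ≡ true → missing R x y ≡ 0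
    missing-zero h rewrite h = refl

    record Rerouted (H R : V → V → Bool) (b : V) (l : List V) : Set where
      field
        used     : List (V × V)
        used⊆H   : ∀ {x y} → (x , y) ∈ used → H x y ≡ true
        short    : length used ≤ 2
        ends     : ∀ v → endLoad v used ≤ δ (lst b l) v + δ b v
        route    : List V
        order    : VertexOrder route
        -- Used with h = 1 to count the gaps, and with h counting the ends equal to a fixed vertex.
        fewer    : ∀ (h : V → V → ℕ) → (∀ x y → h x y ≡ h y x) →
                   cycSum (λ x y → missing (addEdges used R) x y * h x y) route + missing R (lst b l) b * h (lst b l) b
                   ≤ cycSum (λ x y → missing R x y * h x y) (b ∷ l)

    2-opt : ∀ H {R} → Symmetric R → ∀ {b l} → VertexOrder (b ∷ l) → 0 < pairSum (gain H (lst b l) b) (b ∷ l) → Rerouted H R b l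
    2-opt H {R} R-sym {b} {l} o pos with pairSum-find (gain H (lst b l) b) b l pos
    ... | A , y , B , refl , g>0 = record
      { used = es
      ; used⊆H = λ { (here refl) → proj₁ (gain-pos {H} {a} {b} {x} {y} g>0)
                   ; (there (here refl)) → proj₂ (gain-pos {H} {a} {b} {x} {y} g>0) }
      ; short = ≤-refl
      ; ends = λ v → ≤-reflexive (cong (δ a v +_) (+-identityʳ (δ b v)))
      ; route = (b ∷ A) ++ reverse (y ∷ B)
      ; order = λ v → trans (lsum-++ (λ x → δ x v) (b ∷ A) (reverse (y ∷ B)))
          (trans (cong (cnt v (b ∷ A) +_) (lsum-reverse (λ x → δ x v) (y ∷ B)))
          (trans (sym (lsum-++ (λ x → δ x v) (b ∷ A) (y ∷ B))) (o v)))
      ; fewer = fewer }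
      where
      a = lst b (A ++ y ∷ B)
      x = lst b A
      es : List (V × V)
      es = (a , x) ∷ (b , y) ∷ []
      R′ = addEdges es R
      fewer : ∀ (h : V → V → ℕ) → (∀ x y → h x y ≡ h y x) →
              cycSum (λ x y → missing R′ x y * h x y) ((b ∷ A) ++ reverse (y ∷ B)) + missing R a b * h a b
              ≤ cycSum (λ x y → missing R x y * h x y) (b ∷ A ++ y ∷ B)
      -- The closing term `f′ a b` drops out of the 2-opt identity, as ax and by are no gaps any
      -- more. The remaining pairs are then weighed with the old `R`, and the old weight of ab is
      -- added to both sides.
      fewer h h-sym = cancel equation (pairSum-mono (λ x y → *-monoˡ-≤ (h x y) (missing-mono {R} {R′} (λ _ _ → addEdges-⊇ es {R}) x y)) (b ∷ A ++ y ∷ B))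
        where
        cancel : ∀ {L p q P P′ c} → L + (p + q) ≡ p + P′ + (0 + 0) → P′ ≤ P → L + c ≤ c + P
        cancel {L} {p} {q} {P} {P′} {c} eq h = ≤-trans (≤-reflexive (+-comm L c))
          (+-monoʳ-≤ c (≤-trans (m≤m+n L q) (≤-trans (≤-reflexive (+-cancelˡ-≡ p (L + q) P′
            (trans (identity L p q) (trans eq (+-identityʳ (p + P′)))))) h)))
          where
          identity : ∀ L p q → p + (L + q) ≡ L + (p + q)
          identity = solve-∀
        f f′ : V → V → ℕ
        f  x y = missing R x y * h x y
        f′ x y = missing R′ x y * h x y
        f′-sym : ∀ x y → f′ x y ≡ f′ y x
        f′-sym x y = cong₂ _*_ (missing-sym (addEdges-sym es R-sym) x y) (h-sym x y)
        zero₁ : ∀ x y → (x , y) ∈ es → f′ x y ≡ 0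
        zero₁ x y p = cong (_* h x y) (missing-zero {R′} (addEdges-∋ {es} {R} p))
        equation : cycSum f′ ((b ∷ A) ++ reverse (y ∷ B)) + (f′ a b + f′ x y) ≡ f′ a b + pairSum f′ (b ∷ A ++ y ∷ B) + (0 + 0)
        equation = trans (subst (λ z → cycSum f′ ((b ∷ A) ++ reverse (y ∷ B)) + (f′ z b + f′ x y)
                   ≡ cycSum f′ ((b ∷ A) ++ y ∷ B) + (f′ z x + f′ b y)) (sym (lst-++ b A y B)) (cycSum-2-opt f′ f′-sym b A y B))
                   (cong (cycSum f′ ((b ∷ A) ++ y ∷ B) +_) (cong₂ _+_ (zero₁ a x (here refl)) (zero₁ b y (there (here refl)))))

    -- A one-vertex path counts its vertex twice, since two edges will be attached to it.
    ends : V → List V → ℕ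
    ends v []      = 0
    ends v (x ∷ l) = δ x v + δ (lst x l) v

    -- Each attached edge consumes a path end (`budget`), and saving one path takes at most two
    -- edges (`size`). The first bound limits the load of a single vertex, the second the total use
    -- of the reserve.
    record Merged (H : V → V → Bool) (ps : List (List V)) : Set where
      field
        used     : List (V × V)
        used⊆H   : ∀ {x y} → (x , y) ∈ used → H x y ≡ true
        paths    : List (List V)
        counts   : ∀ v → lsum (cnt v) paths ≡ lsum (cnt v) ps
        budget   : ∀ v → endLoad v used + lsum (ends v) paths ≤ lsum (ends v) ps
        present  : ∀ R → lsum (pairSum (missing R)) ps ≡ 0 → lsum (pairSum (missing (addEdges used R))) paths ≡ 0
        size     : length used + 2 * length paths ≤ 2 * length ps

    Merged-refl : ∀ H ps → Merged H ps
    Merged-refl H ps = record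
      { used = [] ; used⊆H = λ () ; paths = ps ; counts = λ _ → refl ; budget = λ _ → ≤-refl
      ; present = λ _ h → h ; size = ≤-refl }

    Merged-trans : ∀ {H ps} (M : Merged H ps) → Merged H (Merged.paths M) → Merged H ps
    Merged-trans {H} {ps} M M′ = record
      { used = M′.used ++ M.used
      ; used⊆H = λ h → case ∈-++⁻ M′.used h of λ { (inj₁ h) → M′.used⊆H h ; (inj₂ h) → M.used⊆H h }
      ; paths = M′.paths
      ; counts = λ v → trans (M′.counts v) (M.counts v)
      ; budget = λ v → begin
          endLoad v (M′.used ++ M.used) + lsum (ends v) M′.paths         ≡⟨ cong (_+ lsum (ends v) M′.paths) (lsum-++ _ M′.used M.used) ⟩
          endLoad v M′.used + endLoad v M.used + lsum (ends v) M′.paths  ≡⟨ swap (endLoad v M′.used) _ _ ⟩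
          endLoad v M.used + (endLoad v M′.used + lsum (ends v) M′.paths) ≤⟨ +-monoʳ-≤ (endLoad v M.used) (M′.budget v) ⟩
          endLoad v M.used + lsum (ends v) M.paths                       ≤⟨ M.budget v ⟩
          lsum (ends v) ps                                               ∎
      ; present = λ R h → trans (lsum-cong (pairSum-cong λ x y → cong (λ b → ⟦ not b ⟧) (addEdges-++ M′.used M.used R x y)) M′.paths)
                                (M′.present (addEdges M.used R) (M.present R h))
      ; size = begin
          length (M′.used ++ M.used) + 2 * length M′.paths         ≡⟨ cong (_+ 2 * length M′.paths) (length-++ M′.used) ⟩
          length M′.used + length M.used + 2 * length M′.paths     ≡⟨ swap (length M′.used) _ _ ⟩
          length M.used + (length M′.used + 2 * length M′.paths)   ≤⟨ +-monoʳ-≤ (length M.used) M′.size ⟩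
          length M.used + 2 * length M.paths                       ≤⟨ M.size ⟩
          2 * length ps                                            ∎ }
      where
      module M = Merged M
      module M′ = Merged M′
      open ≤-Reasoning
      swap : ∀ a b c → a + b + c ≡ b + (a + c)
      swap = solve-∀

    gains : (V → V → Bool) → V → V → List (List V) → ℕ
    gains H u v = lsum (pairSum (gain H u v))

    record Inserted (H : V → V → Bool) (ps : List (List V)) : Set where
      field
        merged : Merged H ps
        fewer  : suc (length (Merged.paths merged)) ≡ length ps
        gains≥ : ∀ u v → gains H u v ps ≤ gains H u v (Merged.paths merged) + 1

    drop-empty : ∀ H pre post → Inserted H (pre ++ [] ∷ post)
    drop-empty H pre post = record
      { merged = record
          { used = [] ; used⊆H = λ () ; paths = pre ++ post
          ; counts = λ v → sym (lsum-remove (cnt v) pre [] post)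
          ; budget = λ v → ≤-reflexive (sym (lsum-remove (ends v) pre [] post))
          ; present = λ R h → trans (sym (lsum-remove (pairSum (missing R)) pre [] post)) h
          ; size = *-monoʳ-≤ 2 (≤-trans (n≤1+n _) (≤-reflexive (sym (length-remove pre [] post)))) }
      ; fewer = sym (length-remove pre [] post)
      ; gains≥ = λ u v → ≤-trans (≤-reflexive (lsum-remove (pairSum (gain H u v)) pre [] post)) (m≤m+n _ 1) }

    module _ (H : V → V → Bool) (b : V) (L : List V) (pre post : List (List V)) where

      private
        a = lst b L
        P = b ∷ L
        ps = pre ++ P ∷ post

      module _ (h : V) (A : List V) (y : V) (B : List V) (pre′ post′ : List (List V)) (eq : pre ++ post ≡ pre′ ++ (h ∷ A ++ y ∷ B) ∷ post′)
               (x~b : H b (lst h A) ≡ true) (a~y : H a y ≡ true) where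

        private
          x = lst h A
          Q = h ∷ A ++ y ∷ B
          Q′ = h ∷ A ++ (P ++ y ∷ B)
          ps′ = pre′ ++ Q′ ∷ post′
          es : List (V × V)
          es = (b , x) ∷ (a , y) ∷ []

          split : (g : List V → ℕ) → lsum g ps ≡ g P + (g Q + lsum g (pre′ ++ post′))
          split g = trans (lsum-remove g pre P post) (cong (g P +_) (trans (cong (lsum g) eq) (lsum-remove g pre′ Q post′)))

          split′ : (g : List V → ℕ) → lsum g ps′ ≡ g Q′ + lsum g (pre′ ++ post′)
          split′ g = lsum-remove g pre′ Q′ post′

          lsum-Q′ : ∀ (g : V → ℕ) → lsum g Q′ ≡ lsum g P + lsum g Q
          lsum-Q′ g = trans (lsum-++ g (h ∷ A) (P ++ y ∷ B)) (trans (cong (lsum g (h ∷ A) +_) (lsum-++ g P (y ∷ B)))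
            (trans (swap (lsum g (h ∷ A)) (lsum g P) (lsum g (y ∷ B))) (cong (lsum g P +_) (sym (lsum-++ g (h ∷ A) (y ∷ B))))))
            where
            swap : ∀ a b c → a + (b + c) ≡ b + (a + c)
            swap = solve-∀

          pairSum-Q′ : ∀ (f : V → V → ℕ) → pairSum f Q′ + f x y ≡ pairSum f P + pairSum f Q + (f x b + f a y)
          pairSum-Q′ f rewrite pairSum-++ f h A b (L ++ y ∷ B) | pairSum-++ f b L y B | pairSum-++ f h A y B =
            swap (pairSum f (h ∷ A)) (f x b) (pairSum f P) (f a y) (pairSum f (y ∷ B)) (f x y)
            where
            swap : ∀ a b c d e g → a + (b + (c + (d + e))) + g ≡ c + (a + (g + e)) + (b + d)
            swap = solve-∀

          last-Q′ : lst h (A ++ (P ++ y ∷ B)) ≡ lst h (A ++ y ∷ B)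
          last-Q′ = trans (lst-++ h A b (L ++ y ∷ B)) (trans (lst-++ b L y B) (sym (lst-++ h A y B)))

          -- The insertion removes the pair xy and adds xb and ay. So at most one insertion place is
          -- lost, and no new pair is missing once xb and ay have been added to the edges.
          pairs-total : ∀ (f : V → V → ℕ) → lsum (pairSum f) ps′ + f x y ≡ lsum (pairSum f) ps + (f x b + f a y)
          pairs-total f = begin
            lsum (pairSum f) ps′ + f x y                            ≡⟨ cong (_+ f x y) (split′ (pairSum f)) ⟩
            pairSum f Q′ + rest + f x y                             ≡⟨ swap₁ (pairSum f Q′) rest (f x y) ⟩
            pairSum f Q′ + f x y + rest                             ≡⟨ cong (_+ rest) (pairSum-Q′ f) ⟩
            pairSum f P + pairSum f Q + (f x b + f a y) + rest      ≡⟨ swap₂ (pairSum f P) (pairSum f Q) (f x b + f a y) rest ⟩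
            pairSum f P + (pairSum f Q + rest) + (f x b + f a y)    ≡⟨ cong (_+ (f x b + f a y)) (sym (split (pairSum f))) ⟩
            lsum (pairSum f) ps + (f x b + f a y)                   ∎
            where
            open ≡-Reasoning
            rest = lsum (pairSum f) (pre′ ++ post′)
            swap₁ : ∀ a b c → a + b + c ≡ a + c + b
            swap₁ = solve-∀
            swap₂ : ∀ a b c d → a + b + c + d ≡ a + (b + d) + c
            swap₂ = solve-∀

          lengths : suc (length ps′) ≡ length ps
          lengths = trans (cong suc (length-remove pre′ Q′ post′)) (sym (trans (length-remove pre P post) (cong suc (trans (cong length eq) (length-remove pre′ Q post′)))))

        insert : Inserted H ps
        insert = record
          { merged = record
              { used = es
              ; used⊆H = λ { (here refl) → x~b ; (there (here refl)) → a~y }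
              ; paths = ps′
              ; counts = λ v → trans (split′ (cnt v)) (trans (cong (_+ lsum (cnt v) (pre′ ++ post′)) (lsum-Q′ (λ z → δ z v)))
                         (trans (+-assoc (cnt v P) (cnt v Q) _) (sym (split (cnt v)))))
              ; budget = λ v → ≤-reflexive (begin
                  (δ b v + (δ a v + 0)) + lsum (ends v) ps′                        ≡⟨ cong ((δ b v + (δ a v + 0)) +_) (split′ (ends v)) ⟩
                  (δ b v + (δ a v + 0)) + (ends v Q′ + lsum (ends v) (pre′ ++ post′)) ≡⟨ cong₂ (λ s t → s + (δ h v + δ t v + lsum (ends v) (pre′ ++ post′)))
                                                                                          (cong (δ b v +_) (+-identityʳ _)) last-Q′ ⟩
                  ends v P + (ends v Q + lsum (ends v) (pre′ ++ post′))            ≡⟨ sym (split (ends v)) ⟩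
                  lsum (ends v) ps ∎)
              ; present = λ R z → n≤0⇒n≡0 (present R z)
              ; size = ≤-reflexive (trans (lem (length ps′)) (cong (2 *_) lengths)) }
          ; fewer = lengths
          ; gains≥ = λ u v → ≤-trans (m≤m+n _ _) (≤-trans (≤-reflexive (sym (pairs-total (gain H u v)))) (+-monoʳ-≤ _ (gain≤1 H u v x y))) }
          where
          open ≡-Reasoning
          lem : ∀ k → 2 + 2 * k ≡ 2 * suc k
          lem = solve-∀
          present : ∀ R → lsum (pairSum (missing R)) ps ≡ 0 → lsum (pairSum (missing (addEdges es R))) ps′ ≤ 0
          present R z = ≤-trans (m≤m+n _ (f′ x y)) (≤-trans (≤-reflexive (trans (pairs-total f′) (cong (lsum (pairSum f′) ps +_)
              (cong₂ _+_ xb (missing-zero {addEdges es R} (addEdges-∋ {es} {R} {a} {y} (there (here refl))))))))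
              (≤-trans (≤-reflexive (+-identityʳ _)) (≤-trans (lsum-mono (pairSum-mono (missing-mono {R} (λ _ _ → addEdges-⊇ es {R}))) ps) (≤-reflexive z))))
            where
            f′ = missing (addEdges es R)
            xb : f′ x b ≡ 0
            xb = missing-zero {addEdges es R} (∨-introˡ _ (trans (isEdge-sym b x x b) (edge-self b x)))
              where
              edge-self : ∀ u v → isEdge u v u v ≡ true
              edge-self u v rewrite dec-true (u Fin.≟ u) refl | dec-true (v Fin.≟ v) refl = refl

      insert-somewhere : 0 < gains H b a (pre ++ post) → Inserted H ps
      insert-somewhere pos with lsum-find (pairSum (gain H b a)) (pre ++ post) pos
      ... | pre′ , h ∷ Q , post′ , eq , q with pairSum-find (gain H b a) h Q q
      ...   | A , y , B , refl , g = insert h A y B pre′ post′ eq (proj₁ (gain-pos {H} {b} {a} {lst h A} {y} g)) (proj₂ (gain-pos {H} {b} {a} {lst h A} {y} g))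

    -- Inserting a shortest path (of fewer than c vertices) while more than N paths are left: D bounds the
    -- number of insertion places from below, of which at most m are lost to earlier insertions.
    merge-all : ∀ H N c D m → n < suc N * c → m + c ≤ D → ∀ k ps → length ps ≤ N + k → (∀ v → lsum (cnt v) ps ≡ 1) →
                (∀ u v → D + length ps ≤ gains H u v ps + m) → ∃ λ (M : Merged H ps) → length (Merged.paths M) ≤ N
    merge-all H N c D m n<Nc m+c≤D k ps few cover rich with length ps ≤? N
    ... | yes done = Merged-refl H ps , done
    merge-all H N c D m n<Nc m+c≤D zero ps few cover rich | no ¬done = ⊥-elim (¬done (≤-trans few (≤-reflexive (+-identityʳ N))))
    merge-all H N c D m n<Nc m+c≤D (suc k) ps few cover rich | no ¬done = continue (shortest ps few cover rich ¬done)
      where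
      shortest : ∀ ps → length ps ≤ N + suc k → (∀ v → lsum (cnt v) ps ≡ 1) →
                 (∀ u v → D + length ps ≤ gains H u v ps + m) → ¬ (length ps ≤ N) → Inserted H ps
      -- More than `N` paths cover `n < suc N * c` vertices, so one of them has fewer than `c`.
      shortest ps few cover rich ¬done with lsum-find-small c length ps (begin-strict
          lsum length ps                   ≡⟨ lsum-cong (λ l → sym (trans (lsum-const 1 l) (*-identityʳ _))) ps ⟩
          lsum (lsum (λ _ → 1)) ps         ≡⟨ sym (lsum-concat (λ _ → 1) ps) ⟩
          lsum (λ _ → 1) (concat ps)       ≡⟨ lsum-const 1 (concat ps) ⟩
          length (concat ps) * 1           ≡⟨ *-identityʳ _ ⟩
          length (concat ps)               ≡⟨ length-ordering {l = concat ps} (λ v → trans (lsum-concat (λ x → δ x v) ps) (cover v)) ⟩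
          n                                <⟨ n<Nc ⟩
          suc N * c                        ≤⟨ *-monoˡ-≤ c (≰⇒> ¬done) ⟩
          length ps * c                    ∎)
        where open ≤-Reasoning
      ... | pre , [] , post , refl , _ = drop-empty H pre post
      -- Fewer than `c` places lie in the path itself, and `m + c ≤ D` leaves one in another path.
      ... | pre , b ∷ L , post , refl , short = insert-somewhere H b L pre post
          (+-cancelʳ-< (pairSum (gain H b a) (b ∷ L) + m) 0 _ (begin-strict
            pairSum (gain H b a) (b ∷ L) + m                                    <⟨ +-monoˡ-< m (≤-<-trans pairs≤length short) ⟩
            c + m                                                               ≡⟨ +-comm c m ⟩
            m + c                                                               ≤⟨ m+c≤D ⟩
            D                                                                   ≤⟨ m≤m+n D _ ⟩
            D + length (pre ++ (b ∷ L) ∷ post)                                  ≤⟨ rich b a ⟩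
            gains H b a (pre ++ (b ∷ L) ∷ post) + m                             ≡⟨ cong (_+ m) (lsum-remove (pairSum (gain H b a)) pre (b ∷ L) post) ⟩
            pairSum (gain H b a) (b ∷ L) + gains H b a (pre ++ post) + m        ≡⟨ swap (pairSum (gain H b a) (b ∷ L)) _ m ⟩
            gains H b a (pre ++ post) + (pairSum (gain H b a) (b ∷ L) + m)      ∎))
        where
        open ≤-Reasoning
        a = lst b L
        swap : ∀ a b c → a + b + c ≡ b + (a + c)
        swap = solve-∀
        pairs≤length : pairSum (gain H b a) (b ∷ L) ≤ length (b ∷ L)
        pairs≤length = begin
          pairSum (gain H b a) (b ∷ L)     ≤⟨ pairSum-mono (gain≤1 H b a) (b ∷ L) ⟩
          pairSum (λ _ _ → 1) (b ∷ L)      ≤⟨ pairSum-fst (λ _ → 1) (b ∷ L) ⟩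
          lsum (λ _ → 1) (b ∷ L)           ≡⟨ trans (lsum-const 1 (b ∷ L)) (*-identityʳ _) ⟩
          length (b ∷ L)                   ∎
      continue : Inserted H ps → ∃ λ (M : Merged H ps) → length (Merged.paths M) ≤ N
      continue I with merge-all H N c D m n<Nc m+c≤D k (Merged.paths merged)
          (s≤s⁻¹ (≤-trans (≤-reflexive fewer) (≤-trans few (≤-reflexive (+-suc N k)))))
          (λ v → trans (Merged.counts merged v) (cover v))
          -- The invariant persists: the left side loses one path, the right side at most one place.
          (λ u v → s≤s⁻¹ (begin
            suc (D + length (Merged.paths merged))           ≡⟨ sym (+-suc D _) ⟩
            D + suc (length (Merged.paths merged))           ≡⟨ cong (D +_) fewer ⟩
            D + length ps                                    ≤⟨ rich u v ⟩
            gains H u v ps + m                               ≤⟨ +-monoˡ-≤ m (gains≥ u v) ⟩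
            gains H u v (Merged.paths merged) + 1 + m        ≡⟨ lem (gains H u v (Merged.paths merged)) m ⟩
            suc (gains H u v (Merged.paths merged) + m)      ∎))
        where
        open Inserted I
        open ≤-Reasoning
        lem : ∀ a m → a + 1 + m ≡ suc (a + m)
        lem = solve-∀
      ... | M , done = Merged-trans (Inserted.merged I) M , done

  -- Edge colouring

  module _ {n} {ρ : Fin n → Fin n → Set} (ρ? : ∀ x y → Dec (ρ x y)) (u : Fin n) where

    private
      Reached : (Fin n → Bool) → Set
      Reached X = ∀ x → X x ≡ true → x ≡ u ⊎ ∃ λ x′ → X x′ ≡ true × ρ x′ x

      Exits : (Fin n → Bool) → Set
      Exits X = ∃₂ λ x y → X x ≡ true × ρ x y × X y ≡ false

      exits? : ∀ X → Dec (Exits X)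
      exits? X = Fin.any? λ x → Fin.any? λ y →
        (X x Bool.≟ true) ×-dec ρ? x y ×-dec (X y Bool.≟ false)

    Closure : Set
    Closure = ∃ λ X → X u ≡ true × (∀ x y → X x ≡ true → ρ x y → X y ≡ true) × Reached X

    -- The set grows vertex by vertex until no step leaves it. Instead of paths from `u` it records
    -- that each element is `u` or has a predecessor in the set, which is what the argument for
    -- Kempe chains consults.
    closure : Closure
    closure = grow n (λ x → does (x Fin.≟ u)) (m≤m+n n _) (dec-true (u Fin.≟ u) refl)
                   (λ x h → inj₁ (does-true (x Fin.≟ u) h))
      where
      grow : ∀ k X → n ≤ k + ∑[ x < n ] ⟦ X x ⟧ → X u ≡ true → Reached X → Closure
      grow k X size Xu reached with exits? X
      ... | no ¬exit = X , Xu , closed , reached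
        where
        closed : ∀ x y → X x ≡ true → ρ x y → X y ≡ true
        closed x y Xx r with X y in eq
        ... | true  = refl
        ... | false = ⊥-elim (¬exit (x , y , Xx , r , eq))
      ... | yes (x , y , Xx , r , ¬Xy) = continue k size
        where
        X′ : Fin n → Bool
        X′ z = X z ∨ does (y Fin.≟ z)
        step : ∀ z → ⟦ X′ z ⟧ ≡ ⟦ X z ⟧ + δ y z
        step z with y Fin.≟ z
        ... | no _ = trans (cong ⟦_⟧ (Bool.∨-identityʳ (X z))) (sym (+-identityʳ _))
        ... | yes refl rewrite ¬Xy = refl
        size′ : ∑[ z < n ] ⟦ X′ z ⟧ ≡ ∑[ z < n ] ⟦ X z ⟧ + 1
        size′ = trans (sum-cong-≗ step) (trans (∑-distrib-+ (λ z → ⟦ X z ⟧) (δ y)) (cong (sum (λ z → ⟦ X z ⟧) +_) (∑-δ-one y)))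
        reached′ : Reached X′
        reached′ z h with ∨-true {X z} h
        ... | inj₂ q with refl ← does-true (y Fin.≟ z) q = inj₂ (x , ∨-introˡ _ Xx , r)
        ... | inj₁ q with reached z q
        ...   | inj₁ e = inj₁ e
        ...   | inj₂ (x′ , Xx′ , r′) = inj₂ (x′ , ∨-introˡ _ Xx′ , r′)
        continue : ∀ k → n ≤ k + ∑[ x < n ] ⟦ X x ⟧ → Closure
        continue zero s = ⊥-elim (<-irrefl refl (begin-strict
          n                          ≤⟨ s ⟩
          ∑[ z < n ] ⟦ X z ⟧         <⟨ m<m+n _ (s≤s z≤n) ⟩
          ∑[ z < n ] ⟦ X z ⟧ + 1     ≡⟨ sym size′ ⟩
          ∑[ z < n ] ⟦ X′ z ⟧        ≤⟨ ∑-≤-const 1 (λ z → ⟦⟧≤1 (X′ z)) ⟩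
          n * 1                      ≡⟨ *-identityʳ n ⟩
          n                          ∎))
          where open ≤-Reasoning
        continue (suc k) s = grow k X′
          (≤-trans s (≤-reflexive (trans (lem k _) (cong (k +_) (sym size′)))))
          (∨-introˡ _ Xu) reached′
          where
          lem : ∀ k s → suc k + s ≡ k + (s + 1)
          lem = solve-∀

  multiplicity : ∀ {n} → Fin n → Fin n → List (Fin n × Fin n) → ℕ
  multiplicity u w = lsum (λ e → δ (proj₁ e) u * δ (proj₂ e) w)

  record Matchings {n} (Δ : ℕ) (es : List (Fin n × Fin n)) : Set where
    field
      matched   : Fin Δ → Fin n → Fin n → Bool
      functional : ∀ t u w w′ → matched t u w ≡ true → matched t u w′ ≡ true → w ≡ w′
      injective  : ∀ t u u′ w → matched t u w ≡ true → matched t u′ w ≡ true → u ≡ u′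
      covered    : ∀ u w → ∑[ t < Δ ] ⟦ matched t u w ⟧ ≡ multiplicity u w es

  module _ {n Δ} {es : List (Fin n × Fin n)} (M : Matchings Δ es) where
    open Matchings M

    free-row : ∀ u → lsum (λ e → δ (proj₁ e) u) es < Δ → ∃ λ t → ∀ w → matched t u w ≡ false
    free-row u h with ∑-find-small 1 (λ t → ∑[ w < n ] ⟦ matched t u w ⟧)
        (subst₂ _<_ (sym total) (sym (*-identityʳ Δ)) h)
      where
      total : ∑[ t < Δ ] ∑[ w < n ] ⟦ matched t u w ⟧ ≡ lsum (λ e → δ (proj₁ e) u) es
      total = begin
        ∑[ t < Δ ] ∑[ w < n ] ⟦ matched t u w ⟧                            ≡⟨ ∑-comm (λ t w → ⟦ matched t u w ⟧) ⟩
        ∑[ w < n ] ∑[ t < Δ ] ⟦ matched t u w ⟧                            ≡⟨ sum-cong-≗ (covered u) ⟩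
        ∑[ w < n ] lsum (λ e → δ (proj₁ e) u * δ (proj₂ e) w) es           ≡⟨ lsum-∑ (λ w e → δ (proj₁ e) u * δ (proj₂ e) w) es ⟨
        lsum (λ e → ∑[ w < n ] (δ (proj₁ e) u * δ (proj₂ e) w)) es         ≡⟨ lsum-cong (λ e → trans (sym (*-distribˡ-sum (δ (proj₁ e) u) (δ (proj₂ e))))
                                                                               (trans (cong (δ (proj₁ e) u *_) (∑-δ-one (proj₂ e))) (*-identityʳ _))) es ⟩
        lsum (λ e → δ (proj₁ e) u) es                                      ∎
        where open ≡-Reasoning
    ... | t , small = t , λ w → zero⇒false (≤-trans (term≤∑ (λ w → ⟦ matched t u w ⟧) w) (s≤s⁻¹ small))
      where
      zero⇒false : ∀ {b} → ⟦ b ⟧ ≤ 0 → b ≡ false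
      zero⇒false {false} _ = refl

  transposed : ∀ {n Δ} {es : List (Fin n × Fin n)} → Matchings Δ es → Matchings Δ (map (λ e → proj₂ e , proj₁ e) es)
  transposed {es = es} M = record
    { matched = λ t u w → matched t w u
    ; functional = λ t u w w′ → injective t w w′ u
    ; injective = λ t u u′ w → functional t w u u′
    ; covered = λ u w → trans (covered w u) (flip es) }
    where
    open Matchings M
    flip : ∀ {u w} es → multiplicity w u es ≡ multiplicity u w (map (λ e → proj₂ e , proj₁ e) es)
    flip [] = refl
    flip (e ∷ es) = cong₂ _+_ (*-comm (δ (proj₁ e) _) _) (flip es)

  module _ {n Δ} {es : List (Fin n × Fin n)} (M : Matchings Δ es) (α β : Fin Δ) (u w : Fin n)
           (α-free : ∀ w′ → Matchings.matched M α u w′ ≡ false) (β-free : ∀ u′ → Matchings.matched M β u′ w ≡ false) where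
    open Matchings M

    private
      β⁻α-step : Fin n → Fin n → Set
      β⁻α-step x y = ∃ λ z → matched β x z ≡ true × matched α y z ≡ true

      β⁻α-step? : ∀ x y → Dec (β⁻α-step x y)
      β⁻α-step? x y = Fin.any? λ z → (matched β x z Bool.≟ true) ×-dec (matched α y z Bool.≟ true)

      absurd : ∀ {b} → b ≡ true → b ≡ false → ⊥
      absurd refl ()

      module _ (cl : Closure β⁻α-step? u) where
        X = proj₁ cl
        Xu = proj₁ (proj₂ cl)
        closed = proj₁ (proj₂ (proj₂ cl))
        reached = proj₂ (proj₂ (proj₂ cl))

        predecessor : ∀ x y → X x ≡ true → matched α x y ≡ true → ∃ λ x′ → X x′ ≡ true × matched β x′ y ≡ true
        predecessor x y Xx h with reached x Xx
        ... | inj₁ refl = ⊥-elim (absurd h (α-free y))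
        ... | inj₂ (x′ , Xx′ , z , p , q) with refl ← functional α x y z h q = x′ , Xx′ , p

        matched′ : Fin Δ → Fin n → Fin n → Bool
        matched′ t x y = matched (if X x then transpose α β t else t) x y

        β↦α : transpose α β β ≡ α
        β↦α with β Fin.≟ α
        ... | yes eq = eq
        ... | no _ rewrite dec-true (β Fin.≟ β) refl = refl

        -- A swapped row x and an unswapped row x′ never collide in a column. For `t = α`, a step
        -- leads from x to x′, which would put x′ into the chain; for `t = β`, the predecessor of x
        -- across this column would be x′; for other colours nothing has changed.
        crossing : ∀ t x x′ y → X x ≡ true → X x′ ≡ false → matched (transpose α β t) x y ≡ true →
                   matched t x′ y ≡ true → ⊥
        crossing t x x′ y Xx ¬Xx′ p q with t Fin.≟ α
        ... | yes refl = absurd (closed x x′ Xx (y , p , q)) ¬Xx′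
        ... | no t≢α with t Fin.≟ β
        ...   | no t≢β with refl ← injective t x x′ y p q = absurd Xx ¬Xx′
        ...   | yes refl with predecessor x y Xx p
        ...     | x″ , Xx″ , r with refl ← injective β x″ x′ y r q = absurd Xx″ ¬Xx′

        injective′ : ∀ t x x′ y → matched′ t x y ≡ true → matched′ t x′ y ≡ true → x ≡ x′
        injective′ t x x′ y p q with X x in eq | X x′ in eq′
        ... | true  | true  = injective (transpose α β t) x x′ y p q
        ... | false | false = injective t x x′ y p q
        ... | true  | false = ⊥-elim (crossing t x x′ y eq eq′ p q)
        ... | false | true  = ⊥-elim (crossing t x′ x y eq′ eq q p)

        covered′ : ∀ x y → ∑[ t < Δ ] ⟦ matched′ t x y ⟧ ≡ multiplicity x y es
        covered′ x y with X x
        ... | true  = trans (sym (∑-permute (λ t → ⟦ matched t x y ⟧) (Perm.transpose α β))) (covered x y)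
        ... | false = covered x y

        kempe-swap : Matchings Δ es
        kempe-swap = record { matched = matched′ ; functional = λ t x → functional _ x
                            ; injective = injective′ ; covered = covered′ }

        row-free : ∀ y → matched′ β u y ≡ false
        row-free y rewrite Xu | β↦α = α-free y

        column-free : ∀ x → matched′ β x w ≡ false
        column-free x with X x in eq
        ... | false = β-free x
        ... | true rewrite β↦α with matched α x w in h
        ...   | false = refl
        ...   | true with predecessor x w eq h
        ...     | x′ , _ , r = ⊥-elim (absurd r (β-free x′))

    -- The colours `α` and `β` are swapped on the Kempe chain of row `u`. As `α` is free at `u`, the
    -- chain starts with a `β`-edge, so it enters every column by `β` and leaves it by `α`. It
    -- cannot enter column `w`, where `β` is free. So `β` becomes free at `u` and stays free at `w`.
    make-free : ∃ λ (M′ : Matchings Δ es) → (∀ y → Matchings.matched M′ β u y ≡ false) × (∀ x → Matchings.matched M′ β x w ≡ false)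
    make-free = kempe-swap cl , row-free cl , column-free cl
      where cl = closure β⁻α-step? u

  module _ {n Δ} {es : List (Fin n × Fin n)} (M : Matchings Δ es) (β : Fin Δ) (u w : Fin n)
           (row-free : ∀ y → Matchings.matched M β u y ≡ false) (column-free : ∀ x → Matchings.matched M β x w ≡ false) where
    open Matchings M

    private
      new : Fin Δ → Fin n → Fin n → Bool
      new t x y = does (β Fin.≟ t) ∧ (does (u Fin.≟ x) ∧ does (w Fin.≟ y))

      new-true : ∀ {t x y} → new t x y ≡ true → t ≡ β × x ≡ u × y ≡ w
      new-true {t} {x} {y} h with p , q ← ∧-true h with q , r ← ∧-true q =
        sym (does-true (β Fin.≟ t) p) , sym (does-true (u Fin.≟ x) q) , sym (does-true (w Fin.≟ y) r)

      absurd : ∀ {b} → b ≡ true → b ≡ false → ⊥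
      absurd refl ()

    add-edge : Matchings Δ ((u , w) ∷ es)
    add-edge = record { matched = matched′ ; functional = functional′ ; injective = injective′ ; covered = covered′ }
      where
      matched′ : Fin Δ → Fin n → Fin n → Bool
      matched′ t x y = new t x y ∨ matched t x y
      functional′ : ∀ t x y y′ → matched′ t x y ≡ true → matched′ t x y′ ≡ true → y ≡ y′
      functional′ t x y y′ p q with ∨-true {new t x y} p | ∨-true {new t x y′} q
      ... | inj₂ p | inj₂ q = functional t x y y′ p q
      ... | inj₁ p | inj₁ q = trans (proj₂ (proj₂ (new-true {t} p))) (sym (proj₂ (proj₂ (new-true {t} q))))
      ... | inj₁ p | inj₂ q with refl , refl , refl ← new-true {t} p = ⊥-elim (absurd q (row-free y′))
      ... | inj₂ p | inj₁ q with refl , refl , refl ← new-true {t} q = ⊥-elim (absurd p (row-free y))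
      injective′ : ∀ t x x′ y → matched′ t x y ≡ true → matched′ t x′ y ≡ true → x ≡ x′
      injective′ t x x′ y p q with ∨-true {new t x y} p | ∨-true {new t x′ y} q
      ... | inj₂ p | inj₂ q = injective t x x′ y p q
      ... | inj₁ p | inj₁ q = trans (proj₁ (proj₂ (new-true {t} p))) (sym (proj₁ (proj₂ (new-true {t} q))))
      ... | inj₁ p | inj₂ q with refl , refl , refl ← new-true {t} p = ⊥-elim (absurd q (column-free x′))
      ... | inj₂ p | inj₁ q with refl , refl , refl ← new-true {t} q = ⊥-elim (absurd p (column-free x))
      disjoint : ∀ t x y → ⟦ matched′ t x y ⟧ ≡ δ β t * (δ u x * δ w y) + ⟦ matched t x y ⟧
      disjoint t x y = trans (exclusive (new t x y) λ h → excluded (new-true {t} h))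
        (cong (_+ ⟦ matched t x y ⟧) (trans (⟦∧⟧ (does (β Fin.≟ t)) _) (cong (δ β t *_) (⟦∧⟧ (does (u Fin.≟ x)) _))))
        where
        excluded : t ≡ β × x ≡ u × y ≡ w → matched t x y ≡ false
        excluded (refl , refl , refl) = row-free y
        exclusive : ∀ a {b} → (a ≡ true → b ≡ false) → ⟦ a ∨ b ⟧ ≡ ⟦ a ⟧ + ⟦ b ⟧
        exclusive true  h rewrite h refl = refl
        exclusive false h = refl
      covered′ : ∀ x y → ∑[ t < Δ ] ⟦ matched′ t x y ⟧ ≡ δ u x * δ w y + multiplicity x y es
      covered′ x y = begin
        ∑[ t < Δ ] ⟦ matched′ t x y ⟧                                            ≡⟨ sum-cong-≗ (λ t → disjoint t x y) ⟩
        ∑[ t < Δ ] (δ β t * (δ u x * δ w y) + ⟦ matched t x y ⟧)                 ≡⟨ ∑-distrib-+ (λ t → δ β t * (δ u x * δ w y)) _ ⟩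
        ∑[ t < Δ ] (δ β t * (δ u x * δ w y)) + ∑[ t < Δ ] ⟦ matched t x y ⟧      ≡⟨ cong₂ _+_ (∑-δ (λ _ → δ u x * δ w y) β) (covered x y) ⟩
        δ u x * δ w y + multiplicity x y es                                      ∎
        where open ≡-Reasoning

  -- König's theorem; es is read as a bipartite multigraph between two copies of Fin n.
  edge-colouring : ∀ {n} Δ (es : List (Fin n × Fin n)) →
    (∀ u → lsum (λ e → δ (proj₁ e) u) es ≤ Δ) → (∀ w → lsum (λ e → δ (proj₂ e) w) es ≤ Δ) → Matchings Δ es
  edge-colouring Δ [] _ _ = record
    { matched = λ _ _ _ → false ; functional = λ _ _ _ _ () ; injective = λ _ _ _ _ () ; covered = λ u w → ∑-zero {Δ} λ _ → refl }
  edge-colouring Δ ((u , w) ∷ es) rows columns = extend (free-row M u row<Δ) (free-row (transposed M) w column<Δ)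
    where
    M : Matchings Δ es
    M = edge-colouring Δ es (λ x → ≤-trans (m≤n+m _ _) (rows x)) (λ y → ≤-trans (m≤n+m _ _) (columns y))
    row<Δ : lsum (λ e → δ (proj₁ e) u) es < Δ
    row<Δ = subst (λ z → z + lsum (λ e → δ (proj₁ e) u) es ≤ Δ) (δ-refl u) (rows u)
    flip : ∀ es → lsum (λ e → δ (proj₁ e) w) (map (λ e → proj₂ e , proj₁ e) es) ≡ lsum (λ e → δ (proj₂ e) w) es
    flip []       = refl
    flip (e ∷ es) = cong (δ (proj₂ e) w +_) (flip es)
    column<Δ : lsum (λ e → δ (proj₁ e) w) (map (λ e → proj₂ e , proj₁ e) es) < Δ
    column<Δ = subst (_< Δ) (sym (flip es)) (subst (λ z → z + lsum (λ e → δ (proj₂ e) w) es ≤ Δ) (δ-refl w) (columns w))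
    extend : (∃ λ α → ∀ y → Matchings.matched M α u y ≡ false) → (∃ λ β → ∀ x → Matchings.matched M β x w ≡ false) →
             Matchings Δ ((u , w) ∷ es)
    extend (α , α-free) (β , β-free) with M′ , r , c ← make-free M α β u w α-free β-free = add-edge M′ β u w r c

  -- The reserve

  module _ {n T q : ℕ} (R : Fin T → Fin q → Fin n → Fin n → Bool) where

    occupied? : ∀ u x → Dec (∃₂ λ g e → R g e u x ≡ true)
    occupied? u x = Fin.any? λ g → Fin.any? λ e → R g e u x Bool.≟ true

    occupied : Fin n → Fin n → Bool
    occupied u x = does (occupied? u x)

    EdgeDisjointFamily : Set
    EdgeDisjointFamily = ∀ {g e g′ e′ u x} → R g e u x ≡ true → R g′ e′ u x ≡ true → g ≡ g′ × e ≡ e′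

  keep : ∀ {T q} {A : Set} → (Fin T → Fin (suc q)) → (Fin T → Fin (suc q) → A) → Fin T → Fin q → A
  keep f X g e = X g (punchIn (f g) e)

  module _ {n T q N : ℕ} (R : Fin T → Fin (suc q) → Fin n → Fin n → Bool) (disjoint : EdgeDisjointFamily R)
           (degree≤2 : ∀ g e u → ∑[ x < n ] ⟦ R g e u x ⟧ ≤ 2)
           (z : Fin N → Fin n) (a : Fin N → Fin n → ℕ) (a≤1 : ∀ c x → a c x ≤ 1) where

    private
      w : Fin N → Fin T → Fin (suc q) → ℕ
      w c g e = ∑[ x < n ] (a c x * ⟦ R g e (z c) x ⟧)

      w≤2 : ∀ c g e → w c g e ≤ 2
      w≤2 c g e = ≤-trans (∑-mono λ x → ≤-trans (*-monoˡ-≤ ⟦ R g e (z c) x ⟧ (a≤1 c x)) (≤-reflexive (*-identityˡ _)))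
                          (degree≤2 g e (z c))

      module _ (f : Fin T → Fin (suc q)) where

        sacrificed total : Fin n → Fin n → ℕ
        sacrificed u x = ∑[ g < T ] ⟦ R g (f g) u x ⟧
        total      u x = ∑[ g < T ] ∑[ e < suc q ] ⟦ R g e u x ⟧

        free : Fin n → Fin n → ℕ
        free u x = ⟦ not (occupied (keep f R) u x) ⟧

        sacrificed≤1 : ∀ u x → sacrificed u x ≤ 1
        sacrificed≤1 u x = ∑-unique (λ g → R g (f g) u x) λ g g′ p q → proj₁ (disjoint p q)

        sacrificed≤total : ∀ u x → sacrificed u x ≤ total u x
        sacrificed≤total u x = ∑-mono λ g → term≤∑ (λ e → ⟦ R g e u x ⟧) (f g)

        -- An edge of a kept member is, by disjointness, in no sacrificed one; every other pair is
        -- free. After summation a balanced choice cancels `suc q * sacrificed` against `total`, so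
        -- that a share 1/(q + 1) of the tested pairs remains free.
        pointwise : ∀ u x → 1 + suc q * sacrificed u x ≤ suc q * free u x + total u x
        pointwise u x with occupied? (keep f R) u x
        ... | no _ = arith (sacrificed≤1 u x) (sacrificed≤total u x)
          where
          arith : ∀ {s t} → s ≤ 1 → s ≤ t → 1 + suc q * s ≤ suc q * 1 + t
          arith {zero} _ _ = ≤-trans (≤-reflexive (cong suc (*-zeroʳ q))) (s≤s z≤n)
          arith {suc zero} {t} _ h = ≤-trans (≤-reflexive (+-comm 1 (suc q * 1))) (+-monoʳ-≤ (suc q * 1) h)
          arith {suc (suc _)} (s≤s ()) _
        ... | yes (g , e , p) = begin
          1 + suc q * sacrificed u x             ≡⟨ cong (λ s → 1 + suc q * s) (∑-zero λ g′ → none g′) ⟩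
          1 + suc q * 0                          ≡⟨ cong suc (*-zeroʳ q) ⟩
          1                                      ≡⟨ ⟦⟧-true p ⟨
          ⟦ R g (punchIn (f g) e) u x ⟧          ≤⟨ term≤∑ (λ e → ⟦ R g e u x ⟧) (punchIn (f g) e) ⟩
          ∑[ e < suc q ] ⟦ R g e u x ⟧           ≤⟨ term≤∑ (λ g → ∑[ e < suc q ] ⟦ R g e u x ⟧) g ⟩
          total u x                              ≤⟨ m≤n+m _ _ ⟩
          suc q * 0 + total u x                  ∎
          where
          open ≤-Reasoning
          none : ∀ g′ → ⟦ R g′ (f g′) u x ⟧ ≡ 0
          none g′ with R g′ (f g′) u x in eq
          ... | false = refl
          ... | true with disjoint p eq
          ...   | refl , same = ⊥-elim (Fin.punchInᵢ≢i (f g) e same)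

    -- A test consists of a vertex `z c` and a set `a c` of possible partners. Only such linear
    -- conditions fit into `balanced-choice`; a condition on two edges takes two applications.
    sacrifice : ∀ M → N ≤ n * n * n → T ≤ n → threshold q 2 M < n →
      ∃ λ (f : Fin T → Fin (suc q)) → ∀ c →
        M * (∑[ x < n ] a c x) ≤ M * (suc q * (∑[ x < n ] (a c x * ⟦ not (occupied (keep f R) (z c) x) ⟧))) + n
    sacrifice M N≤ T≤ large = conclude (balanced-choice 2 w w≤2 M n N≤ T≤ large)
      where
      conclude : (∃ λ f → ∀ c →
        M * (suc q * (∑[ g < T ] w c g (f g))) ≤ M * (∑[ g < T ] ∑[ e < suc q ] w c g e) + n ×
        M * (∑[ g < T ] ∑[ e < suc q ] w c g e) ≤ M * (suc q * (∑[ g < T ] w c g (f g))) + n) → _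
      collect : ∀ f c → M * (∑[ g < T ] ∑[ e < suc q ] w c g e) ≤ M * (suc q * (∑[ g < T ] w c g (f g))) + n →
        M * (∑[ x < n ] a c x) ≤ M * (suc q * (∑[ x < n ] (a c x * free f (z c) x))) + n
      conclude (f , balanced) = f , λ c → collect f c (proj₂ (balanced c))
      collect f c h = lin 0 (+-mono-≤ (*-monoʳ-≤ M summed) h)
          (identity M (∑[ x < n ] a c x) (suc q * (∑[ g < T ] w c g (f g))) (suc q * (∑[ x < n ] (a c x * free f (z c) x)))
                    (∑[ g < T ] ∑[ e < suc q ] w c g e) n)
        where
        identity : ∀ M A S F W n → M * A + (M * (F + W) + (M * S + n)) + 0 ≡ M * F + n + (M * (A + S) + M * W)
        identity = solve-∀
        open ≡-Reasoning
        total-w : ∑[ x < n ] (a c x * total f (z c) x) ≡ ∑[ g < T ] ∑[ e < suc q ] w c g e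
        total-w = begin
          ∑[ x < n ] (a c x * total f (z c) x)
            ≡⟨ sum-cong-≗ (λ x → trans (*-distribˡ-sum (a c x) (λ g → ∑[ e < suc q ] ⟦ R g e (z c) x ⟧))
                 (sum-cong-≗ λ g → *-distribˡ-sum (a c x) (λ e → ⟦ R g e (z c) x ⟧))) ⟩
          ∑[ x < n ] ∑[ g < T ] ∑[ e < suc q ] (a c x * ⟦ R g e (z c) x ⟧)
            ≡⟨ ∑-comm (λ x g → ∑[ e < suc q ] (a c x * ⟦ R g e (z c) x ⟧)) ⟩
          ∑[ g < T ] ∑[ x < n ] ∑[ e < suc q ] (a c x * ⟦ R g e (z c) x ⟧)
            ≡⟨ sum-cong-≗ (λ g → ∑-comm (λ x e → a c x * ⟦ R g e (z c) x ⟧)) ⟩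
          ∑[ g < T ] ∑[ e < suc q ] w c g e ∎
        sacrificed-w : ∑[ x < n ] (a c x * sacrificed f (z c) x) ≡ ∑[ g < T ] w c g (f g)
        sacrificed-w = trans (sum-cong-≗ λ x → *-distribˡ-sum (a c x) (λ g → ⟦ R g (f g) (z c) x ⟧))
                             (∑-comm (λ x g → a c x * ⟦ R g (f g) (z c) x ⟧))
        pull : ∀ (h : Fin n → ℕ) → ∑[ x < n ] (a c x * (suc q * h x)) ≡ suc q * (∑[ x < n ] (a c x * h x))
        pull h = trans (sum-cong-≗ λ x → lem (a c x) (suc q) (h x)) (sym (*-distribˡ-sum (suc q) (λ x → a c x * h x)))
          where
          lem : ∀ a b c → a * (b * c) ≡ b * (a * c)
          lem = solve-∀
        summed : ∑[ x < n ] a c x + suc q * (∑[ g < T ] w c g (f g))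
                 ≤ suc q * (∑[ x < n ] (a c x * free f (z c) x)) + ∑[ g < T ] ∑[ e < suc q ] w c g e
        summed = subst₂ _≤_
          (trans (sum-cong-≗ λ x → trans (*-distribˡ-+ (a c x) 1 _) (cong (_+ a c x * (suc q * sacrificed f (z c) x)) (*-identityʳ (a c x))))
            (trans (∑-distrib-+ (a c) _) (cong (∑[ x < n ] a c x +_) (trans (pull (sacrificed f (z c))) (cong (suc q *_) sacrificed-w)))))
          (trans (sum-cong-≗ λ x → *-distribˡ-+ (a c x) (suc q * free f (z c) x) _)
            (trans (∑-distrib-+ (λ x → a c x * (suc q * free f (z c) x)) _) (cong₂ _+_ (pull (free f (z c))) total-w)))
          (∑-mono λ x → *-monoʳ-≤ (a c x) (pointwise f (z c) x))

  Reserve : ∀ {n T q} → Graph n → (Fin T → Fin q → Fin n → Fin n → Bool) → Fin n → Fin n → Bool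
  Reserve G R u x = adj G u x ∧ not (occupied R u x)

  -- δ(G) ≥ (1/2 + 1/ε⁻¹) n without fractions.
  LargeDegrees : ∀ {n} → Graph n → ℕ → Set
  LargeDegrees {n} G ε⁻¹ = ∀ u → (ε⁻¹ + 2) * n ≤ 2 * ε⁻¹ * (∑[ x < n ] ⟦ adj G u x ⟧)

  module _ {n T q : ℕ} (G : Graph n) (ε⁻¹ : ℕ) (large-degrees : LargeDegrees G ε⁻¹) (ε⁻¹≤n : ε⁻¹ ≤ n)
           (l : Fin T → Fin (2 + q) → List (Fin n)) (order : ∀ g e → VertexOrder (l g e))
           (R : Fin T → Fin (2 + q) → Fin n → Fin n → Bool) (disjoint : EdgeDisjointFamily R)
           (degree≤2 : ∀ g e u → ∑[ x < n ] ⟦ R g e u x ⟧ ≤ 2)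
           (Q : ℕ) (q≤Q : 2 + q ≤ Q) (small : T * (2 + q) ≤ n) where

    private
      V = Fin n

      N : ℕ
      N = (T * (2 + q)) * (n * n)

      N≤n³ : N ≤ n * n * n
      N≤n³ = ≤-trans (*-monoˡ-≤ (n * n) small) (≤-reflexive (*-comm n (n * n)))

      T≤n : T ≤ n
      T≤n = ≤-trans (m≤m*n T (2 + q)) small

      Key : Set
      Key = (Fin T × Fin (2 + q)) × (V × V)

      split : Fin (T * (2 + q)) × Fin (n * n) → Key
      split (i , j) = remQuot {T} (2 + q) i , remQuot {n} n j

      unpack : Fin N → Key
      unpack c = split (remQuot {T * (2 + q)} (n * n) c)

      pack : Fin T → Fin (2 + q) → V → V → Fin N
      pack g e u v = combine (combine g e) (combine u v)

      unpack-pack : ∀ g e u v → unpack (pack g e u v) ≡ ((g , e) , (u , v))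
      unpack-pack g e u v = trans (cong split (Fin.remQuot-combine (combine g e) (combine u v)))
                                  (cong₂ _,_ (Fin.remQuot-combine g e) (Fin.remQuot-combine u v))

      -- They turn a set of consecutive pairs into the set of its first or second vertices, as
      -- `sacrifice` requires. The values are at most 1, because a vertex starts at most one pair of
      -- an ordering and ends at most one.
      first second : (V → V → ℕ) → List V → V → ℕ
      first  φ l x = pairSum (λ s t → δ s x * φ s t) l
      second φ l y = pairSum (λ s t → δ t y * φ s t) l

      first≤1 : ∀ φ → (∀ s t → φ s t ≤ 1) → ∀ {l} → VertexOrder l → ∀ x → first φ l x ≤ 1
      first≤1 φ h {l} o x = ≤-trans (pairSum-mono (λ s t → ≤-trans (*-monoʳ-≤ (δ s x) (h s t)) (≤-reflexive (*-identityʳ _))) l)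
                                  (≤-trans (pairSum-fst (λ s → δ s x) l) (≤-reflexive (o x)))

      second≤1 : ∀ φ → (∀ s t → φ s t ≤ 1) → ∀ {l} → VertexOrder l → ∀ x → second φ l x ≤ 1
      second≤1 φ h {l} o x = ≤-trans (pairSum-mono (λ s t → ≤-trans (*-monoʳ-≤ (δ t x) (h s t)) (≤-reflexive (*-identityʳ _))) l)
                                   (≤-trans (pairSum-snd (λ s → δ s x) l) (≤-reflexive (o x)))

      pull : ∀ {ψ : V → V → V → ℕ} l (h : V → ℕ) →
             ∑[ x < n ] (pairSum (ψ x) l * h x) ≡ pairSum (λ s t → ∑[ x < n ] (h x * ψ x s t)) l
      pull {ψ} l h = trans (sum-cong-≗ λ x → trans (*-comm _ (h x)) (sym (pairSum-* (h x) (ψ x) l)))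
                           (sym (pairSum-∑ (λ x s t → h x * ψ x s t) l))

      pull-first : ∀ φ l (h : V → ℕ) → ∑[ x < n ] (first φ l x * h x) ≡ pairSum (λ s t → h s * φ s t) l
      pull-first φ l h = trans (pull l h) (pairSum-cong (λ s t → trans (sum-cong-≗ λ x → lem (h x) (δ s x) (φ s t))
          (∑-δ (λ x → h x * φ s t) s)) l)
        where
        lem : ∀ a b c → a * (b * c) ≡ b * (a * c)
        lem = solve-∀

      pull-second : ∀ φ l (h : V → ℕ) → ∑[ x < n ] (second φ l x * h x) ≡ pairSum (λ s t → h t * φ s t) l
      pull-second φ l h = trans (pull l h) (pairSum-cong (λ s t → trans (sum-cong-≗ λ x → lem (h x) (δ t x) (φ s t))
          (∑-δ (λ x → h x * φ s t) t)) l)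
        where
        lem : ∀ a b c → a * (b * c) ≡ b * (a * c)
        lem = solve-∀

      sum-first : ∀ φ l → ∑[ x < n ] first φ l x ≡ pairSum φ l
      sum-first φ l = trans (sum-cong-≗ λ x → sym (*-identityʳ (first φ l x)))
                        (trans (pull-first φ l (λ _ → 1)) (pairSum-cong (λ s t → *-identityˡ (φ s t)) l))

      sum-second : ∀ φ l → ∑[ x < n ] second φ l x ≡ pairSum φ l
      sum-second φ l = trans (sum-cong-≗ λ x → sym (*-identityʳ (second φ l x)))
                        (trans (pull-second φ l (λ _ → 1)) (pairSum-cong (λ s t → *-identityˡ (φ s t)) l))

    -- The first sacrifice keeps a share 1/(2 + q) of the places, now with ux free; the second keeps
    -- a share 1/(1 + q) of these with vy free as well, and what the first one has freed stays free.
    -- With `M = 4 * ε⁻¹ * Q` the two errors reduce 4Qn to (3Q - 1)n ≥ 2n.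
    reserve-rich : threshold (suc q) 2 (4 * ε⁻¹ * Q) < n → threshold q 2 (4 * ε⁻¹ * Q) < n →
      ∃₂ λ (f : Fin T → Fin (2 + q)) (f′ : Fin T → Fin (1 + q)) →
        ∀ g e u v → n ≤ 4 * ε⁻¹ * (Q * Q * Q) * pairSum (gain (Reserve G (keep f′ (keep f R))) u v) (l g e)
    reserve-rich large₁ large₂ = second-step (sacrifice R disjoint degree≤2 (z₁ ∘ unpack) (a₁ ∘ unpack) (a₁≤1 ∘ unpack) M N≤n³ T≤n large₁)
      where
      M = 4 * ε⁻¹ * Q
      Gain : V → V → V → V → ℕ
      Gain = gain (adj G)
      z₁ : Key → V
      z₁ (_ , (u , v)) = u
      a₁ : Key → V → ℕ
      a₁ ((g , e) , (u , v)) = first (Gain u v) (l g e)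
      a₁≤1 : ∀ k x → a₁ k x ≤ 1
      a₁≤1 ((g , e) , (u , v)) = first≤1 (Gain u v) (gain≤1 (adj G) u v) {l g e} (order g e)

      Many₁ : (Fin T → Fin (2 + q)) → Key → Set
      Many₁ f k = M * (∑[ x < n ] a₁ k x) ≤ M * ((2 + q) * (∑[ x < n ] (a₁ k x * ⟦ not (occupied (keep f R) (z₁ k) x) ⟧))) + n

      second-step : (∃ λ (f : Fin T → Fin (2 + q)) → ∀ c → Many₁ f (unpack c)) → _
      second-step (f , many₁) = finish (sacrifice R₁ (λ p q → let r , s = disjoint p q in r , injective r s) (λ g e → degree≤2 g _)
                                         (z₂ ∘ unpack) (a₂ ∘ unpack) (a₂≤1 ∘ unpack) M N≤n³ T≤n large₂)
        where
        R₁ = keep f R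
        injective : ∀ {g g′ e e′} → g ≡ g′ → punchIn (f g) e ≡ punchIn (f g′) e′ → e ≡ e′
        injective {g} refl s = Fin.punchIn-injective (f g) _ _ s
        free₁ : V → V → ℕ
        free₁ u x = ⟦ not (occupied R₁ u x) ⟧
        φ : V → V → V → V → ℕ
        φ u v s t = free₁ u s * Gain u v s t
        φ≤1 : ∀ u v s t → φ u v s t ≤ 1
        φ≤1 u v s t = *-mono-≤ (⟦⟧≤1 (not (occupied R₁ u s))) (gain≤1 (adj G) u v s t)
        z₂ : Key → V
        z₂ (_ , (u , v)) = v
        a₂ : Key → V → ℕ
        a₂ ((g , e) , (u , v)) = second (φ u v) (l g e)
        a₂≤1 : ∀ k x → a₂ k x ≤ 1
        a₂≤1 ((g , e) , (u , v)) = second≤1 (φ u v) (φ≤1 u v) {l g e} (order g e)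
        Many₂ : (Fin T → Fin (1 + q)) → Key → Set
        Many₂ f′ k = M * (∑[ x < n ] a₂ k x) ≤ M * ((1 + q) * (∑[ x < n ] (a₂ k x * ⟦ not (occupied (keep f′ R₁) (z₂ k) x) ⟧))) + n
        finish : (∃ λ (f′ : Fin T → Fin (1 + q)) → ∀ c → Many₂ f′ (unpack c)) → _
        finish (f′ , many₂) = f , f′ , λ g e u v →
            conclude g e u v (subst (Many₁ f) (unpack-pack g e u v) (many₁ (pack g e u v)))
                             (subst (Many₂ f′) (unpack-pack g e u v) (many₂ (pack g e u v)))
          where
          R₂ = keep f′ R₁
          free₂ : V → V → ℕ
          free₂ u x = ⟦ not (occupied R₂ u x) ⟧
          conclude : ∀ g e u v → Many₁ f ((g , e) , (u , v)) → Many₂ f′ ((g , e) , (u , v)) →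
                     n ≤ 4 * ε⁻¹ * (Q * Q * Q) * pairSum (gain (Reserve G R₂) u v) (l g e)
          conclude g e u v h₁ h₂ = arithmetic gap
              (subst₂ (λ a b → M * a ≤ M * ((2 + q) * b) + n) (sum-first (Gain u v) (l g e)) (pull-first (Gain u v) (l g e) (free₁ u)) h₁)
              (subst₂ (λ a b → M * a ≤ M * ((1 + q) * b) + n) (sum-second (φ u v) (l g e)) (pull-second (φ u v) (l g e) (free₂ v)) h₂)
              (pairSum-mono inclusion (l g e))
            where
            -- The degree sum exceeds n by 2n/ε⁻¹, whereas `pigeonhole-pairs` costs n + 1; the extra
            -- 1 becomes the summand `ε⁻¹`.
            gap : 2 * n ≤ ε⁻¹ * pairSum (Gain u v) (l g e) + ε⁻¹
            gap = *-cancelˡ-≤ 2 (lin 0 (+-mono-≤ (+-mono-≤ (large-degrees u) (large-degrees v))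
                    (*-monoʳ-≤ (2 * ε⁻¹) (pigeonhole-pairs (adj G u) (adj G v) {l g e} (order g e))))
                    (identity n ε⁻¹ (pairSum (Gain u v) (l g e)) (∑[ x < n ] ⟦ adj G u x ⟧) (∑[ x < n ] ⟦ adj G v x ⟧)))
              where
              identity : ∀ n e P a b → 2 * (2 * n) + ((2 * e * a + 2 * e * b) + 2 * e * (P + n + 1)) + 0
                         ≡ 2 * (e * P + e) + (((e + 2) * n + (e + 2) * n) + 2 * e * (a + b))
              identity = solve-∀
            occupied-mono : ∀ u x → occupied R₂ u x ≡ true → occupied R₁ u x ≡ true
            occupied-mono u x h with does-true (occupied? R₂ u x) h
            ... | g , e , p = dec-true (occupied? R₁ u x) (g , punchIn (f′ g) e , p)
            free-mono : ∀ u x → not (occupied R₁ u x) ≡ true → not (occupied R₂ u x) ≡ true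
            free-mono u x h with occupied R₂ u x in eq
            ... | false = refl
            ... | true rewrite occupied-mono u x eq = h
            inclusion : ∀ s t → free₂ v t * φ u v s t ≤ gain (Reserve G R₂) u v s t
            inclusion s t = begin
              free₂ v t * (free₁ u s * (⟦ adj G u s ⟧ * ⟦ adj G v t ⟧))    ≤⟨ *-monoʳ-≤ (free₂ v t) (*-monoˡ-≤ _ (⟦⟧-mono (free-mono u s))) ⟩
              free₂ v t * (free₂ u s * (⟦ adj G u s ⟧ * ⟦ adj G v t ⟧))    ≡⟨ swap (free₂ v t) (free₂ u s) ⟦ adj G u s ⟧ ⟦ adj G v t ⟧ ⟩
              (⟦ adj G u s ⟧ * free₂ u s) * (⟦ adj G v t ⟧ * free₂ v t)    ≡⟨ cong₂ _*_ (sym (⟦∧⟧ (adj G u s) _)) (sym (⟦∧⟧ (adj G v t) _)) ⟩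
              gain (Reserve G R₂) u v s t                                  ∎
              where
              open ≤-Reasoning
              swap : ∀ a b c d → a * (b * (c * d)) ≡ (c * b) * (d * a)
              swap = solve-∀
            arithmetic : ∀ {P₀ P₁ P₂ P₃} → 2 * n ≤ ε⁻¹ * P₀ + ε⁻¹ → M * P₀ ≤ M * ((2 + q) * P₁) + n → M * P₁ ≤ M * ((1 + q) * P₂) + n →
                         P₂ ≤ P₃ → n ≤ 4 * ε⁻¹ * (Q * Q * Q) * P₃
            arithmetic {P₀} {P₁} {P₂} {P₃} h₀ h₁ h₂ h₃ = *-cancelˡ-≤ {n} 2 bound
              where
              open ≤-Reasoning
              n≤ : n ≤ ε⁻¹ * P₀
              n≤ = +-cancelʳ-≤ n _ _ (≤-trans (≤-reflexive (cong (n +_) (sym (+-identityʳ n)))) (≤-trans h₀ (+-monoʳ-≤ (ε⁻¹ * P₀) ε⁻¹≤n)))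
              1≤Q : 1 ≤ Q
              1≤Q = ≤-trans (s≤s z≤n) q≤Q
              step₁ : 4 * Q * n ≤ M * (Q * P₁) + n
              step₁ = begin
                4 * Q * n                     ≤⟨ *-monoʳ-≤ (4 * Q) n≤ ⟩
                4 * Q * (ε⁻¹ * P₀)            ≡⟨ lem Q ε⁻¹ P₀ ⟩
                M * P₀                        ≤⟨ h₁ ⟩
                M * ((2 + q) * P₁) + n        ≤⟨ +-monoˡ-≤ n (*-monoʳ-≤ M (*-monoˡ-≤ P₁ q≤Q)) ⟩
                M * (Q * P₁) + n              ∎
                where
                lem : ∀ Q e P → 4 * Q * (e * P) ≡ 4 * e * Q * P
                lem = solve-∀
              step₂ : M * P₁ ≤ M * (Q * P₃) + n
              step₂ = begin
                M * P₁                        ≤⟨ h₂ ⟩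
                M * ((1 + q) * P₂) + n        ≤⟨ +-monoˡ-≤ n (*-monoʳ-≤ M (*-mono-≤ (≤-trans (n≤1+n _) q≤Q) h₃)) ⟩
                M * (Q * P₃) + n              ∎
              bound : 2 * n ≤ 2 * (4 * ε⁻¹ * (Q * Q * Q) * P₃)
              bound = begin
                2 * n                                        ≤⟨ lin 0 (+-mono-≤ step₁ (+-mono-≤ (*-monoʳ-≤ Q step₂) (*-monoʳ-≤ 3 (*-monoˡ-≤ n 1≤Q)))) (identity Q ε⁻¹ P₁ P₃ n) ⟩
                4 * ε⁻¹ * (Q * Q * Q) * P₃                   ≤⟨ m≤m+n _ _ ⟩
                2 * (4 * ε⁻¹ * (Q * Q * Q) * P₃)             ∎
                where
                identity : ∀ Q e P₁ P₃ n → 2 * n + (4 * e * Q * (Q * P₁) + n + (Q * (4 * e * Q * (Q * P₃) + n) + 3 * (Q * n))) + 0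
                           ≡ 4 * e * (Q * Q * Q) * P₃ + (4 * Q * n + (Q * (4 * e * Q * P₁) + 3 * (1 * n)))
                identity = solve-∀

  -- Greedy use of the reserve

  module _ {n : ℕ} where

    private
      V = Fin n

    nowhere : V → V → Bool
    nowhere _ _ = false

    hostLoad : V → List (V × V) → ℕ
    hostLoad v = lsum (λ e → δ (proj₂ e) v)

    ∑-hostLoad : ∀ L → ∑[ v < n ] hostLoad v L ≡ length L
    ∑-hostLoad L = trans (sym (lsum-∑ (λ v e → δ (proj₂ e) v) L))
      (trans (lsum-cong (λ e → ∑-δ-one (proj₂ e)) L) (trans (lsum-const 1 L) (*-identityʳ _)))

    hostLoad≤length : ∀ v L → hostLoad v L ≤ length L
    hostLoad≤length v L = ≤-trans (lsum-mono (λ e → ⟦⟧≤1 (does (proj₂ e Fin.≟ v))) L) (≤-reflexive (trans (lsum-const 1 L) (*-identityʳ _)))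

    used-degree : ∀ L u → ∑[ x < n ] ⟦ addEdges L nowhere u x ⟧ ≤ endLoad u L + hostLoad u L
    used-degree [] u = ≤-reflexive (∑-zero {n} λ _ → refl)
    used-degree ((s , t) ∷ L) u = begin
      ∑[ x < n ] ⟦ isEdge s t u x ∨ addEdges L nowhere u x ⟧           ≤⟨ ∑-mono (λ x → ≤-trans (⟦∨⟧ (isEdge s t u x) _) (+-monoˡ-≤ _ (edge x))) ⟩
      ∑[ x < n ] ((δ t x * δ s u + δ s x * δ t u) + ⟦ addEdges L nowhere u x ⟧)
        ≡⟨ trans (∑-distrib-+ (λ x → δ t x * δ s u + δ s x * δ t u) _) (cong (_+ ∑[ x < n ] ⟦ addEdges L nowhere u x ⟧)
             (trans (∑-distrib-+ (λ x → δ t x * δ s u) _) (cong₂ _+_ (∑-δ (λ _ → δ s u) t) (∑-δ (λ _ → δ t u) s)))) ⟩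
      δ s u + δ t u + ∑[ x < n ] ⟦ addEdges L nowhere u x ⟧            ≤⟨ +-monoʳ-≤ (δ s u + δ t u) (used-degree L u) ⟩
      δ s u + δ t u + (endLoad u L + hostLoad u L)                     ≡⟨ swap (δ s u) (δ t u) (endLoad u L) (hostLoad u L) ⟩
      δ s u + endLoad u L + (δ t u + hostLoad u L)                     ∎
      where
      open ≤-Reasoning
      swap : ∀ a b c d → a + b + (c + d) ≡ a + c + (b + d)
      swap = solve-∀
      edge : ∀ x → ⟦ isEdge s t u x ⟧ ≤ δ t x * δ s u + δ s x * δ t u
      edge x = ≤-trans (⟦∨⟧ (does (s Fin.≟ u) ∧ does (t Fin.≟ x)) _) (≤-reflexive (cong₂ _+_
        (trans (⟦∧⟧ (does (s Fin.≟ u)) _) (*-comm (δ s u) (δ t x))) (⟦∧⟧ (does (s Fin.≟ x)) _)))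

    -- Besides the pairs used before, hosts that already carry `cap` edges are excluded. This bounds
    -- the degrees of the used edges, hence the number of pairs blocked at a vertex.
    available : (H : V → V → Bool) (cap : ℕ) (L : List (V × V)) → V → V → Bool
    available H cap L u x = (H u x ∧ not (addEdges L nowhere u x)) ∧ does (hostLoad x L <? cap)

    overloaded : ℕ → List (V × V) → V → ℕ
    overloaded cap L x = ⟦ not (does (hostLoad x L <? cap)) ⟧

    ∑-overloaded : ∀ cap L → cap * (∑[ x < n ] overloaded cap L x) ≤ length L
    ∑-overloaded cap L = begin
      cap * (∑[ x < n ] overloaded cap L x)     ≡⟨ *-distribˡ-sum cap (overloaded cap L) ⟩
      ∑[ x < n ] (cap * overloaded cap L x)     ≤⟨ ∑-mono heavy ⟩
      ∑[ x < n ] hostLoad x L                   ≡⟨ ∑-hostLoad L ⟩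
      length L                                  ∎
      where
      open ≤-Reasoning
      heavy : ∀ x → cap * overloaded cap L x ≤ hostLoad x L
      heavy x = cases (hostLoad x L <? cap)
        where
        cases : (d : Dec (hostLoad x L < cap)) → cap * ⟦ not (does d) ⟧ ≤ hostLoad x L
        cases (yes _) = ≤-trans (≤-reflexive (*-zeroʳ cap)) z≤n
        cases (no h)  = ≤-trans (≤-reflexive (*-identityʳ cap)) (≮⇒≥ h)

    blocked : ℕ → List (V × V) → V → V → ℕ
    blocked cap L u x = ⟦ addEdges L nowhere u x ⟧ + overloaded cap L x

    gain-available : ∀ H cap L u v {l} → VertexOrder l →
      pairSum (gain H u v) l ≤ pairSum (gain (available H cap L) u v) l + ((∑[ x < n ] blocked cap L u x) + (∑[ x < n ] blocked cap L v x))
    gain-available H cap L u v {l} o = begin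
      pairSum (gain H u v) l                                                 ≤⟨ pairSum-mono pointwise l ⟩
      pairSum (λ x y → gain (available H cap L) u v x y + (blocked cap L u x + blocked cap L v y)) l
        ≡⟨ trans (pairSum-+ (gain (available H cap L) u v) _ l) (cong (pairSum (gain (available H cap L) u v) l +_) (pairSum-+ (λ x _ → blocked cap L u x) _ l)) ⟩
      pairSum (gain (available H cap L) u v) l + (pairSum (λ x _ → blocked cap L u x) l + pairSum (λ _ y → blocked cap L v y) l)
        ≤⟨ +-monoʳ-≤ (pairSum (gain (available H cap L) u v) l)
             (+-mono-≤ (≤-trans (pairSum-fst (blocked cap L u) l) (≤-reflexive (lsum-ordering (blocked cap L u) {l} o)))
                       (≤-trans (pairSum-snd (blocked cap L v) l) (≤-reflexive (lsum-ordering (blocked cap L v) {l} o)))) ⟩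
      pairSum (gain (available H cap L) u v) l + ((∑[ x < n ] blocked cap L u x) + (∑[ x < n ] blocked cap L v x)) ∎
      where
      open ≤-Reasoning
      pointwise : ∀ x y → gain H u v x y ≤ gain (available H cap L) u v x y + (blocked cap L u x + blocked cap L v y)
      pointwise x y = cases (H u x) (addEdges L nowhere u x) (does (hostLoad x L <? cap)) (H v y) (addEdges L nowhere v y) (does (hostLoad y L <? cap))
        where
        cases : ∀ h a c h′ a′ c′ → ⟦ h ⟧ * ⟦ h′ ⟧ ≤ ⟦ (h ∧ not a) ∧ c ⟧ * ⟦ (h′ ∧ not a′) ∧ c′ ⟧ + ((⟦ a ⟧ + ⟦ not c ⟧) + (⟦ a′ ⟧ + ⟦ not c′ ⟧))
        cases false a c h′ a′ c′ = z≤n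
        cases true a c false a′ c′ = z≤n
        cases true true c true a′ c′ = s≤s z≤n
        cases true false false true a′ c′ = s≤s z≤n
        cases true false true true true c′ = s≤s z≤n
        cases true false true true false false = ≤-refl
        cases true false true true false true = ≤-refl

    Avoids : List (V × V) → List (V × V) → Set
    Avoids es L = ∀ {x y} → (x , y) ∈ es → addEdges L nowhere x y ≡ false

    module _ (H : V → V → Bool) (a cap X C C′ : ℕ)
             (enough : ∀ L → length L ≤ n * a → (∀ u → endLoad u L ≤ X) → (∀ u → hostLoad u L ≤ cap + a) →
                       ∀ u v {P P′} → n ≤ C * P → P ≤ P′ + ((∑[ x < n ] blocked cap L u x) + (∑[ x < n ] blocked cap L v x)) → n ≤ C′ * P′) where

      -- `L` lists all edges used so far. The bounds on its length and end loads already include the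
      -- edges still to be used, so they are invariants, and `enough` shows at every step that the
      -- available part of the reserve is rich.
      process : ∀ K (l : Fin K → List V) → (∀ i → VertexOrder (l i)) → (∀ i u v → n ≤ C * pairSum (gain H u v) (l i)) →
        (E : Fin K → V → ℕ) (Out : Fin K → List (V × V) → Set) →
        (∀ i Ĥ → (∀ u v → n ≤ C′ * pairSum (gain Ĥ u v) (l i)) →
          ∃ λ es → (∀ {x y} → (x , y) ∈ es → Ĥ x y ≡ true) × length es ≤ a × (∀ v → endLoad v es ≤ E i v) × Out i es) →
        ∀ L → length L + K * a ≤ n * a → (∀ v → endLoad v L + (∑[ i < K ] E i v) ≤ X) → (∀ v → hostLoad v L ≤ cap + a) →
        ∃ λ (U : Fin K → List (V × V)) → (∀ i → Out i (U i)) × (∀ i {x y} → (x , y) ∈ U i → H x y ≡ true) ×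
          (∀ i → Avoids (U i) L) × (∀ i j → i ≢ j → ∀ {x y} → (x , y) ∈ U i → ¬ ((x , y) ∈ U j ⊎ (y , x) ∈ U j))
      process zero l o rich E Out proc L _ _ _ = (λ ()) , (λ ()) , (λ ()) , (λ ()) , λ ()
      process (suc K) l o rich E Out proc L len ends-ok hosts-ok = treat
          (proc zero Ĥ λ u v → enough L (≤-trans (m≤m+n _ _) len) (λ u → ≤-trans (m≤m+n _ _) (ends-ok u)) hosts-ok u v
              (rich zero u v) (gain-available H cap L u v {l zero} (o zero)))
        where
        Ĥ = available H cap L
        treat : (∃ λ es → (∀ {x y} → (x , y) ∈ es → Ĥ x y ≡ true) × length es ≤ a × (∀ v → endLoad v es ≤ E zero v) × Out zero es) → _
        treat (es , es⊆Ĥ , short , ends≤ , out) = extend (process K (l ∘ suc) (o ∘ suc) (rich ∘ suc) (E ∘ suc) (Out ∘ suc) (proc ∘ suc) (es ++ L)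
            (begin
              length (es ++ L) + K * a        ≡⟨ cong (_+ K * a) (length-++ es) ⟩
              length es + length L + K * a    ≤⟨ +-monoˡ-≤ (K * a) (+-monoˡ-≤ (length L) short) ⟩
              a + length L + K * a            ≡⟨ swap₁ a (length L) (K * a) ⟩
              length L + (a + K * a)          ≤⟨ len ⟩
              n * a                           ∎)
            (λ v → begin
              endLoad v (es ++ L) + rest v             ≡⟨ cong (_+ rest v) (lsum-++ _ es L) ⟩
              endLoad v es + endLoad v L + rest v      ≤⟨ +-monoˡ-≤ (rest v) (+-monoˡ-≤ (endLoad v L) (ends≤ v)) ⟩
              E zero v + endLoad v L + rest v          ≡⟨ swap₁ (E zero v) (endLoad v L) (rest v) ⟩
              endLoad v L + (E zero v + rest v)        ≤⟨ ends-ok v ⟩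
              X                                        ∎)
            hosts)
          where
          open ≤-Reasoning
          rest : V → ℕ
          rest v = ∑[ i < K ] E (suc i) v
          swap₁ : ∀ a b c → a + b + c ≡ b + (a + c)
          swap₁ = solve-∀
          split : ∀ {x y} → (x , y) ∈ es → (H x y ≡ true × addEdges L nowhere x y ≡ false) × hostLoad y L < cap
          split {x} {y} h with p , q ← ∧-true (es⊆Ĥ h) with p , r ← ∧-true p = (p , not-true r) , does-true (hostLoad y L <? cap) q
            where
            not-true : ∀ {b} → not b ≡ true → b ≡ false
            not-true {false} _ = refl
          -- A vertex with load `cap` or more receives nothing; any other one gains at most `a` in
          -- this step.
          hosts : ∀ v → hostLoad v (es ++ L) ≤ cap + a
          hosts v = ≤-trans (≤-reflexive (lsum-++ _ es L)) (bound es (λ h → proj₂ (split h)) short)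
            where
            bound : ∀ es → (∀ {x y} → (x , y) ∈ es → hostLoad y L < cap) → length es ≤ a → hostLoad v es + hostLoad v L ≤ cap + a
            bound es light short with hostLoad v L <? cap
            ... | yes p = begin
              hostLoad v es + hostLoad v L    ≤⟨ +-mono-≤ (≤-trans (hostLoad≤length v es) short) (<⇒≤ p) ⟩
              a + cap                         ≡⟨ +-comm a cap ⟩
              cap + a                         ∎
            ... | no ¬p = ≤-trans (+-monoˡ-≤ _ (≤-reflexive (none es light))) (hosts-ok v)
              where
              none : ∀ es → (∀ {x y} → (x , y) ∈ es → hostLoad y L < cap) → hostLoad v es ≡ 0
              none [] _ = refl
              none ((x , y) ∷ es) light with y Fin.≟ v
              ... | yes refl = ⊥-elim (¬p (light (here refl)))
              ... | no _ = none es (λ h → light (there h))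
          extend : (∃ λ (U : Fin K → List (V × V)) → (∀ i → Out (suc i) (U i)) × (∀ i {x y} → (x , y) ∈ U i → H x y ≡ true) ×
            (∀ i → Avoids (U i) (es ++ L)) × (∀ i j → i ≢ j → ∀ {x y} → (x , y) ∈ U i → ¬ ((x , y) ∈ U j ⊎ (y , x) ∈ U j))) → _
          extend (U , outs , U⊆H , avoids , apart) = U′ , outs′ , U′⊆H , avoids′ , apart′
            where
            U′ : Fin (suc K) → List (V × V)
            U′ zero    = es
            U′ (suc i) = U i
            outs′ : ∀ i → Out i (U′ i)
            outs′ zero    = out
            outs′ (suc i) = outs i
            U′⊆H : ∀ i {x y} → (x , y) ∈ U′ i → H x y ≡ true
            U′⊆H zero    h = proj₁ (proj₁ (split h))
            U′⊆H (suc i) h = U⊆H i h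
            false-++ : ∀ {x y} → addEdges (es ++ L) nowhere x y ≡ false → addEdges es nowhere x y ≡ false × addEdges L nowhere x y ≡ false
            false-++ {x} {y} h = lemma (λ p → absurd (trans (addEdges-++ es L nowhere x y) (addEdges-mono p)) h) ,
                                 lemma (λ p → absurd (trans (addEdges-++ es L nowhere x y) (addEdges-⊇ es p)) h)
              where
              absurd : ∀ {b} → b ≡ true → b ≡ false → ⊥
              absurd refl ()
              lemma : ∀ {b} → (b ≡ true → ⊥) → b ≡ false
              lemma {true}  f = ⊥-elim (f refl)
              lemma {false} f = refl
              addEdges-mono : addEdges es nowhere x y ≡ true → addEdges es (addEdges L nowhere) x y ≡ true
              addEdges-mono p with addEdges-∈ es p
              ... | inj₂ (inj₁ q) = addEdges-∋ {es = es} q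
              ... | inj₂ (inj₂ q) = trans (addEdges-sym es {addEdges L nowhere} (addEdges-sym L λ _ _ → refl) x y) (addEdges-∋ {es = es} q)
            avoids′ : ∀ i → Avoids (U′ i) L
            avoids′ zero    h = proj₂ (proj₁ (split h))
            avoids′ (suc i) h = proj₂ (false-++ (avoids i h))
            separate : ∀ j {x y} → (x , y) ∈ U j → ¬ ((x , y) ∈ es ⊎ (y , x) ∈ es)
            separate j {x} {y} h k = contradiction (trans (sym (used k)) (proj₁ (false-++ (avoids j h)))) λ ()
              where
              used : (x , y) ∈ es ⊎ (y , x) ∈ es → addEdges es nowhere x y ≡ true
              used (inj₁ q) = addEdges-∋ {es = es} q
              used (inj₂ q) = trans (addEdges-sym es {nowhere} (λ _ _ → refl) x y) (addEdges-∋ {es = es} q)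
            apart′ : ∀ i j → i ≢ j → ∀ {x y} → (x , y) ∈ U′ i → ¬ ((x , y) ∈ U′ j ⊎ (y , x) ∈ U′ j)
            apart′ zero zero i≢j = ⊥-elim (i≢j refl)
            apart′ (suc i) (suc j) i≢j = apart i j (λ eq → i≢j (cong suc eq))
            apart′ (suc i) zero i≢j = separate i
            apart′ zero (suc j) i≢j h (inj₁ k) = separate j k (inj₁ h)
            apart′ zero (suc j) i≢j h (inj₂ k) = separate j k (inj₂ h)

  ≤-/ : ∀ m {k n} .{{_ : NonZero m}} → m * k ≤ n → k ≤ n / m
  ≤-/ m {k} {n} h = ≤-trans (≤-reflexive (sym (m*n/m≡n m k))) (/-monoˡ-≤ m h)
    where
    m*n/m≡n : ∀ m k .{{_ : NonZero m}} → m * k / m ≡ k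
    m*n/m≡n m k = trans (cong (_/ m) (*-comm m k)) (m*n/n≡m k m)

  m*[n/m]≤n : ∀ m n .{{_ : NonZero m}} → m * (n / m) ≤ n
  m*[n/m]≤n m n = ≤-trans (≤-reflexive (*-comm m (n / m))) (m/n*n≤m n m)

  n≤2m[n/m] : ∀ m n .{{_ : NonZero m}} → m ≤ n → n ≤ 2 * m * (n / m)
  n≤2m[n/m] m n m≤n = begin
    n                              ≡⟨ m≡m%n+[m/n]*n n m ⟩
    n % m + n / m * m              ≤⟨ +-monoˡ-≤ _ (<⇒≤ (m%n<n n m)) ⟩
    m + n / m * m                  ≤⟨ +-monoˡ-≤ _ (≤-trans (≤-reflexive (sym (*-identityʳ m))) (*-monoʳ-≤ m (m≥n⇒m/n>0 m≤n))) ⟩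
    m * (n / m) + n / m * m        ≡⟨ lem m (n / m) ⟩
    2 * m * (n / m)                ∎
    where
    open ≤-Reasoning
    lem : ∀ m k → m * k + k * m ≡ 2 * m * k
    lem = solve-∀

  richness : ℕ → ℕ → ℕ
  richness ε⁻¹ Q = 4 * ε⁻¹ * (Q * Q * Q)

  -- Let C be the richness. With the host cap n/(16C), at most n · a used edges overload at most
  -- 32Ca vertices, and few enough means 16C · 32Ca ≤ n.
  sparsity : ℕ → ℕ → ℕ
  sparsity ε⁻¹ Q = 512 * (richness ε⁻¹ Q * richness ε⁻¹ Q)

  module _ {n : ℕ} (C a : ℕ) (1≤C : 1 ≤ C) (16C≤n : 16 * C ≤ n) (a-small : 512 * (C * C) * a ≤ n) where

    private
      instance
        16C≢0 : NonZero (16 * C)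
        16C≢0 = >-nonZero (*-mono-≤ {1} {16} (s≤s z≤n) 1≤C)
        n≢0 : NonZero n
        n≢0 = >-nonZero (≤-trans (*-mono-≤ {1} {16} (s≤s z≤n) 1≤C) 16C≤n)

    hostCap : ℕ
    hostCap = n / (16 * C)

    -- Four quantities block pairs at a vertex: its end load, the host cap, the excess `a` over the
    -- cap, and the overloaded hosts. Each is at most n/(16C). So u and v lose at most n/(4C) places
    -- each, together half of the n/C places.
    few-blocked : ∀ X → 512 * (C * C) * X ≤ n → ∀ L → length L ≤ n * a → (∀ u → endLoad {n} u L ≤ X) → (∀ u → hostLoad u L ≤ hostCap + a) →
      ∀ u v {P P′} → n ≤ C * P → P ≤ P′ + ((∑[ x < n ] blocked hostCap L u x) + (∑[ x < n ] blocked hostCap L v x)) → n ≤ 2 * C * P′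
    few-blocked X X-small L len ends hosts u v {P} {P′} rich bound =
        *-cancelˡ-≤ 2 (lin 0 (+-mono-≤ (*-monoʳ-≤ 4 rich) (+-mono-≤ (*-monoʳ-≤ (4 * C) bound) (+-mono-≤ (S-small u) (S-small v))))
          (identity n C P P′ (S u) (S v)))
      where
      open ≤-Reasoning
      identity : ∀ n C P P′ s t → 2 * n + (4 * (C * P) + (4 * C * (P′ + (s + t)) + (n + n))) + 0
                 ≡ 2 * (2 * C * P′) + (4 * n + (4 * C * P + (4 * C * s + 4 * C * t)))
      identity = solve-∀
      O = ∑[ x < n ] overloaded hostCap L x
      S : Fin n → ℕ
      S u = ∑[ x < n ] blocked hostCap L u x
      O-small : 16 * C * O ≤ n
      O-small = begin
        16 * C * O                  ≤⟨ *-monoʳ-≤ (16 * C) (*-cancelˡ-≤ n (begin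
          n * O                          ≤⟨ *-monoˡ-≤ O (n≤2m[n/m] (16 * C) n 16C≤n) ⟩
          2 * (16 * C) * hostCap * O     ≡⟨ *-assoc (2 * (16 * C)) hostCap O ⟩
          2 * (16 * C) * (hostCap * O)   ≤⟨ *-monoʳ-≤ (2 * (16 * C)) (≤-trans (∑-overloaded hostCap L) len) ⟩
          2 * (16 * C) * (n * a)         ≡⟨ lem C n a ⟩
          n * (2 * (16 * C) * a)         ∎)) ⟩
        16 * C * (2 * (16 * C) * a) ≡⟨ lem′ C a ⟩
        512 * (C * C) * a           ≤⟨ a-small ⟩
        n                           ∎
        where
        lem : ∀ C n a → 2 * (16 * C) * (n * a) ≡ n * (2 * (16 * C) * a)
        lem = solve-∀
        lem′ : ∀ C a → 16 * C * (2 * (16 * C) * a) ≡ 512 * (C * C) * a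
        lem′ = solve-∀
      16C≤ : ∀ Y → 16 * C * Y ≤ 512 * (C * C) * Y
      16C≤ Y = *-monoˡ-≤ Y (*-mono-≤ {16} {512} (m≤m+n 16 496) (≤-trans (≤-reflexive (sym (*-identityʳ C))) (*-monoʳ-≤ C 1≤C)))
      S-small : ∀ u → 4 * C * S u ≤ n
      S-small u = *-cancelˡ-≤ 4 (begin
        4 * (4 * C * S u)
          ≡⟨ trans (lem₁ C (S u)) (cong (16 * C *_) (∑-distrib-+ (λ x → ⟦ addEdges L nowhere u x ⟧) (overloaded hostCap L))) ⟩
        16 * C * ((∑[ x < n ] ⟦ addEdges L nowhere u x ⟧) + O)
          ≤⟨ *-monoʳ-≤ (16 * C) (+-monoˡ-≤ O (≤-trans (used-degree L u) (+-mono-≤ (ends u) (hosts u)))) ⟩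
        16 * C * (X + (hostCap + a) + O)
          ≡⟨ lem₂ (16 * C) X hostCap a O ⟩
        16 * C * X + 16 * C * hostCap + 16 * C * a + 16 * C * O
          ≤⟨ +-mono-≤ (+-mono-≤ (+-mono-≤ (≤-trans (16C≤ X) X-small) (m*[n/m]≤n (16 * C) n)) (≤-trans (16C≤ a) a-small)) O-small ⟩
        n + n + n + n
          ≡⟨ lem₃ n ⟩
        4 * n ∎)
        where
        lem₁ : ∀ C s → 4 * (4 * C * s) ≡ 16 * C * s
        lem₁ = solve-∀
        lem₂ : ∀ c x h a o → c * (x + (h + a) + o) ≡ c * x + c * h + c * a + c * o
        lem₂ = solve-∀
        lem₃ : ∀ n → n + n + n + n ≡ 4 * n
        lem₃ = solve-∀

  module _ {n T q : ℕ} (G : Graph n) (ε⁻¹ : ℕ) (1≤ε⁻¹ : 1 ≤ ε⁻¹) (large-degrees : LargeDegrees G ε⁻¹)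
           (l : Fin T → Fin (2 + q) → List (Fin n)) (order : ∀ g e → VertexOrder (l g e))
           (R : Fin T → Fin (2 + q) → Fin n → Fin n → Bool) (R-sym : ∀ g e → Symmetric (R g e))
           (R⊆G : ∀ g e {x y} → R g e x y ≡ true → adj G x y ≡ true)
           (disjoint : EdgeDisjointFamily R)
           (degree≤2 : ∀ g e u → ∑[ x < n ] ⟦ R g e u x ⟧ ≤ 2)
           (Q : ℕ) (q≤Q : 2 + q ≤ Q) (small : T * (2 + q) ≤ n)
           (E : Fin T → Fin (2 + q) → Fin n → ℕ) (a : ℕ)
           (Out : Fin T → Fin (2 + q) → List (Fin n × Fin n) → Set) where

    private
      V = Fin n
      C = richness ε⁻¹ Q

    -- Merging paths and closing gaps share this form: `Out` is what is to be achieved for each kept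
    -- member, and `E` bounds the end load it may cause. New edges come from the reserve, which
    -- contains no edge of a kept member, and are claimed only once; so the family stays
    -- edge-disjoint.
    record Round : Set where
      field
        kept       : Fin T → Fin q → Fin (2 + q)
        kept-inj   : ∀ g {e e′} → kept g e ≡ kept g e′ → e ≡ e′
        used       : Fin T → Fin q → List (V × V)
        outcome    : ∀ g e → Out g (kept g e) (used g e)
        new⊆G      : ∀ g e {x y} → addEdges (used g e) (R g (kept g e)) x y ≡ true → adj G x y ≡ true
        new-disjoint : EdgeDisjointFamily (λ g e → addEdges (used g e) (R g (kept g e)))

    round : threshold (suc q) 2 (4 * ε⁻¹ * Q) < n → threshold q 2 (4 * ε⁻¹ * Q) < n → ε⁻¹ ≤ n → 16 * C ≤ n →
      sparsity ε⁻¹ Q * a ≤ n → (∀ v → sparsity ε⁻¹ Q * (∑[ g < T ] ∑[ e < 2 + q ] E g e v) ≤ n) →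
      (∀ g e Ĥ → (∀ u v → n ≤ 2 * C * pairSum (gain Ĥ u v) (l g e)) →
        ∃ λ es → (∀ {x y} → (x , y) ∈ es → Ĥ x y ≡ true) × length es ≤ a × (∀ v → endLoad v es ≤ E g e v) × Out g e es) →
      Round
    round large₁ large₂ ε⁻¹≤n 16C≤n a-small E-small proc =
        select (reserve-rich G ε⁻¹ large-degrees ε⁻¹≤n l order R disjoint degree≤2 Q q≤Q small large₁ large₂)
      where
      1≤C : 1 ≤ C
      1≤C = *-mono-≤ {1} {4 * ε⁻¹} (*-mono-≤ {1} {4} (s≤s z≤n) 1≤ε⁻¹) (*-mono-≤ (*-mono-≤ 1≤Q 1≤Q) 1≤Q)
        where
        1≤Q : 1 ≤ Q
        1≤Q = ≤-trans (s≤s z≤n) q≤Q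
      instance
        M≢0 : NonZero (sparsity ε⁻¹ Q)
        M≢0 = >-nonZero (*-mono-≤ {1} {512} (s≤s z≤n) (*-mono-≤ 1≤C 1≤C))

      X : ℕ
      X = n / sparsity ε⁻¹ Q

      select : (∃₂ λ (f : Fin T → Fin (2 + q)) (f′ : Fin T → Fin (1 + q)) →
          ∀ g e u v → n ≤ C * pairSum (gain (Reserve G (keep f′ (keep f R))) u v) (l g e)) → Round
      select (f , f′ , rich) = assemble (process H a (hostCap C a 1≤C 16C≤n a-small) X C (2 * C)
          (few-blocked C a 1≤C 16C≤n a-small X (m*[n/m]≤n (sparsity ε⁻¹ Q) n))
          (T * q) (λ k → l (group k) (member k)) (λ k → order (group k) (member k)) (λ k → rich (group k) (member k))
          (λ k → E (group k) (member k)) (λ k → Out (group k) (member k)) (λ k → proc (group k) (member k))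
          [] (*-monoˡ-≤ a (≤-trans (*-monoʳ-≤ T (m≤n+m q 2)) small)) (λ v → ≤-/ (sparsity ε⁻¹ Q) (≤-trans (*-monoʳ-≤ (sparsity ε⁻¹ Q) (budget v)) (E-small v))) (λ _ → z≤n))
        where
        ι : Fin T → Fin q → Fin (2 + q)
        ι g e = punchIn (f g) (punchIn (f′ g) e)
        ι-inj : ∀ g {e e′} → ι g e ≡ ι g e′ → e ≡ e′
        ι-inj g h = Fin.punchIn-injective (f′ g) _ _ (Fin.punchIn-injective (f g) _ _ h)
        R₂ = keep f′ (keep f R)
        H : V → V → Bool
        H = Reserve G R₂
        group : Fin (T * q) → Fin T
        group k = proj₁ (remQuot q k)
        member : ∀ k → Fin (2 + q)
        member k = ι (group k) (proj₂ (remQuot {T} q k))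
        budget : ∀ v → ∑[ k < T * q ] E (group k) (member k) v ≤ ∑[ g < T ] ∑[ e < 2 + q ] E g e v
        budget v = ≤-trans (≤-reflexive (∑-combine T q (λ g e → E g (ι g e) v)))
                         (∑-mono λ g → ∑-injective (ι g) (λ _ _ → ι-inj g) (λ e → E g e v))
        assemble : (∃ λ (U : Fin (T * q) → List (V × V)) → (∀ k → Out (group k) (member k) (U k)) ×
            (∀ k {x y} → (x , y) ∈ U k → H x y ≡ true) × (∀ k → Avoids (U k) []) ×
            (∀ k k′ → k ≢ k′ → ∀ {x y} → (x , y) ∈ U k → ¬ ((x , y) ∈ U k′ ⊎ (y , x) ∈ U k′))) → Round
        assemble (U , outs , U⊆H , _ , apart) = record
          { kept = ι ; kept-inj = ι-inj ; used = used ; outcome = outcome ; new⊆G = new⊆G ; new-disjoint = new-disjoint }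
          where
          used : Fin T → Fin q → List (V × V)
          used g e = U (combine g e)
          outcome : ∀ g e → Out g (ι g e) (used g e)
          outcome g e = subst (λ ge → Out (proj₁ ge) (ι (proj₁ ge) (proj₂ ge)) (used g e)) (Fin.remQuot-combine g e) (outs (combine g e))
          used⊆G : ∀ g e {x y} → (x , y) ∈ used g e ⊎ (y , x) ∈ used g e → adj G x y ≡ true × occupied R₂ x y ≡ false
          used⊆G g e {x} {y} (inj₁ h) with p , q ← ∧-true {adj G x y} (U⊆H (combine g e) h) = p , unnot q
            where
            unnot : ∀ {b} → not b ≡ true → b ≡ false
            unnot {false} _ = refl
          used⊆G g e {x} {y} (inj₂ h) with p , q ← used⊆G g e {y} {x} (inj₁ h) = trans (adj-sym G x y) p , occupied-sym q
            where
            occupied-sym : occupied R₂ y x ≡ false → occupied R₂ x y ≡ false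
            occupied-sym q with occupied R₂ x y in eq
            ... | false = refl
            ... | true with does-true (occupied? R₂ x y) eq
            ...   | g , e , r = trans (sym (dec-true (occupied? R₂ y x) (g , e , trans (R-sym g (ι g e) y x) r))) q
          clash : ∀ {g e g′ e′ x y} → R g (ι g e) x y ≡ true → ¬ ((x , y) ∈ used g′ e′ ⊎ (y , x) ∈ used g′ e′)
          clash {g} {e} {g′} {e′} {x} {y} r h with trans (sym (dec-true (occupied? R₂ x y) (g , e , r))) (proj₂ (used⊆G g′ e′ h))
          ... | ()
          new⊆G : ∀ g e {x y} → addEdges (used g e) (R g (ι g e)) x y ≡ true → adj G x y ≡ true
          new⊆G g e {x} {y} h with addEdges-∈ (used g e) h
          ... | inj₁ r = R⊆G g (ι g e) r
          ... | inj₂ u = proj₁ (used⊆G g e u)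
          swap : ∀ {g e x y} → (x , y) ∈ used g e ⊎ (y , x) ∈ used g e → (y , x) ∈ used g e ⊎ (x , y) ∈ used g e
          swap (inj₁ h) = inj₂ h
          swap (inj₂ h) = inj₁ h
          same : ∀ {g e g′ e′ x y} → (x , y) ∈ used g e ⊎ (y , x) ∈ used g e → (x , y) ∈ used g′ e′ ⊎ (y , x) ∈ used g′ e′ → g ≡ g′ × e ≡ e′
          same {g} {e} {g′} {e′} (inj₁ h) k with combine g e Fin.≟ combine g′ e′
          ... | yes eq = Fin.combine-injective g e g′ e′ eq
          ... | no neq = ⊥-elim (apart (combine g e) (combine g′ e′) neq h k)
          same (inj₂ h) k = same (inj₁ h) (swap k)
          new-disjoint : EdgeDisjointFamily (λ g e → addEdges (used g e) (R g (ι g e)))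
          new-disjoint {g} {e} {g′} {e′} p p′ with addEdges-∈ (used g e) p | addEdges-∈ (used g′ e′) p′
          ... | inj₁ r | inj₁ r′ with refl , s ← disjoint r r′ = refl , ι-inj g s
          ... | inj₁ r | inj₂ u′ = ⊥-elim (clash r u′)
          ... | inj₂ u | inj₁ r′ = ⊥-elim (clash r′ u)
          ... | inj₂ u | inj₂ u′ = same u u′

  -- Closing all gaps

  module _ {n : ℕ} where

    private
      V = Fin n

    gaps : (V → V → Bool) → (V → V → ℕ) → List V → ℕ
    gaps R h = cycSum (λ x y → missing R x y * h x y)

    unweighted : V → V → ℕ
    unweighted _ _ = 1

    at : V → V → V → ℕ
    at v x y = δ x v + δ y v

    at-sym : ∀ v x y → at v x y ≡ at v y x
    at-sym v x y = +-comm (δ x v) (δ y v)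

    pairsFrom : V → List V → List (V × V)
    pairsFrom x []      = []
    pairsFrom x (y ∷ l) = (x , y) ∷ pairsFrom y l

    cycPairs : List V → List (V × V)
    cycPairs []      = []
    cycPairs (x ∷ l) = (lst x l , x) ∷ pairsFrom x l

    cycSum-lsum : ∀ f l → cycSum f l ≡ lsum (uncurry f) (cycPairs l)
    cycSum-lsum f []      = refl
    cycSum-lsum f (x ∷ l) = cong (f (lst x l) x +_) (go x l)
      where
      go : ∀ x l → pairSum f (x ∷ l) ≡ lsum (uncurry f) (pairsFrom x l)
      go x []      = refl
      go x (y ∷ l) = cong (f x y +_) (go y l)

    -- A 2-opt move takes xy out of the ordering, but adding edges to `R` does not take it out of
    -- `R`. Trimming returns such edges to the reserve and restores the degree bound 2 that
    -- `sacrifice` demands.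
    trim : (V → V → Bool) → List V → V → V → Bool
    trim R l x y = R x y ∧ does (0 <? lsum (λ e → ⟦ isEdge (proj₁ e) (proj₂ e) x y ⟧) (cycPairs l))

    trim-⊆ : ∀ R l {x y} → trim R l x y ≡ true → R x y ≡ true
    trim-⊆ R l h = proj₁ (∧-true h)

    trim-sym : ∀ R l → Symmetric R → Symmetric (trim R l)
    trim-sym R l s x y = cong₂ (λ b k → b ∧ does (0 <? k)) (s x y)
      (lsum-cong (λ e → cong ⟦_⟧ (isEdge-sym (proj₁ e) (proj₂ e) x y)) (cycPairs l))

    trim-degree : ∀ R {l} → VertexOrder l → ∀ u → ∑[ x < n ] ⟦ trim R l u x ⟧ ≤ 2
    trim-degree R {l} o u = begin
      ∑[ x < n ] ⟦ trim R l u x ⟧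
        ≤⟨ ∑-mono (λ x → ≤-trans (⟦⟧-mono (λ h → proj₂ (∧-true {R u x} h))) (indicator (0 <? _))) ⟩
      ∑[ x < n ] lsum (λ e → ⟦ isEdge (proj₁ e) (proj₂ e) u x ⟧) (cycPairs l)
        ≡⟨ sym (lsum-∑ (λ x e → ⟦ isEdge (proj₁ e) (proj₂ e) u x ⟧) (cycPairs l)) ⟩
      lsum (λ e → ∑[ x < n ] ⟦ isEdge (proj₁ e) (proj₂ e) u x ⟧) (cycPairs l)
        ≤⟨ lsum-mono (λ e → edge (proj₁ e) (proj₂ e)) (cycPairs l) ⟩
      lsum (λ e → δ (proj₁ e) u + δ (proj₂ e) u) (cycPairs l)
        ≡⟨ sym (cycSum-lsum (λ x y → δ x u + δ y u) l) ⟩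
      cycSum (λ x y → δ x u + δ y u) l
        ≤⟨ incidence l ⟩
      cnt u l + cnt u l
        ≡⟨ cong₂ _+_ (o u) (o u) ⟩
      2 ∎
      where
      open ≤-Reasoning
      indicator : ∀ {k} (d : Dec (0 < k)) → ⟦ does d ⟧ ≤ k
      indicator (yes p) = p
      indicator (no _)  = z≤n
      edge : ∀ s t → ∑[ x < n ] ⟦ isEdge s t u x ⟧ ≤ δ s u + δ t u
      edge s t = ≤-trans (∑-mono λ x → ≤-trans (⟦∨⟧ (does (s Fin.≟ u) ∧ does (t Fin.≟ x)) _) (≤-reflexive (cong₂ _+_
          (trans (⟦∧⟧ (does (s Fin.≟ u)) _) (*-comm (δ s u) (δ t x))) (⟦∧⟧ (does (s Fin.≟ x)) _))))
        (≤-reflexive (trans (∑-distrib-+ (λ x → δ t x * δ s u) _) (cong₂ _+_ (∑-δ (λ _ → δ s u) t) (∑-δ (λ _ → δ t u) s))))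
      incidence : ∀ l → cycSum (λ x y → δ x u + δ y u) l ≤ cnt u l + cnt u l
      incidence [] = z≤n
      incidence (x ∷ l) = ≤-reflexive (begin-equality
        δ (lst x l) u + δ x u + pairSum (λ x y → δ x u + δ y u) (x ∷ l)
          ≡⟨ cong (δ (lst x l) u + δ x u +_) (trans (pairSum-+ (λ x _ → δ x u) (λ _ y → δ y u) (x ∷ l))
               (cong (pairSum (λ x _ → δ x u) (x ∷ l) +_) (pairSum-snd-tail (λ y → δ y u) x l))) ⟩
        δ (lst x l) u + δ x u + (pairSum (λ x _ → δ x u) (x ∷ l) + cnt u l)
          ≡⟨ swap (δ (lst x l) u) (δ x u) (pairSum (λ x _ → δ x u) (x ∷ l)) (cnt u l) ⟩
        pairSum (λ x _ → δ x u) (x ∷ l) + δ (lst x l) u + (δ x u + cnt u l)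
          ≡⟨ cong (_+ (δ x u + cnt u l)) (pairSum-fst-lst (λ x → δ x u) x l) ⟩
        cnt u (x ∷ l) + cnt u (x ∷ l) ∎)
        where
        swap : ∀ a b c d → a + b + (c + d) ≡ c + a + (b + d)
        swap = solve-∀

    trim-gaps : ∀ R l h → gaps (trim R l) h l ≤ gaps R h l
    trim-gaps R l h = begin
      gaps (trim R l) h l                                                               ≡⟨ cycSum-lsum _ l ⟩
      lsum (uncurry λ x y → missing (trim R l) x y * h x y) (cycPairs l)                ≤⟨ go (cycPairs l) (λ e → m≤m+n _ 0) ⟩
      lsum (uncurry λ x y → missing R x y * h x y) (cycPairs l)                         ≡⟨ cycSum-lsum _ l ⟨
      gaps R h l                                                                        ∎
      where
      open ≤-Reasoning
      count : V × V → List (V × V) → ℕ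
      count f = lsum (λ e → ⟦ isEdge (proj₁ e) (proj₂ e) (proj₁ f) (proj₂ f) ⟧)
      self : ∀ e → ⟦ isEdge (proj₁ e) (proj₂ e) (proj₁ e) (proj₂ e) ⟧ ≡ 1
      self (u , v) rewrite dec-true (u Fin.≟ u) refl | dec-true (v Fin.≟ v) refl = refl
      keep-pair : ∀ {x y} → 0 < count (x , y) (cycPairs l) → missing (trim R l) x y ≤ missing R x y
      keep-pair {x} {y} p = ≤-reflexive (cong (λ b → ⟦ not b ⟧) (trans (cong (R x y ∧_) (dec-true (0 <? count (x , y) (cycPairs l)) p)) (Bool.∧-identityʳ (R x y))))
      go : ∀ es → (∀ f → count f es ≤ count f (cycPairs l) + 0) →
           lsum (uncurry λ x y → missing (trim R l) x y * h x y) es ≤ lsum (uncurry λ x y → missing R x y * h x y) es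
      go [] _ = z≤n
      go ((x , y) ∷ es) sub = +-mono-≤
        (*-monoˡ-≤ (h x y) (keep-pair (≤-trans (≤-trans (≤-reflexive (sym (self (x , y)))) (m≤m+n _ (count (x , y) es)))
                                       (≤-trans (sub (x , y)) (≤-reflexive (+-identityʳ _))))))
        (go es λ f → ≤-trans (m≤n+m (count f es) _) (sub f))

    -- The cyclic list is rotated until a gap, if there is one, becomes its closing pair, which is
    -- the pair that `2-opt` removes.
    record Normalised (R : V → V → Bool) (l : List V) : Set where
      field
        first    : V
        rest     : List V
        order    : VertexOrder (first ∷ rest)
        same     : ∀ f → cycSum f (first ∷ rest) ≡ cycSum f l
        closing  : missing R (lst first rest) first ≡ 1 ⊎ gaps R unweighted l ≡ 0

    normalise : ∀ R l → VertexOrder l → 0 < n → Normalised R l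
    normalise R [] o 0<n = ⊥-elim (<-irrefl (length-ordering {l = []} o) 0<n)
    normalise R (x ∷ l) o 0<n with R (lst x l) x in eq
    ... | false = record { first = x ; rest = l ; order = o ; same = λ _ → refl ; closing = inj₁ (cong (λ b → ⟦ not b ⟧) eq) }
    ... | true with 0 <? pairSum (λ x y → missing R x y * 1) (x ∷ l)
    ...   | no none = record { first = x ; rest = l ; order = o ; same = λ _ → refl
                             ; closing = inj₂ (cong₂ _+_ (cong (λ b → ⟦ not b ⟧ * 1) eq) (n≤0⇒n≡0 (≮⇒≥ none))) }
    ...   | yes some with A , y , B , refl , p ← pairSum-find (λ x y → missing R x y * 1) x l some = record
      { first = y ; rest = B ++ x ∷ A
      ; order = λ v → trans (lsum-++ (λ z → δ z v) (y ∷ B) (x ∷ A)) (trans (+-comm (cnt v (y ∷ B)) _)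
                      (trans (sym (lsum-++ (λ z → δ z v) (x ∷ A) (y ∷ B))) (o v)))
      ; same = λ f → sym (cycSum-rotate f x A y B)
      ; closing = inj₁ (trans (cong (λ z → missing R z y) (lst-++ y B x A)) (pos⇒1 p)) }
      where
      pos⇒1 : ∀ {b} → 0 < ⟦ b ⟧ * 1 → ⟦ b ⟧ ≡ 1
      pos⇒1 {true} _ = refl

  -- Each round costs a group two members; this size leaves `q` of them after `m` rounds.
  widen : ℕ → ℕ → ℕ
  widen q zero    = q
  widen q (suc m) = 2 + widen q m

  widen-def : ∀ q m → widen q m ≡ 2 * m + q
  widen-def q zero    = refl
  widen-def q (suc m) = trans (cong (2 +_) (widen-def q m)) (lem m q)
    where
    lem : ∀ m q → 2 + (2 * m + q) ≡ 2 * suc m + q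
    lem = solve-∀

  positive-factor : ∀ c {n P} → 0 < n → n ≤ c * P → 0 < P
  positive-factor c {P = zero}  0<n h = ⊥-elim (<-irrefl refl (<-≤-trans 0<n (≤-trans h (≤-reflexive (*-zeroʳ c)))))
  positive-factor c {P = suc P} 0<n h = s≤s z≤n

  module _ {n : ℕ} (G : Graph n) where

    private
      V = Fin n

    -- Consecutive pairs outside the edge set `R g e` are the gaps. Disjointness is required of the
    -- edge sets, as gaps of different orderings may coincide.
    record CycleFamily (T q m : ℕ) : Set where
      field
        l        : Fin T → Fin q → List V
        order    : ∀ g e → VertexOrder (l g e)
        R        : Fin T → Fin q → V → V → Bool
        R-sym    : ∀ g e → Symmetric (R g e)
        R⊆G      : ∀ g e {x y} → R g e x y ≡ true → adj G x y ≡ true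
        disjoint : EdgeDisjointFamily R
        few-gaps : ∀ g e → gaps (R g e) unweighted (l g e) ≤ m

      gapLoad : V → ℕ
      gapLoad v = ∑[ g < T ] ∑[ e < q ] gaps (R g e) (at v) (l g e)

    module _ (ε⁻¹ : ℕ) (1≤ε⁻¹ : 1 ≤ ε⁻¹) (large-degrees : LargeDegrees G ε⁻¹) (Q : ℕ)
             (n-large : ∀ q → q ≤ Q → threshold q 2 (4 * ε⁻¹ * Q) < n) (ε⁻¹≤n : ε⁻¹ ≤ n)
             (16C≤n : 16 * richness ε⁻¹ Q ≤ n) (2-small : sparsity ε⁻¹ Q * 2 ≤ n) where

      -- The new edges are charged to the ends of the gap that they close, and no gap arises. So
      -- `gapLoad` does not increase, and the same sparsity condition serves in every round.
      close-one-gap : ∀ {T q m} → 2 + q ≤ Q → T * (2 + q) ≤ n → (F : CycleFamily T (2 + q) (suc m)) →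
        (∀ v → sparsity ε⁻¹ Q * CycleFamily.gapLoad F v ≤ n) →
        ∃ λ (F′ : CycleFamily T q m) → ∀ v → CycleFamily.gapLoad F′ v ≤ CycleFamily.gapLoad F v
      close-one-gap {T} {q} {m} q≤Q small F sparse = assemble
          (round G ε⁻¹ 1≤ε⁻¹ large-degrees l′ order′ R′ (λ g e → trim-sym (R g e) (l g e) (R-sym g e))
            (λ g e h → R⊆G g e (trim-⊆ (R g e) (l g e) h))
            (λ {g} {e} {g′} {e′} p p′ → disjoint (trim-⊆ (R g e) (l g e) p) (trim-⊆ (R g′ e′) (l g′ e′) p′))
            (λ g e → trim-degree (R g e) {l g e} (order g e)) Q q≤Q small E 2 Out
            (n-large (suc q) (≤-trans (n≤1+n _) q≤Q)) (n-large q (≤-trans (≤-trans (n≤1+n _) (n≤1+n _)) q≤Q)) ε⁻¹≤n 16C≤n 2-small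
            (λ v → ≤-trans (*-monoʳ-≤ (sparsity ε⁻¹ Q) (∑-mono λ g → ∑-mono λ e → E≤ g e (at v))) (sparse v))
            proc)
        where
        open CycleFamily F
        0<n : 0 < n
        0<n = ≤-<-trans z≤n (n-large 0 z≤n)
        R′ : Fin T → Fin (2 + q) → V → V → Bool
        R′ g e = trim (R g e) (l g e)
        nf : ∀ g e → Normalised (R′ g e) (l g e)
        nf g e = normalise (R′ g e) (l g e) (order g e) 0<n
        l′ : Fin T → Fin (2 + q) → List V
        l′ g e = Normalised.first (nf g e) ∷ Normalised.rest (nf g e)
        order′ : ∀ g e → VertexOrder (l′ g e)
        order′ g e = Normalised.order (nf g e)
        E : Fin T → Fin (2 + q) → V → ℕ
        E g e v = gaps (R′ g e) (at v) (l′ g e)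
        E≤ : ∀ g e h → gaps (R′ g e) h (l′ g e) ≤ gaps (R g e) h (l g e)
        E≤ g e h = ≤-trans (≤-reflexive (Normalised.same (nf g e) _)) (trim-gaps (R g e) (l g e) h)
        Out : ∀ g e → List (V × V) → Set
        Out g e es = ∃ λ route → VertexOrder route × (∀ h → (∀ x y → h x y ≡ h y x) → gaps (addEdges es (R′ g e)) h route ≤ gaps (R′ g e) h (l′ g e)) ×
                       gaps (addEdges es (R′ g e)) unweighted route ≤ m
        proc : ∀ g e Ĥ → (∀ u v → n ≤ 2 * richness ε⁻¹ Q * pairSum (gain Ĥ u v) (l′ g e)) →
               ∃ λ es → (∀ {x y} → (x , y) ∈ es → Ĥ x y ≡ true) × length es ≤ 2 × (∀ v → endLoad v es ≤ E g e v) × Out g e es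
        proc g e Ĥ rich = by-closing (Normalised.closing (nf g e))
          where
          open ≤-Reasoning
          b = Normalised.first (nf g e)
          a = lst b (Normalised.rest (nf g e))
          rerouted : Rerouted Ĥ (R′ g e) b (Normalised.rest (nf g e))
          rerouted = 2-opt Ĥ (trim-sym (R g e) (l g e) (R-sym g e)) {b} {Normalised.rest (nf g e)} (order′ g e)
                       (positive-factor (2 * richness ε⁻¹ Q) 0<n (rich a b))
          open Rerouted rerouted renaming (order to order″; ends to end-loads)
          by-closing : missing (R′ g e) a b ≡ 1 ⊎ gaps (R′ g e) unweighted (l g e) ≡ 0 →
               ∃ λ es → (∀ {x y} → (x , y) ∈ es → Ĥ x y ≡ true) × length es ≤ 2 × (∀ v → endLoad v es ≤ E g e v) × Out g e es
          by-closing (inj₂ none) = [] , (λ ()) , z≤n , (λ _ → z≤n) , l′ g e , order′ g e , (λ _ _ → ≤-refl) ,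
                          ≤-trans (≤-reflexive (trans (Normalised.same (nf g e) _) none)) z≤n
          by-closing (inj₁ gap) = used , used⊆H , short , (λ v → ≤-trans (end-loads v) (≤-trans (closing-weight (at v)) (m≤m+n _ _))) ,
                         route , order″ , (λ h s → ≤-trans (m≤m+n _ _) (fewer h s)) ,
                         s≤s⁻¹ (begin
                           suc (gaps (addEdges used (R′ g e)) unweighted route)      ≡⟨ +-comm 1 _ ⟩
                           gaps (addEdges used (R′ g e)) unweighted route + 1        ≤⟨ +-monoʳ-≤ _ (closing-weight unweighted) ⟩
                           gaps (addEdges used (R′ g e)) unweighted route + missing (R′ g e) a b * 1 ≤⟨ fewer unweighted (λ _ _ → refl) ⟩
                           gaps (R′ g e) unweighted (l′ g e)                         ≤⟨ E≤ g e unweighted ⟩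
                           gaps (R g e) unweighted (l g e)                           ≤⟨ few-gaps g e ⟩
                           suc m                                              ∎)
            where
            closing-weight : ∀ h → h a b ≤ missing (R′ g e) a b * h a b
            closing-weight h = ≤-reflexive (sym (trans (cong (_* h a b) gap) (*-identityˡ (h a b))))
        assemble : Round G ε⁻¹ 1≤ε⁻¹ large-degrees l′ order′ R′ (λ g e → trim-sym (R g e) (l g e) (R-sym g e))
            (λ g e h → R⊆G g e (trim-⊆ (R g e) (l g e) h))
            (λ {g} {e} {g′} {e′} p p′ → disjoint (trim-⊆ (R g e) (l g e) p) (trim-⊆ (R g′ e′) (l g′ e′) p′))
            (λ g e → trim-degree (R g e) {l g e} (order g e)) Q q≤Q small E 2 Out → _
        assemble r = record
            { l = λ g e → proj₁ (outcome g e) ; order = λ g e → proj₁ (proj₂ (outcome g e))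
            ; R = λ g e → addEdges (used g e) (R′ g (kept g e))
            ; R-sym = λ g e → addEdges-sym (used g e) (trim-sym (R g (kept g e)) (l g (kept g e)) (R-sym g (kept g e)))
            ; R⊆G = new⊆G ; disjoint = new-disjoint
            ; few-gaps = λ g e → proj₂ (proj₂ (proj₂ (outcome g e))) } ,
          λ v → ∑-mono λ g → ≤-trans (∑-mono λ e → ≤-trans (proj₁ (proj₂ (proj₂ (outcome g e))) (at v) (at-sym v)) (E≤ g (kept g e) (at v)))
                                     (∑-injective (kept g) (λ _ _ → kept-inj g) (λ e → gaps (R g e) (at v) (l g e)))
          where open Round r

      -- `Q` bounds the group size of the first round and therefore of all later ones, so the
      -- constants do not deteriorate from round to round.
      close-gaps : ∀ {T q} m → widen q m ≤ Q → T * widen q m ≤ n → (F : CycleFamily T (widen q m) m) →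
        (∀ v → sparsity ε⁻¹ Q * CycleFamily.gapLoad F v ≤ n) → CycleFamily T q 0
      close-gaps zero    _   _     F _      = F
      close-gaps {T} {q} (suc m) q≤Q small F sparse = continue (close-one-gap q≤Q small F sparse)
        where
        continue : (∃ λ (F′ : CycleFamily T (widen q m) m) → ∀ v → CycleFamily.gapLoad F′ v ≤ CycleFamily.gapLoad F v) → CycleFamily T q 0
        continue (F′ , lighter) = close-gaps m (≤-trans (m≤n+m _ 2) q≤Q) (≤-trans (*-monoʳ-≤ T (m≤n+m _ 2)) small) F′
          (λ v → ≤-trans (*-monoʳ-≤ (sparsity ε⁻¹ Q) (lighter v)) (sparse v))

  -- Merging paths

  module _ {n : ℕ} where

    private
      V = Fin n

    -- Since `f` vanishes inside the paths, only the transitions from the last vertex of a path to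
    -- the first vertex of the next one contribute. Splitting their weight into `α` and `β` charges
    -- every path with its own two ends.
    junctions : (f : V → V → ℕ) (α β : V → ℕ) → (∀ x y → f x y ≤ α x + β y) →
      ∀ ps → lsum (pairSum f) ps ≡ 0 → (w : List V → ℕ) → (∀ x l → w (x ∷ l) ≡ α (lst x l) + β x) →
      cycSum f (concat ps) ≤ lsum w ps
    junctions f α β f≤ ps zero-inside w w≡ = wrap (concat ps) refl
      where
      open ≤-Reasoning
      -- The term `α (lst x t) + β x` stands for the closing pair; with it the induction can charge
      -- every path in full.
      linear : ∀ ps → lsum (pairSum f) ps ≡ 0 → ∀ x t → concat ps ≡ x ∷ t → pairSum f (x ∷ t) + (α (lst x t) + β x) ≤ lsum w ps
      linear ([] ∷ ps) z x t eq = ≤-trans (linear ps z x t eq) (m≤n+m _ (w []))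
      linear ((y ∷ p) ∷ ps) z x t eq with concat ps in tail-eq
      linear ((y ∷ p) ∷ ps) z x t refl | [] = begin
        pairSum f (y ∷ p ++ []) + (α (lst y (p ++ [])) + β y)   ≡⟨ cong (λ p → pairSum f (y ∷ p) + (α (lst y p) + β y)) (++-identityʳ p) ⟩
        pairSum f (y ∷ p) + (α (lst y p) + β y)                 ≡⟨ cong₂ _+_ (m+n≡0⇒m≡0 (pairSum f (y ∷ p)) z) (sym (w≡ y p)) ⟩
        w (y ∷ p)                                               ≤⟨ m≤m+n _ _ ⟩
        w (y ∷ p) + lsum w ps                                   ∎
      linear ((y ∷ p) ∷ ps) z x t refl | s ∷ r = begin
        pairSum f (y ∷ p ++ s ∷ r) + (α (lst y (p ++ s ∷ r)) + β y)
          ≡⟨ cong₂ _+_ (trans (pairSum-++ f y p s r) (cong (_+ (f (lst y p) s + pairSum f (s ∷ r))) (m+n≡0⇒m≡0 (pairSum f (y ∷ p)) z))) (cong (λ q → α q + β y) (lst-++ y p s r)) ⟩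
        f (lst y p) s + pairSum f (s ∷ r) + (α (lst s r) + β y)
          ≤⟨ +-monoˡ-≤ _ (+-monoˡ-≤ (pairSum f (s ∷ r)) (f≤ (lst y p) s)) ⟩
        α (lst y p) + β s + pairSum f (s ∷ r) + (α (lst s r) + β y)
          ≡⟨ swap (α (lst y p)) (β s) (pairSum f (s ∷ r)) (α (lst s r)) (β y) ⟩
        α (lst y p) + β y + (pairSum f (s ∷ r) + (α (lst s r) + β s))
          ≤⟨ +-mono-≤ (≤-reflexive (sym (w≡ y p))) (linear ps (m+n≡0⇒n≡0 (pairSum f (y ∷ p)) z) s r tail-eq) ⟩
        w (y ∷ p) + lsum w ps ∎
        where
        swap : ∀ a b c d e → a + b + c + (d + e) ≡ a + e + (c + (d + b))
        swap = solve-∀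
      wrap : ∀ l → concat ps ≡ l → cycSum f (concat ps) ≤ lsum w ps
      wrap []      eq rewrite eq = z≤n
      wrap (x ∷ t) eq = begin
        cycSum f (concat ps)                           ≡⟨ cong (cycSum f) eq ⟩
        f (lst x t) x + pairSum f (x ∷ t)              ≤⟨ +-monoˡ-≤ _ (f≤ (lst x t) x) ⟩
        α (lst x t) + β x + pairSum f (x ∷ t)          ≡⟨ +-comm _ (pairSum f (x ∷ t)) ⟩
        pairSum f (x ∷ t) + (α (lst x t) + β x)        ≤⟨ linear ps zero-inside x t eq ⟩
        lsum w ps                                      ∎

    pairSum-concat : (f : V → V → ℕ) → (∀ x y → f x y ≤ 1) → ∀ ps → pairSum f (concat ps) ≤ lsum (pairSum f) ps + length ps
    pairSum-concat f f≤1 []       = z≤n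
    pairSum-concat f f≤1 (p ∷ ps) = begin
      pairSum f (p ++ concat ps)                               ≤⟨ append p (concat ps) ⟩
      pairSum f p + (1 + pairSum f (concat ps))                ≤⟨ +-monoʳ-≤ (pairSum f p) (s≤s (pairSum-concat f f≤1 ps)) ⟩
      pairSum f p + (1 + (lsum (pairSum f) ps + length ps))    ≡⟨ lem (pairSum f p) (lsum (pairSum f) ps) (length ps) ⟩
      pairSum f p + lsum (pairSum f) ps + (1 + length ps)      ∎
      where
      open ≤-Reasoning
      lem : ∀ a b c → a + (1 + (b + c)) ≡ a + b + (1 + c)
      lem = solve-∀
      append : ∀ p q → pairSum f (p ++ q) ≤ pairSum f p + (1 + pairSum f q)
      append [] q = n≤1+n _
      append (x ∷ p) [] = ≤-trans (≤-reflexive (cong (λ z → pairSum f (x ∷ z)) (++-identityʳ p))) (m≤m+n _ _)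
      append (x ∷ p) (y ∷ q) = ≤-trans (≤-reflexive (pairSum-++ f x p y q)) (+-monoʳ-≤ (pairSum f (x ∷ p)) (+-monoˡ-≤ _ (f≤1 (lst x p) y)))

    path-gaps : ∀ {R ps} → lsum (pairSum (missing R)) ps ≡ 0 → gaps R unweighted (concat ps) ≤ length ps
    path-gaps {R} {ps} z = ≤-trans (junctions _ (λ _ → 1) (λ _ → 0) (λ x y → ≤-trans (≤-reflexive (*-identityʳ _)) (⟦⟧≤1 (not (R x y)))) ps
        (trans (lsum-cong (pairSum-cong λ x y → *-identityʳ (missing R x y)) ps) z) (λ _ → 1) (λ _ _ → refl))
      (≤-reflexive (trans (lsum-const 1 ps) (*-identityʳ _)))

    path-gapLoad : ∀ {R ps} → lsum (pairSum (missing R)) ps ≡ 0 → ∀ v → gaps R (at v) (concat ps) ≤ lsum (ends v) ps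
    path-gapLoad {R} {ps} z v = junctions _ (λ x → δ x v) (λ x → δ x v)
      (λ x y → ≤-trans (*-monoˡ-≤ (at v x y) (⟦⟧≤1 (not (R x y)))) (≤-reflexive (*-identityˡ _))) ps
      (n≤0⇒n≡0 (≤-trans (lsum-mono (pairSum-mono λ x y → scaled (missing R x y) x y) ps)
         (≤-reflexive (trans (lsum-cong (pairSum-* 2 (missing R)) ps) (trans (lsum-* 2 (pairSum (missing R)) ps) (cong (2 *_) z))))))
      (ends v) (λ x l → +-comm (δ x v) _)
      where
      scaled : ∀ m x y → m * at v x y ≤ 2 * m
      scaled m x y = ≤-trans (*-monoʳ-≤ m (+-mono-≤ (⟦⟧≤1 (does (x Fin.≟ v))) (⟦⟧≤1 (does (y Fin.≟ v))))) (≤-reflexive (*-comm m 2))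

  module _ {n : ℕ} (G : Graph n) where

    private
      V = Fin n

    record PathFamily (T q m : ℕ) : Set where
      field
        paths    : Fin T → Fin q → List (List V)
        cover    : ∀ g e v → lsum (cnt v) (paths g e) ≡ 1
        R        : Fin T → Fin q → V → V → Bool
        R-sym    : ∀ g e → Symmetric (R g e)
        R⊆G      : ∀ g e {x y} → R g e x y ≡ true → adj G x y ≡ true
        disjoint : EdgeDisjointFamily R
        degree≤2 : ∀ g e u → ∑[ x < n ] ⟦ R g e u x ⟧ ≤ 2
        present  : ∀ g e → lsum (pairSum (missing (R g e))) (paths g e) ≡ 0
        few      : ∀ g e → length (paths g e) ≤ m

      endsLoad : V → ℕ
      endsLoad v = ∑[ g < T ] ∑[ e < q ] lsum (ends v) (paths g e)

    module _ (ε⁻¹ : ℕ) (1≤ε⁻¹ : 1 ≤ ε⁻¹) (large-degrees : LargeDegrees G ε⁻¹) (Q : ℕ)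
             (n-large : ∀ q → q ≤ Q → threshold q 2 (4 * ε⁻¹ * Q) < n) (ε⁻¹≤n : ε⁻¹ ≤ n)
             (16C≤n : 16 * richness ε⁻¹ Q ≤ n) where

      merge-paths : ∀ {T q m} → 2 + q ≤ Q → T * (2 + q) ≤ n → sparsity ε⁻¹ Q * (2 * m) ≤ n → (F : PathFamily T (2 + q) m) →
        (∀ v → sparsity ε⁻¹ Q * PathFamily.endsLoad F v ≤ n) →
        ∃ λ (F′ : CycleFamily G T q (16 * richness ε⁻¹ Q)) → ∀ v → CycleFamily.gapLoad F′ v ≤ PathFamily.endsLoad F v
      merge-paths {T} {q} {m} q≤Q small sparse F light = assemble
          (round G ε⁻¹ 1≤ε⁻¹ large-degrees l order R R-sym R⊆G disjoint degree≤2 Q q≤Q small E (2 * m) Out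
            (n-large (suc q) (≤-trans (n≤1+n _) q≤Q)) (n-large q (≤-trans (≤-trans (n≤1+n _) (n≤1+n _)) q≤Q)) ε⁻¹≤n 16C≤n sparse light proc)
        where
        open PathFamily F
        open ≤-Reasoning
        C = richness ε⁻¹ Q
        1≤C : 1 ≤ C
        1≤C = *-mono-≤ {1} {4 * ε⁻¹} (*-mono-≤ {1} {4} (s≤s z≤n) 1≤ε⁻¹) (*-mono-≤ (*-mono-≤ 1≤Q 1≤Q) 1≤Q)
          where
          1≤Q : 1 ≤ Q
          1≤Q = ≤-trans (s≤s z≤n) q≤Q
        instance
          2C≢0 : NonZero (2 * C)
          2C≢0 = >-nonZero (*-mono-≤ {1} {2} (s≤s z≤n) 1≤C)
          8C≢0 : NonZero (8 * C)
          8C≢0 = >-nonZero (*-mono-≤ {1} {8} (s≤s z≤n) 1≤C)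
        0<n : 0 < n
        0<n = ≤-<-trans z≤n (n-large 0 z≤n)
        l : Fin T → Fin (2 + q) → List V
        l g e = concat (paths g e)
        order : ∀ g e → VertexOrder (l g e)
        order g e v = trans (lsum-concat (λ x → δ x v) (paths g e)) (cover g e v)
        E : Fin T → Fin (2 + q) → V → ℕ
        E g e v = lsum (ends v) (paths g e)
        Out : ∀ g e → List (V × V) → Set
        Out g e es = ∃ λ ps → (∀ v → lsum (cnt v) ps ≡ 1) × lsum (pairSum (missing (addEdges es (R g e)))) ps ≡ 0 ×
                       (∀ v → lsum (ends v) ps ≤ E g e v) × length ps ≤ 16 * C
        -- While more than 16C paths are left, one has fewer than n/(8C) vertices. The available
        -- reserve offers n/(2C) places. At most m of them are lost at the junctions of the paths, m
        -- to earlier insertions, and fewer than `c` lie in the path to be inserted.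
        c D : ℕ
        c = n / (8 * C)
        D = n / (2 * C)
        8C≤n : 8 * C ≤ n
        8C≤n = ≤-trans (*-monoˡ-≤ C (m≤m+n 8 8)) 16C≤n
        few-large : n < suc (16 * C) * c
        few-large = begin-strict
          n                         ≤⟨ n≤2m[n/m] (8 * C) n 8C≤n ⟩
          2 * (8 * C) * c           ≡⟨ cong (_* c) (lem C) ⟩
          16 * C * c                <⟨ m<n+m _ (m≥n⇒m/n>0 8C≤n) ⟩
          c + 16 * C * c            ∎
          where
          lem : ∀ C → 2 * (8 * C) ≡ 16 * C
          lem = solve-∀
        slack : 2 * m + c ≤ D
        slack = ≤-/ (2 * C) (*-cancelˡ-≤ 4 (begin
          4 * (2 * C * (2 * m + c))                       ≡⟨ lem C m c ⟩
          16 * C * m + 8 * C * c                          ≤⟨ +-mono-≤ m-small (m*[n/m]≤n (8 * C) n) ⟩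
          n + n                                           ≤⟨ m≤m+n (n + n) (n + n) ⟩
          n + n + (n + n)                                 ≡⟨ lem″ n ⟩
          4 * n                                           ∎))
          where
          lem : ∀ C m c → 4 * (2 * C * (2 * m + c)) ≡ 16 * C * m + 8 * C * c
          lem = solve-∀
          lem″ : ∀ n → n + n + (n + n) ≡ 4 * n
          lem″ = solve-∀
          m-small : 16 * C * m ≤ n
          m-small = begin
            16 * C * m                        ≤⟨ *-monoˡ-≤ m (*-mono-≤ {16} {512} (m≤m+n 16 496) (≤-trans (≤-reflexive (sym (*-identityʳ C))) (*-monoʳ-≤ C 1≤C))) ⟩
            512 * (C * C) * m                 ≤⟨ *-monoʳ-≤ (512 * (C * C)) (m≤m+n m _) ⟩
            512 * (C * C) * (2 * m)           ≤⟨ sparse ⟩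
            n                                 ∎
        proc : ∀ g e Ĥ → (∀ u v → n ≤ 2 * C * pairSum (gain Ĥ u v) (l g e)) →
               ∃ λ es → (∀ {x y} → (x , y) ∈ es → Ĥ x y ≡ true) × length es ≤ 2 * m × (∀ v → endLoad v es ≤ E g e v) × Out g e es
        proc g e Ĥ rich = finish (merge-all Ĥ (16 * C) c D (2 * m) few-large slack (length (paths g e)) (paths g e) (m≤n+m _ (16 * C)) (cover g e) many)
          where
          many : ∀ u v → D + length (paths g e) ≤ gains Ĥ u v (paths g e) + 2 * m
          many u v = begin
            D + length (paths g e)                                                 ≤⟨ +-monoˡ-≤ _ D≤ ⟩
            gains Ĥ u v (paths g e) + length (paths g e) + length (paths g e)      ≤⟨ +-mono-≤ (+-monoʳ-≤ _ (few g e)) (few g e) ⟩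
            gains Ĥ u v (paths g e) + m + m                                        ≡⟨ lem (gains Ĥ u v (paths g e)) m ⟩
            gains Ĥ u v (paths g e) + 2 * m                                        ∎
            where
            lem : ∀ a m → a + m + m ≡ a + 2 * m
            lem = solve-∀
            D≤ : D ≤ gains Ĥ u v (paths g e) + length (paths g e)
            D≤ = ≤-trans (*-cancelˡ-≤ (2 * C) (≤-trans (m*[n/m]≤n (2 * C) n) (rich u v))) (pairSum-concat (gain Ĥ u v) (gain≤1 Ĥ u v) (paths g e))
          finish : (∃ λ (M : Merged Ĥ (paths g e)) → length (Merged.paths M) ≤ 16 * C) →
               ∃ λ es → (∀ {x y} → (x , y) ∈ es → Ĥ x y ≡ true) × length es ≤ 2 * m × (∀ v → endLoad v es ≤ E g e v) × Out g e es
          finish (M , done) = M.used , M.used⊆H , ≤-trans (m≤m+n _ _) (≤-trans M.size (*-monoʳ-≤ 2 (few g e))) ,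
              (λ v → ≤-trans (m≤m+n _ _) (M.budget v)) , M.paths , (λ v → trans (M.counts v) (cover g e v)) ,
              M.present (R g e) (present g e) , (λ v → ≤-trans (m≤n+m _ _) (M.budget v)) , done
            where module M = Merged M
        assemble : Round G ε⁻¹ 1≤ε⁻¹ large-degrees l order R R-sym R⊆G disjoint degree≤2 Q q≤Q small E (2 * m) Out →
          ∃ λ (F′ : CycleFamily G T q (16 * C)) → ∀ v → CycleFamily.gapLoad F′ v ≤ endsLoad v
        assemble r = record
            { l = λ g e → concat (proj₁ (outcome g e))
            ; order = λ g e v → trans (lsum-concat (λ x → δ x v) (proj₁ (outcome g e))) (proj₁ (proj₂ (outcome g e)) v)
            ; R = λ g e → addEdges (used g e) (R g (kept g e))
            ; R-sym = λ g e → addEdges-sym (used g e) (R-sym g (kept g e))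
            ; R⊆G = new⊆G ; disjoint = new-disjoint
            ; few-gaps = λ g e → ≤-trans (path-gaps {ps = proj₁ (outcome g e)} (proj₁ (proj₂ (proj₂ (outcome g e))))) (proj₂ (proj₂ (proj₂ (proj₂ (outcome g e))))) } ,
          λ v → ∑-mono λ g → ≤-trans (∑-mono λ e → ≤-trans (path-gapLoad {ps = proj₁ (outcome g e)} (proj₁ (proj₂ (proj₂ (outcome g e)))) v)
                                                           (proj₁ (proj₂ (proj₂ (proj₂ (outcome g e)))) v))
                                     (∑-injective (kept g) (λ _ _ → kept-inj g) (λ e → E g e v))
          where open Round r

  -- Cyclic shifts modulo a prime

  -- Euclid: a prime factor of `suc (P !)` exceeds `P`.
  large-prime : ∀ P → ∃ λ p → Prime p × P < p
  large-prime P with factorise (suc (P !))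
  ... | record { factors = [] ; isFactorisation = eq } = ⊥-elim (<-irrefl (sym (suc-injective eq)) (1≤n! P))
  ... | record { factors = p ∷ ps ; isFactorisation = eq ; factorsPrime = p-prime All.∷ _ } with P <? p
  ...   | yes P<p = p , p-prime , P<p
  ...   | no P≮p = ⊥-elim (¬prime[1] (subst Prime (∣1⇒≡1 (∣m+n∣m⇒∣n (subst (p ∣_) (trans (sym eq) (+-comm 1 (P !))) (m∣m*n _)) p∣P!)) p-prime))
    where
    p∣P! : p ∣ P !
    p∣P! = divides-factorial p {{prime⇒nonZero p-prime}} (≮⇒≥ P≮p)
      where
      divides-factorial : ∀ p .{{_ : NonZero p}} → p ≤ P → p ∣ P !
      divides-factorial (suc p) h = ∣-trans (m∣m*n (p !)) (m≤n⇒m!∣n! h)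

  module _ (p : ℕ) .{{_ : NonZero p}} where

    unshift : ∀ {a s} → a < p → s ≤ p → ((a + s) % p + (p ∸ s)) % p ≡ a
    unshift {a} {s} a<p s≤p = begin
      ((a + s) % p + (p ∸ s)) % p               ≡⟨ %-distribˡ-+ ((a + s) % p) (p ∸ s) p ⟩
      ((a + s) % p % p + (p ∸ s) % p) % p       ≡⟨ cong (λ z → (z + (p ∸ s) % p) % p) (m%n%n≡m%n (a + s) p) ⟩
      ((a + s) % p + (p ∸ s) % p) % p           ≡⟨ %-distribˡ-+ (a + s) (p ∸ s) p ⟨
      (a + s + (p ∸ s)) % p                     ≡⟨ cong (_% p) (trans (+-assoc a s _) (cong (a +_) (m+[n∸m]≡n s≤p))) ⟩
      (a + p) % p                               ≡⟨ [m+n]%n≡m%n a p ⟩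
      a % p                                     ≡⟨ m<n⇒m%n≡m a<p ⟩
      a                                         ∎
      where open ≡-Reasoning

    shift-injective : ∀ {a b s} → a < p → b < p → s ≤ p → (a + s) % p ≡ (b + s) % p → a ≡ b
    shift-injective {a} {b} {s} a<p b<p s≤p eq =
      trans (sym (unshift a<p s≤p)) (trans (cong (λ z → (z + (p ∸ s)) % p) eq) (unshift b<p s≤p))

    shift-injectiveʳ : ∀ {a s s′} → a < p → s < p → s′ < p → (a + s) % p ≡ (a + s′) % p → s ≡ s′
    shift-injectiveʳ {a} {s} {s′} a<p s<p s′<p eq = shift-injective s<p s′<p (<⇒≤ a<p)
      (trans (cong (_% p) (+-comm s a)) (trans eq (cong (_% p) (+-comm a s′))))

    -- Returning would need s + s′ ≡ 0 modulo p. This is what the restriction to differences below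
    -- p/2 is for: no edge is then directed both ways.
    no-return : ∀ {a b s s′} → a < p → b ≡ (a + s) % p → a ≡ (b + s′) % p → 0 < s → s + s′ < p → ⊥
    no-return {a} {b} {s} {s′} a<p refl eq 0<s s+s′<p = <-irrefl (sym (m+n≡0⇒m≡0 s zero-shift)) 0<s
      where
      open ≡-Reasoning
      total : (a + 0) % p ≡ (a + (s + s′)) % p
      total = begin
        (a + 0) % p                        ≡⟨ cong (_% p) (+-identityʳ a) ⟩
        a % p                              ≡⟨ m<n⇒m%n≡m a<p ⟩
        a                                  ≡⟨ eq ⟩
        ((a + s) % p + s′) % p             ≡⟨ %-distribˡ-+ ((a + s) % p) s′ p ⟩
        ((a + s) % p % p + s′ % p) % p     ≡⟨ cong (λ z → (z + s′ % p) % p) (m%n%n≡m%n (a + s) p) ⟩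
        ((a + s) % p + s′ % p) % p         ≡⟨ %-distribˡ-+ (a + s) s′ p ⟨
        (a + s + s′) % p                   ≡⟨ cong (_% p) (+-assoc a s s′) ⟩
        (a + (s + s′)) % p                 ∎
      zero-shift : s + s′ ≡ 0
      zero-shift = sym (shift-injectiveʳ a<p (≤-<-trans z≤n a<p) s+s′<p total)

  module _ (p : ℕ) (p-prime : Prime p) where

    private
      instance
        p≢0 : NonZero p
        p≢0 = prime⇒nonZero p-prime

      1<p : 1 < p
      1<p = nonTrivial⇒n>1 p {{prime⇒nonTrivial p-prime}}

    inverse : ∀ s → 0 < s → s < p → ∃ λ s⁻¹ → (s * s⁻¹) % p ≡ 1
    inverse s 0<s s<p with coprime-Bézout (prime⇒coprime p-prime {{>-nonZero 0<s}} s<p)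
    ... | Bézout.-+ x y eq = y , (begin
      (s * y) % p          ≡⟨ cong (_% p) (trans (*-comm s y) (sym eq)) ⟩
      (1 + x * p) % p      ≡⟨ [m+kn]%n≡m%n 1 x p ⟩
      1 % p                ≡⟨ m<n⇒m%n≡m 1<p ⟩
      1                    ∎)
      where open ≡-Reasoning
    -- Here 1 + y s = x p, so that -y is the inverse, written as `(p ∸ 1) * y`.
    ... | Bézout.+- x y eq = (p ∸ 1) * y , (begin
      (s * ((p ∸ 1) * y)) % p                        ≡⟨ [m+n]%n≡m%n _ p ⟨
      (s * ((p ∸ 1) * y) + p) % p                    ≡⟨ cong (λ z → (s * ((p ∸ 1) * y) + z) % p) (sym (m+[n∸m]≡n (<⇒≤ 1<p))) ⟩
      (s * ((p ∸ 1) * y) + (1 + (p ∸ 1))) % p        ≡⟨ cong (_% p) (lem s (p ∸ 1) y) ⟩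
      (1 + (p ∸ 1) * (1 + y * s)) % p                ≡⟨ cong (λ z → (1 + (p ∸ 1) * z) % p) eq ⟩
      (1 + (p ∸ 1) * (x * p)) % p                    ≡⟨ cong (λ z → (1 + z) % p) (sym (*-assoc (p ∸ 1) x p)) ⟩
      (1 + ((p ∸ 1) * x) * p) % p                    ≡⟨ [m+kn]%n≡m%n 1 ((p ∸ 1) * x) p ⟩
      1 % p                                          ≡⟨ m<n⇒m%n≡m 1<p ⟩
      1                                              ∎)
      where
      open ≡-Reasoning
      lem : ∀ s q y → s * (q * y) + (1 + q) ≡ 1 + q * (1 + y * s)
      lem = solve-∀

    -- The cycle a ↦ a + s on ℤ/p becomes acyclic once the step into τ is removed: the number of steps
    -- from τ to a is (a − τ) / s mod p.
    cycle-rank : ∀ s τ → 0 < s → s < p → τ < p →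
      ∃ λ (ρ : ℕ → ℕ) → ∀ a b → b < p → b ≡ (a + s) % p → b ≢ τ → ρ a < ρ b
    cycle-rank s τ 0<s s<p τ<p with s⁻¹ , unit ← inverse s 0<s s<p = ρ , increases
      where
      open ≡-Reasoning
      ρ : ℕ → ℕ
      ρ a = ((a + (p ∸ τ)) * s⁻¹) % p
      step : ∀ a b → b ≡ (a + s) % p → ρ b ≡ (ρ a + 1) % p
      step a b refl = begin
        (((a + s) % p + k) * s⁻¹) % p             ≡⟨ %-distribˡ-* ((a + s) % p + k) s⁻¹ p ⟩
        (((a + s) % p + k) % p * (s⁻¹ % p)) % p   ≡⟨ cong (λ z → (z * (s⁻¹ % p)) % p) reduce ⟩
        ((a + s + k) % p * (s⁻¹ % p)) % p         ≡⟨ %-distribˡ-* (a + s + k) s⁻¹ p ⟨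
        ((a + s + k) * s⁻¹) % p                   ≡⟨ cong (_% p) (lem a s k s⁻¹) ⟩
        ((a + k) * s⁻¹ + s * s⁻¹) % p             ≡⟨ %-distribˡ-+ ((a + k) * s⁻¹) (s * s⁻¹) p ⟩
        (ρ a + (s * s⁻¹) % p) % p                 ≡⟨ cong (λ z → (ρ a + z) % p) unit ⟩
        (ρ a + 1) % p                             ∎
        where
        k = p ∸ τ
        lem : ∀ a s k i → (a + s + k) * i ≡ (a + k) * i + s * i
        lem = solve-∀
        reduce : ((a + s) % p + k) % p ≡ (a + s + k) % p
        reduce = trans (%-distribˡ-+ ((a + s) % p) k p) (trans (cong (λ z → (z + k % p) % p) (m%n%n≡m%n (a + s) p)) (sym (%-distribˡ-+ (a + s) k p)))
      -- Ranks drop only in the step from p - 1 to 0, so only τ may have rank 0. Indeed p divides (b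
      -- + (p - τ)) s⁻¹ and not s⁻¹, and b + (p - τ) lies strictly between 0 and 2p, hence equals p.
      zero-rank : ∀ b → b < p → ρ b ≡ 0 → b ≡ τ
      zero-rank b b<p h with euclidsLemma (b + (p ∸ τ)) s⁻¹ p-prime (m%n≡0⇒n∣m _ p h)
      ... | inj₂ p∣s⁻¹ with trans (sym unit) (n∣m⇒m%n≡0 (s * s⁻¹) p (∣n⇒∣m*n s p∣s⁻¹))
      ...   | ()
      zero-rank b b<p h | inj₁ (divides q eq) with q
      ...   | zero = ⊥-elim (<-irrefl refl (<-≤-trans (m<n⇒0<n∸m τ<p) (≤-trans (m≤n+m _ b) (≤-reflexive eq))))
      ...   | suc zero = +-cancelʳ-≡ (p ∸ τ) b τ (trans eq (trans (+-identityʳ p) (sym (m+[n∸m]≡n (<⇒≤ τ<p)))))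
      ...   | suc (suc q) = ⊥-elim (<-irrefl refl (<-≤-trans (+-mono-<-≤ b<p (m∸n≤m p τ)) (≤-trans (+-monoʳ-≤ p (m≤m+n p (q * p))) (≤-reflexive (sym eq)))))
      increases : ∀ a b → b < p → b ≡ (a + s) % p → b ≢ τ → ρ a < ρ b
      increases a b b<p eq b≢τ with ρ a + 1 <? p
      ... | yes small = ≤-reflexive (trans (+-comm 1 (ρ a)) (sym (trans (step a b eq) (m<n⇒m%n≡m small))))
      ... | no large = ⊥-elim (b≢τ (zero-rank b b<p (trans (step a b eq) (trans (cong (_% p) full) (n%n≡0 p)))))
        where
        full : ρ a + 1 ≡ p
        full = ≤-antisym (≤-trans (≤-reflexive (+-comm (ρ a) 1)) (m%n<n ((a + (p ∸ τ)) * s⁻¹) p)) (≮⇒≥ large)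

  -- Linear forests

  lsum-allFin : ∀ {n} (g : Fin n → ℕ) → lsum g (allFin n) ≡ sum g
  lsum-allFin g = tabulated g id
    where
    tabulated : ∀ {m n} (g : Fin n → ℕ) (f : Fin m → Fin n) → lsum g (tabulate f) ≡ ∑[ i < m ] g (f i)
    tabulated {zero}  g f = refl
    tabulated {suc m} g f = cong (g (f zero) +_) (tabulated g (f ∘ suc))

  module _ {n : ℕ} (S : Fin n → Fin n → Bool)
           (functional : ∀ u w w′ → S u w ≡ true → S u w′ ≡ true → w ≡ w′)
           (injective : ∀ u u′ w → S u w ≡ true → S u′ w ≡ true → u ≡ u′)
           (rank : Fin n → ℕ) (increasing : ∀ u w → S u w ≡ true → rank u < rank w) where

    private
      V = Fin n

      hd ld : V → List V → ℕ
      hd v []      = 0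
      hd v (x ∷ l) = δ x v
      ld v []      = 0
      ld v (x ∷ l) = δ (lst x l) v

    symmetrised : V → V → Bool
    symmetrised x y = S x y ∨ S y x

    out-degree in-degree : V → ℕ
    out-degree u = ∑[ w < n ] ⟦ S u w ⟧
    in-degree  w = ∑[ u < n ] ⟦ S u w ⟧

    out-degree≤1 : ∀ u → out-degree u ≤ 1
    out-degree≤1 u = ∑-unique (S u) (functional u)

    in-degree≤1 : ∀ w → in-degree w ≤ 1
    in-degree≤1 w = ∑-unique (λ u → S u w) (λ u u′ → injective u u′ w)

    private
      descent : V → V → ℕ
      descent x y = ⟦ not (does (rank x <? rank y)) ⟧

      -- The paths formed by the edges that leave the vertices us.
      record Partial (us : List V) : Set where
        field
          paths    : List (List V)
          cover    : ∀ v → lsum (cnt v) paths ≡ 1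
          present  : lsum (pairSum (missing symmetrised)) paths ≡ 0
          ascend   : lsum (pairSum descent) paths ≡ 0
          heads    : ∀ v → lsum (hd v) paths + lsum (λ u → ⟦ S u v ⟧) us ≡ 1
          lasts    : ∀ v → lsum (ld v) paths + lsum (λ u → δ u v * out-degree u) us ≡ 1
          size     : length paths + lsum out-degree us ≡ n

      singletons : Partial []
      singletons = record
        { paths = map [_] (allFin n)
        ; cover = λ v → trans (lsum-map (cnt v) (λ _ → +-identityʳ _)) (one v)
        ; present = trans (lsum-map (pairSum (missing symmetrised)) (λ _ → refl)) (trans (lsum-allFin {n} (λ _ → 0)) (∑-zero {n} λ _ → refl))
        ; ascend = trans (lsum-map (pairSum descent) (λ _ → refl)) (trans (lsum-allFin {n} (λ _ → 0)) (∑-zero {n} λ _ → refl))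
        ; heads = λ v → trans (+-identityʳ _) (trans (lsum-map (hd v) (λ _ → refl)) (one v))
        ; lasts = λ v → trans (+-identityʳ _) (trans (lsum-map (ld v) (λ _ → refl)) (one v))
        ; size = trans (+-identityʳ _) (trans (length-map [_] (allFin n)) (length-tabulate id)) }
        where
        lsum-map : ∀ (g : List V → ℕ) {f : V → ℕ} → (∀ x → g [ x ] ≡ f x) → lsum g (map [_] (allFin n)) ≡ lsum f (allFin n)
        lsum-map g {f} h = go (allFin n)
          where
          go : ∀ l → lsum g (map [_] l) ≡ lsum f l
          go []      = refl
          go (x ∷ l) = cong₂ _+_ (h x) (go l)
        one : ∀ v → lsum (λ x → δ x v) (allFin n) ≡ 1
        one v = trans (lsum-allFin (λ x → δ x v)) (trans (sum-cong-≗ λ x → δ-sym x v) (∑-δ-one v))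

      descent-monotone : ∀ x l → pairSum descent (x ∷ l) ≡ 0 → rank x ≤ rank (lst x l)
      descent-monotone x []      _ = ≤-refl
      descent-monotone x (y ∷ l) z = ≤-trans (<⇒≤ (step (rank x <? rank y) (m+n≡0⇒m≡0 _ z)))
                                             (descent-monotone y l (m+n≡0⇒n≡0 (descent x y) z))
        where
        step : (d : Dec (rank x < rank y)) → ⟦ not (does d) ⟧ ≡ 0 → rank x < rank y
        step (yes p) _ = p

      hd-pos : ∀ {v P} → 0 < hd v P → ∃ λ l → P ≡ v ∷ l
      hd-pos {v} {x ∷ l} h with refl ← δ-pos {u = x} h = l , refl

      ld-pos : ∀ {v P} → 0 < ld v P → ∃₂ λ x l → P ≡ x ∷ l × lst x l ≡ v
      ld-pos {v} {x ∷ l} h = x , l , refl , δ-pos h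

      1≡⇒0< : ∀ {k} → k ≡ 1 → 0 < k
      1≡⇒0< refl = s≤s z≤n

      module _ {us : List V} (M : Partial us) (u : V) (fresh : cnt u us ≡ 0) where
        open Partial M

        skip : out-degree u ≡ 0 → Partial (u ∷ us)
        skip none = record
          { paths = paths ; cover = cover ; present = present ; ascend = ascend
          ; heads = λ v → trans (cong (λ z → lsum (hd v) paths + (z + lsum (λ u → ⟦ S u v ⟧) us)) (n≤0⇒n≡0 (≤-trans (term≤∑ (λ w → ⟦ S u w ⟧) v) (≤-reflexive none)))) (heads v)
          ; lasts = λ v → trans (cong (λ z → lsum (ld v) paths + (z + lsum (λ u → δ u v * out-degree u) us)) (trans (cong (δ u v *_) none) (*-zeroʳ (δ u v)))) (lasts v)
          ; size = trans (cong (λ z → length paths + (z + lsum out-degree us)) none) size }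

        module _ (w : V) (Suw : S u w ≡ true) where

          ends-at-u : lsum (ld u) paths ≡ 1
          ends-at-u = trans (sym (+-identityʳ _)) (trans (cong (lsum (ld u) paths +_) (sym zero-sum)) (lasts u))
            where
            zero-sum : lsum (λ x → δ x u * out-degree x) us ≡ 0
            zero-sum = n≤0⇒n≡0 (≤-trans (lsum-mono (λ x → ≤-trans (*-monoʳ-≤ (δ x u) (out-degree≤1 x)) (≤-reflexive (*-identityʳ _))) us) (≤-reflexive fresh))

          starts-at-w : lsum (hd w) paths ≡ 1
          starts-at-w = trans (sym (+-identityʳ _)) (trans (cong (lsum (hd w) paths +_) (sym zero-sum)) (heads w))
            where
            zero-sum : lsum (λ x → ⟦ S x w ⟧) us ≡ 0
            zero-sum = n≤0⇒n≡0 (≤-trans (lsum-mono only-u us) (≤-reflexive fresh))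
              where
              only-u : ∀ x → ⟦ S x w ⟧ ≤ δ x u
              only-u x = ⟦⟧-mono λ h → dec-true (x Fin.≟ u) (injective x u w h Suw)

          module _ (pre post : List (List V)) (x : V) (l : List V) (eq : paths ≡ pre ++ (x ∷ l) ∷ post) (last-u : lst x l ≡ u) where

            private
              P = x ∷ l

            other : lsum (hd w) (pre ++ post) ≡ 1
            other = trans (cong (_+ lsum (hd w) (pre ++ post)) (sym not-w)) (trans (sym (lsum-remove (hd w) pre P post)) (trans (cong (lsum (hd w)) (sym eq)) starts-at-w))
              where
              not-w : δ x w ≡ 0
              not-w with x Fin.≟ w
              ... | no _ = refl
              -- Here acyclicity enters: ranks ascend along the path to `u` and further to `w`, so
              -- `w` is not the head of the path that ends at `u`.
              ... | yes refl = ⊥-elim (<-irrefl refl (<-≤-trans (increasing u x Suw) (subst (λ z → rank x ≤ rank z) last-u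
                  (descent-monotone x l (m+n≡0⇒m≡0 _ (trans (sym (lsum-remove (pairSum descent) pre P post)) (trans (cong (lsum (pairSum descent)) (sym eq)) ascend)))))))

            module _ (pre′ post′ : List (List V)) (m : List V) (eq′ : pre ++ post ≡ pre′ ++ (w ∷ m) ∷ post′) where

              private
                Q = w ∷ m
                joined = pre′ ++ (P ++ Q) ∷ post′

                split : ∀ (g : List V → ℕ) → lsum g paths ≡ g P + (g Q + lsum g (pre′ ++ post′))
                split g = trans (cong (lsum g) eq) (trans (lsum-remove g pre P post) (cong (g P +_) (trans (cong (lsum g) eq′) (lsum-remove g pre′ Q post′))))

                split′ : ∀ (g : List V → ℕ) → lsum g joined ≡ g (P ++ Q) + lsum g (pre′ ++ post′)
                split′ g = lsum-remove g pre′ (P ++ Q) post′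

                pairs : ∀ (f : V → V → ℕ) → f u w ≡ 0 → lsum (pairSum f) joined ≡ lsum (pairSum f) paths
                pairs f z = trans (split′ (pairSum f)) (trans (cong (_+ lsum (pairSum f) (pre′ ++ post′))
                    (trans (pairSum-++ f x l w m) (cong (λ k → pairSum f P + (k + pairSum f Q)) (trans (cong (λ z → f z w) last-u) z))))
                  (trans (+-assoc (pairSum f P) _ _) (sym (split (pairSum f)))))

                out≡1 : out-degree u ≡ 1
                out≡1 = ≤-antisym (out-degree≤1 u) (≤-trans (≤-reflexive (sym (⟦⟧-true Suw))) (term≤∑ (λ w → ⟦ S u w ⟧) w))

              join : Partial (u ∷ us)
              join = record
                { paths = joined
                ; cover = λ v → trans (split′ (cnt v)) (trans (cong (_+ lsum (cnt v) (pre′ ++ post′)) (lsum-++ (λ z → δ z v) P Q))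
                            (trans (+-assoc (cnt v P) _ _) (trans (sym (split (cnt v))) (cover v))))
                ; present = trans (pairs (missing symmetrised) (missing-zero {R = symmetrised} (∨-introˡ _ Suw))) present
                ; ascend = trans (pairs descent (cong (λ b → ⟦ not b ⟧) (dec-true (rank u <? rank w) (increasing u w Suw)))) ascend
                ; heads = λ v → trans (cong₂ _+_ (split′ (hd v)) (cong (_+ lsum (λ u → ⟦ S u v ⟧) us) (S≡δ v)))
                    (trans (lem (δ x v) (lsum (hd v) (pre′ ++ post′)) (δ w v) _)
                    (trans (cong (_+ lsum (λ u → ⟦ S u v ⟧) us) (sym (split (hd v)))) (heads v)))
                ; lasts = λ v → trans (cong₂ _+_ (trans (split′ (ld v)) (cong (λ z → δ z v + lsum (ld v) (pre′ ++ post′)) (lst-++ x l w m)))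
                      (cong (_+ lsum (λ u → δ u v * out-degree u) us) (trans (cong (δ u v *_) out≡1) (*-identityʳ (δ u v)))))
                    (trans (lem′ (δ (lst w m) v) (lsum (ld v) (pre′ ++ post′)) (δ u v) _)
                    (trans (cong (_+ lsum (λ u → δ u v * out-degree u) us) (sym (trans (split (ld v)) (cong (λ z → δ z v + (ld v Q + lsum (ld v) (pre′ ++ post′))) last-u)))) (lasts v)))
                ; size = trans (cong (λ z → length joined + (z + lsum out-degree us)) out≡1)
                    (trans (+-suc (length joined) _) (trans (cong (_+ lsum out-degree us) (sym lengths)) size)) }
                where
                lem : ∀ a b c d → a + b + (c + d) ≡ a + (c + b) + d
                lem = solve-∀
                lem′ : ∀ a b c d → a + b + (c + d) ≡ c + (a + b) + d
                lem′ = solve-∀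
                S≡δ : ∀ v → ⟦ S u v ⟧ ≡ δ w v
                S≡δ v with w Fin.≟ v
                ... | yes refl = ⟦⟧-true Suw
                ... | no w≢v with S u v in h
                ...   | false = refl
                ...   | true = ⊥-elim (w≢v (functional u w v Suw h))
                lengths : length paths ≡ suc (length joined)
                lengths = trans (cong length eq) (trans (length-remove pre P post) (cong suc (trans (cong length eq′) (trans (length-remove pre′ Q post′) (sym (length-remove pre′ (P ++ Q) post′))))))

          extend : Partial (u ∷ us)
          extend with pre , P , post , eq , p ← lsum-find (ld u) paths (1≡⇒0< ends-at-u)
                 with x , l , refl , last-u ← ld-pos {u} {P} p
                 with pre′ , Q , post′ , eq′ , q ← lsum-find (hd w) (pre ++ post) (1≡⇒0< (other pre post x l eq last-u))
                 with m , refl ← hd-pos {w} {Q} q = join pre post x l eq last-u pre′ post′ m eq′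

        add-source : Partial (u ∷ us)
        add-source with 0 <? out-degree u
        ... | no none = skip (n≤0⇒n≡0 (≮⇒≥ none))
        ... | yes some with w , p ← ∑-find-pos (λ w → ⟦ S u w ⟧) some = extend w (⟦⟧-pos p)

      build : ∀ us → (∀ v → cnt v us ≤ 1) → Partial us
      build []       _ = singletons
      build (u ∷ us) h = add-source (build us (λ v → ≤-trans (m≤n+m _ _) (h v))) u
        (n≤0⇒n≡0 (s≤s⁻¹ (subst (λ z → z + cnt u us ≤ 1) (δ-refl u) (h u))))

    record LinearForest : Set where
      field
        paths   : List (List V)
        cover   : ∀ v → lsum (cnt v) paths ≡ 1
        present : lsum (pairSum (missing symmetrised)) paths ≡ 0
        load    : ∀ v → lsum (ends v) paths + (in-degree v + out-degree v) ≡ 2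
        size    : length paths + ∑[ u < n ] out-degree u ≡ n

    linear-forest : LinearForest
    linear-forest = record
      { paths = paths ; cover = cover ; present = present
      ; load = λ v → trans (cong (_+ (in-degree v + out-degree v)) (trans (lsum-cong (split v) paths) (lsum-+ (hd v) (ld v) paths)))
          (trans (lem (lsum (hd v) paths) _ (in-degree v) (out-degree v)) (cong₂ _+_
            (trans (cong (lsum (hd v) paths +_) (sym (lsum-allFin (λ u → ⟦ S u v ⟧)))) (heads v))
            (trans (cong (lsum (ld v) paths +_) (trans (sym (trans (sum-cong-≗ λ u → cong (_* out-degree u) (δ-sym u v)) (∑-δ out-degree v))) (sym (lsum-allFin (λ u → δ u v * out-degree u))))) (lasts v))))
      ; size = trans (cong (length paths +_) (sym (lsum-allFin out-degree))) size }
      where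
      open Partial (build (allFin n) (λ v → ≤-reflexive (trans (lsum-allFin (λ x → δ x v)) (trans (sum-cong-≗ λ x → δ-sym x v) (∑-δ-one v)))))
      lem : ∀ a b c d → a + b + (c + d) ≡ a + c + (b + d)
      lem = solve-∀
      split : ∀ v P → ends v P ≡ hd v P + ld v P
      split v []      = refl
      split v (x ∷ l) = refl

    symmetrised-sym : Symmetric symmetrised
    symmetrised-sym x y = Bool.∨-comm (S x y) (S y x)

    symmetrised-degree : ∀ u → ∑[ x < n ] ⟦ symmetrised u x ⟧ ≤ 2
    symmetrised-degree u = ≤-trans (∑-mono λ x → ⟦∨⟧ (S u x) (S x u))
      (≤-trans (≤-reflexive (∑-distrib-+ (λ x → ⟦ S u x ⟧) (λ x → ⟦ S x u ⟧))) (+-mono-≤ (out-degree≤1 u) (in-degree≤1 u)))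

    -- Summing `load` over all vertices counts every edge twice, and `size` relates the number of
    -- edges to the number of paths.
    ends-total : ∀ (L : LinearForest) → ∑[ v < n ] lsum (ends v) (LinearForest.paths L) ≡ 2 * length (LinearForest.paths L)
    ends-total L = +-cancelʳ-≡ (2 * (∑[ u < n ] out-degree u)) _ _ (begin
      ∑[ v < n ] lsum (ends v) paths + 2 * (∑[ u < n ] out-degree u)
        ≡⟨ cong (∑[ v < n ] lsum (ends v) paths +_) (trans (cong (total-out +_) (+-identityʳ _)) (cong (_+ total-out) (∑-comm (λ u w → ⟦ S u w ⟧)))) ⟩
      ∑[ v < n ] lsum (ends v) paths + (∑[ v < n ] in-degree v + ∑[ v < n ] out-degree v)
        ≡⟨ cong (∑[ v < n ] lsum (ends v) paths +_) (∑-distrib-+ in-degree out-degree) ⟨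
      ∑[ v < n ] lsum (ends v) paths + ∑[ v < n ] (in-degree v + out-degree v)
        ≡⟨ ∑-distrib-+ (λ v → lsum (ends v) paths) _ ⟨
      ∑[ v < n ] (lsum (ends v) paths + (in-degree v + out-degree v))
        ≡⟨ trans (sum-cong-≗ load) (∑-const n 2) ⟩
      n * 2
        ≡⟨ trans (*-comm n 2) (cong (2 *_) (sym size)) ⟩
      2 * (length paths + total-out)
        ≡⟨ *-distribˡ-+ 2 (length paths) total-out ⟩
      2 * length paths + 2 * total-out ∎)
      where
      open LinearForest L
      open ≡-Reasoning
      total-out = ∑[ u < n ] out-degree u

  -- Splitting a regular graph into linear forests

  lsum-concat-map : ∀ {A B : Set} (f : B → ℕ) (g : A → List B) l → lsum f (concat (map g l)) ≡ lsum (λ x → lsum f (g x)) l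
  lsum-concat-map f g []      = refl
  lsum-concat-map f g (x ∷ l) = trans (lsum-++ f (g x) _) (cong (lsum f (g x) +_) (lsum-concat-map f g l))

  module _ {n : ℕ} where

    edgeList : (Fin n → Fin n → Bool) → List (Fin n × Fin n)
    edgeList B = concat (map (λ u → concat (map (edge u) (allFin n))) (allFin n))
      where
      edge : Fin n → Fin n → List (Fin n × Fin n)
      edge u w = if B u w then [ (u , w) ] else []

    lsum-edgeList : ∀ B f → lsum f (edgeList B) ≡ ∑[ u < n ] ∑[ w < n ] (⟦ B u w ⟧ * f (u , w))
    lsum-edgeList B f = trans (lsum-concat-map f _ (allFin n)) (trans (lsum-allFin {n} _) (sum-cong-≗ {n} λ u →
        trans (lsum-concat-map f _ (allFin n)) (trans (lsum-allFin {n} _) (sum-cong-≗ {n} λ w → single (B u w) (u , w)))))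
      where
      single : ∀ b e → lsum f (if b then [ e ] else []) ≡ ⟦ b ⟧ * f e
      single true  e = refl
      single false e = refl

  -- The residue and the quotient modulo `p` determine `t`, and at most `suc (Δ / p)` quotients
  -- occur.
  residue-count : ∀ p Δ .{{_ : NonZero p}} a → ∑[ t < Δ ] ⟦ does (a ≟ toℕ t % p) ⟧ ≤ suc (Δ / p)
  residue-count p Δ a = begin
    ∑[ t < Δ ] member t                                        ≡⟨ sum-cong-≗ (λ t → sym (trans (sym (*-distribˡ-sum (member t) (δ (quotient t)))) (trans (cong (member t *_) (∑-δ-one (quotient t))) (*-identityʳ _)))) ⟩
    ∑[ t < Δ ] ∑[ k < suc (Δ / p) ] (member t * δ (quotient t) k) ≡⟨ ∑-comm (λ t k → member t * δ (quotient t) k) ⟩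
    ∑[ k < suc (Δ / p) ] ∑[ t < Δ ] (member t * δ (quotient t) k) ≤⟨ ∑-≤-const 1 one ⟩
    suc (Δ / p) * 1                                            ≡⟨ *-identityʳ _ ⟩
    suc (Δ / p)                                                ∎
    where
    open ≤-Reasoning
    member : Fin Δ → ℕ
    member t = ⟦ does (a ≟ toℕ t % p) ⟧
    quotient : Fin Δ → Fin (suc (Δ / p))
    quotient t = fromℕ< (s≤s (/-monoˡ-≤ p (<⇒≤ (Fin.toℕ<n t))))
    one : ∀ k → ∑[ t < Δ ] (member t * δ (quotient t) k) ≤ 1
    one k = ≤-trans (≤-reflexive (sum-cong-≗ {Δ} λ t → sym (⟦∧⟧ (does (a ≟ toℕ t % p)) (does (quotient t Fin.≟ k))))) (∑-unique _ λ i j hi hj →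
        Fin.toℕ-injective (trans (determined i hi) (sym (determined j hj))))
      where
      determined : ∀ t → does (a ≟ toℕ t % p) ∧ does (quotient t Fin.≟ k) ≡ true → toℕ t ≡ a + toℕ k * p
      determined t h with r , s ← ∧-true {does (a ≟ toℕ t % p)} h =
        trans (m≡m%n+[m/n]*n (toℕ t) p) (cong₂ (λ x y → x + y * p) (sym (does-true (a ≟ toℕ t % p) r))
          (trans (sym (Fin.toℕ-fromℕ< _)) (cong toℕ (does-true (quotient t Fin.≟ k) s))))

  module _ {n : ℕ} (F : Fin n → Fin n → Bool) (F-sym : Symmetric F) (r : ℕ) (regular : ∀ u → ∑[ x < n ] ⟦ F u x ⟧ ≡ r) where

    private
      V = Fin n

    neighboursIn : ∀ {p} → (V → Fin p) → V → Fin p → ℕ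
    neighboursIn c v j = ∑[ g < n ] (⟦ F v g ⟧ * δ (c g) j)

    -- In `balanced-choice` the vertices are the groups, the colours are the options, and each
    -- vertex v with a colour j gives a test, which counts the neighbours of v of colour j.
    balanced-colouring : ∀ q M → suc q ≤ n → threshold q 1 M < n → ∃ λ (c : V → Fin (suc q)) → ∀ v j →
      M * (suc q * neighboursIn c v j) ≤ M * r + n × M * r ≤ M * (suc q * neighboursIn c v j) + n
    balanced-colouring q M q<n large = unpack (balanced-choice 1 (λ k → w (remQuot (suc q) k)) (λ k → w≤1 (remQuot (suc q) k)) M n N≤n³ ≤-refl large)
      where
      w : V × Fin (suc q) → V → Fin (suc q) → ℕ
      w (v , j) g e = ⟦ F v g ⟧ * δ e j
      w≤1 : ∀ k g e → w k g e ≤ 1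
      w≤1 (v , j) g e = *-mono-≤ (⟦⟧≤1 (F v g)) (⟦⟧≤1 (does (e Fin.≟ j)))
      N≤n³ : n * suc q ≤ n * n * n
      N≤n³ = ≤-trans (*-monoʳ-≤ n q<n) (≤-trans (≤-reflexive (sym (*-identityʳ (n * n)))) (*-monoʳ-≤ (n * n) (≤-trans (s≤s z≤n) q<n)))
      total : ∀ v j → ∑[ g < n ] ∑[ e < suc q ] w (v , j) g e ≡ r
      total v j = trans (sum-cong-≗ λ g → trans (sym (*-distribˡ-sum ⟦ F v g ⟧ (λ e → δ e j)))
          (trans (cong (⟦ F v g ⟧ *_) (trans (sum-cong-≗ λ e → δ-sym e j) (∑-δ-one j))) (*-identityʳ _))) (regular v)
      Balanced : (V → Fin (suc q)) → V × Fin (suc q) → Set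
      Balanced c k = M * (suc q * (∑[ g < n ] w k g (c g))) ≤ M * (∑[ g < n ] ∑[ e < suc q ] w k g e) + n ×
                     M * (∑[ g < n ] ∑[ e < suc q ] w k g e) ≤ M * (suc q * (∑[ g < n ] w k g (c g))) + n
      unpack : (∃ λ c → ∀ k → Balanced c (remQuot (suc q) k)) → _
      unpack (c , h) = c , λ v j → subst (λ R → M * (suc q * neighboursIn c v j) ≤ M * R + n × M * R ≤ M * (suc q * neighboursIn c v j) + n)
                                     (total v j) (subst (Balanced c) (Fin.remQuot-combine v j) (h (combine v j)))

    module Coloured (p : ℕ) (p-prime : Prime p) .{{_ : NonZero p}} (M : ℕ) (1≤M : 1 ≤ M) (c : V → Fin p)
             (upper : ∀ v j → M * (p * neighboursIn c v j) ≤ M * r + n) (lower : ∀ v j → M * r ≤ M * (p * neighboursIn c v j) + n)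
             (h : ℕ) (2h<p : 2 * h < p) where

      private
        instance
          Mp≢0 : NonZero (M * p)
          Mp≢0 = >-nonZero (*-mono-≤ 1≤M (>-nonZero⁻¹ p))

      -- The upper bound on the number of neighbours in one colour, and thus the number of matchings
      -- that König's theorem uses for each colour difference.
      Δ : ℕ
      Δ = (M * r + n) / (M * p)

      neighbours≤Δ : ∀ v j → neighboursIn c v j ≤ Δ
      neighbours≤Δ v j = ≤-trans (≤-reflexive (sym (trans (cong (_/ (M * p)) (*-comm (M * p) _)) (m*n/n≡m (neighboursIn c v j) (M * p)))))
        (/-monoˡ-≤ (M * p) (≤-trans (≤-reflexive (*-assoc M p _)) (upper v j)))

      MpΔ≤ : M * p * Δ ≤ M * r + n
      MpΔ≤ = ≤-trans (≤-reflexive (*-comm (M * p) Δ)) (m/n*n≤m _ (M * p))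

      shift : ℕ → Fin p → Fin p
      shift s a = fromℕ< (m%n<n (toℕ a + s) p)

      toℕ-shift : ∀ s a → toℕ (shift s a) ≡ (toℕ a + s) % p
      toℕ-shift s a = Fin.toℕ-fromℕ< _

      shift-back : ∀ {s} → s ≤ p → ∀ a → shift (p ∸ s) (shift s a) ≡ a
      shift-back {s} s≤p a = Fin.toℕ-injective (trans (toℕ-shift (p ∸ s) _)
        (trans (cong (λ z → (z + (p ∸ s)) % p) (toℕ-shift s a)) (unshift p (Fin.toℕ<n a) s≤p)))

      shift-adjoint : ∀ {s} → s ≤ p → ∀ a b → δ b (shift s a) ≡ δ a (shift (p ∸ s) b)
      shift-adjoint {s} s≤p a b = ≤-antisym
        (⟦⟧-mono λ e → dec-true (a Fin.≟ _) (trans (sym (shift-back s≤p a)) (cong (shift (p ∸ s)) (sym (does-true (b Fin.≟ _) e)))))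
        (⟦⟧-mono λ e → dec-true (b Fin.≟ _) (trans (sym (shift-back (m∸n≤m p s) b))
            (trans (cong (λ z → shift z (shift (p ∸ s) b)) (m∸[m∸n]≡n s≤p)) (cong (shift s) (sym (does-true (a Fin.≟ _) e))))))

      module _ (d : Fin h) where

        s : ℕ
        s = suc (toℕ d)

        s<p : s < p
        s<p = ≤-<-trans (≤-trans (Fin.toℕ<n d) (m≤m+n h _)) 2h<p

        B : V → V → Bool
        B u w = F u w ∧ does (c w Fin.≟ shift s (c u))

        row : ∀ u → ∑[ w < n ] ⟦ B u w ⟧ ≡ neighboursIn c u (shift s (c u))
        row u = sum-cong-≗ λ w → ⟦∧⟧ (F u w) _

        column : ∀ w → ∑[ u < n ] ⟦ B u w ⟧ ≡ neighboursIn c w (shift (p ∸ s) (c w))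
        column w = sum-cong-≗ λ u → trans (⟦∧⟧ (F u w) _) (cong₂ _*_ (cong ⟦_⟧ (F-sym u w)) (shift-adjoint (<⇒≤ s<p) (c u) (c w)))

        abstract
          matchings : Matchings Δ (edgeList B)
          matchings = edge-colouring Δ (edgeList B)
            (λ u → ≤-trans (≤-reflexive (trans (lsum-edgeList B (λ e → δ (proj₁ e) u)) (trans (sum-cong-≗ λ x →
                trans (sum-cong-≗ λ w → trans (*-comm ⟦ B x w ⟧ (δ x u)) (cong (_* ⟦ B x w ⟧) (δ-sym x u))) (sym (*-distribˡ-sum (δ u x) (λ w → ⟦ B x w ⟧))))
                (trans (∑-δ (λ x → ∑[ w < n ] ⟦ B x w ⟧) u) (row u))))) (neighbours≤Δ u _))
            (λ w → ≤-trans (≤-reflexive (trans (lsum-edgeList B (λ e → δ (proj₂ e) w)) (trans (sum-cong-≗ λ u →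
                trans (sum-cong-≗ λ y → trans (*-comm ⟦ B u y ⟧ (δ y w)) (cong (_* ⟦ B u y ⟧) (δ-sym y w))) (∑-δ (λ y → ⟦ B u y ⟧) w))
                (column w)))) (neighbours≤Δ w _))

        open Matchings matchings

        matched-total : ∀ u w → ∑[ t < Δ ] ⟦ matched t u w ⟧ ≡ ⟦ B u w ⟧
        matched-total u w = trans (covered u w) (trans (lsum-edgeList B (λ e → δ (proj₁ e) u * δ (proj₂ e) w))
          (trans (sum-cong-≗ λ x → trans (sum-cong-≗ λ y → lem ⟦ B x y ⟧ (δ x u) (δ y w) (δ u x) (δ w y) (δ-sym x u) (δ-sym y w))
            (trans (sym (*-distribˡ-sum (δ u x) (λ y → δ w y * ⟦ B x y ⟧))) (cong (δ u x *_) (∑-δ (λ y → ⟦ B x y ⟧) w))))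
            (∑-δ (λ x → ⟦ B x w ⟧) u)))
          where
          lem : ∀ b i j i′ j′ → i ≡ i′ → j ≡ j′ → b * (i * j) ≡ i′ * (j′ * b)
          lem b i j .i .j refl refl = go b i j
            where
            go : ∀ b i j → b * (i * j) ≡ i * (j * b)
            go = solve-∀

        matched⊆B : ∀ {t u w} → matched t u w ≡ true → B u w ≡ true
        matched⊆B {t} {u} {w} m = ⟦⟧-pos (≤-trans (≤-reflexive (sym (⟦⟧-true m)))
          (≤-trans (term≤∑ (λ t → ⟦ matched t u w ⟧) t) (≤-reflexive (matched-total u w))))

        matched-colour : ∀ {t u w} → matched t u w ≡ true → c w ≡ shift s (c u)
        matched-colour {t} {u} {w} m = does-true (c w Fin.≟ _) (proj₂ (∧-true {F u w} (matched⊆B m)))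

        module _ (t : Fin Δ) where

          -- The edges of the matching `t` into colour class `τ` are cut. As `τ` runs through all
          -- residues, a vertex loses its outgoing edge in this way about Δ/p times only, and
          -- likewise its incoming edge.
          τ : ℕ
          τ = toℕ t % p

          cut : V → Bool
          cut u = does (toℕ (shift s (c u)) ≟ τ)

          S : V → V → Bool
          S u w = matched t u w ∧ not (cut u)

          S-functional : ∀ u w w′ → S u w ≡ true → S u w′ ≡ true → w ≡ w′
          S-functional u w w′ a b = functional t u w w′ (proj₁ (∧-true a)) (proj₁ (∧-true b))

          S-injective : ∀ u u′ w → S u w ≡ true → S u′ w ≡ true → u ≡ u′
          S-injective u u′ w a b = injective t u u′ w (proj₁ (∧-true a)) (proj₁ (∧-true b))

          abstract
            rank-function : ∃ λ (ρ : ℕ → ℕ) → ∀ a b → b < p → b ≡ (a + s) % p → b ≢ τ → ρ a < ρ b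
            rank-function = cycle-rank p p-prime s τ (s≤s z≤n) s<p (m%n<n (toℕ t) p)

          rank : V → ℕ
          rank u = proj₁ rank-function (toℕ (c u))

          S-increasing : ∀ u w → S u w ≡ true → rank u < rank w
          S-increasing u w a with m , uncut ← ∧-true {matched t u w} a =
            proj₂ rank-function (toℕ (c u)) (toℕ (c w)) (Fin.toℕ<n (c w)) (trans (cong toℕ (matched-colour m)) (toℕ-shift s (c u)))
              λ e → contradiction (trans (sym uncut) (cong not (dec-true (toℕ (shift s (c u)) ≟ τ) (trans (cong toℕ (sym (matched-colour m))) e)))) λ ()

          abstract
            forest : LinearForest S S-functional S-injective rank S-increasing
            forest = linear-forest S S-functional S-injective rank S-increasing

          forest-edges : V → V → Bool
          forest-edges = symmetrised S S-functional S-injective rank S-increasing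

          forest-edges-sym : Symmetric forest-edges
          forest-edges-sym = symmetrised-sym S S-functional S-injective rank S-increasing

          forest-edges-degree : ∀ u → ∑[ x < n ] ⟦ forest-edges u x ⟧ ≤ 2
          forest-edges-degree = symmetrised-degree S S-functional S-injective rank S-increasing

          forest-paths : List (List V)
          forest-paths = LinearForest.paths forest

          S-at : ∀ u w → ⟦ matched t u w ⟧ ≤ ⟦ S u w ⟧ + ⟦ cut u ⟧
          S-at u w = cases (matched t u w) (cut u)
            where
            cases : ∀ a b → ⟦ a ⟧ ≤ ⟦ a ∧ not b ⟧ + ⟦ b ⟧
            cases true  true  = ≤-refl
            cases true  false = ≤-refl
            cases false b     = z≤n

          bounded-cut : ∀ (b : Bool) (f g : V → Bool) → ∑[ x < n ] ⟦ f x ⟧ ≤ 1 → (∀ x → ⟦ f x ⟧ ≤ ⟦ g x ⟧ + ⟦ b ⟧) →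
                        ∑[ x < n ] ⟦ f x ⟧ ≤ ∑[ x < n ] ⟦ g x ⟧ + ⟦ b ⟧
          bounded-cut true  f g h _ = ≤-trans h (m≤n+m 1 _)
          bounded-cut false f g _ h = ≤-trans (∑-mono λ x → ≤-trans (h x) (≤-reflexive (+-identityʳ _))) (m≤m+n _ 0)

          out-lower : ∀ v → ∑[ w < n ] ⟦ matched t v w ⟧ ≤ ∑[ w < n ] ⟦ S v w ⟧ + ⟦ does (toℕ (shift s (c v)) ≟ τ) ⟧
          out-lower v = bounded-cut (cut v) (matched t v) (S v) (∑-unique (matched t v) (functional t v)) (S-at v)

          in-lower : ∀ v → ∑[ u < n ] ⟦ matched t u v ⟧ ≤ ∑[ u < n ] ⟦ S u v ⟧ + ⟦ does (toℕ (c v) ≟ τ) ⟧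
          in-lower v = bounded-cut (does (toℕ (c v) ≟ τ)) (λ u → matched t u v) (λ u → S u v)
              (∑-unique (λ u → matched t u v) (λ u u′ → injective t u u′ v)) same-cut
            where
            same-cut : ∀ u → ⟦ matched t u v ⟧ ≤ ⟦ S u v ⟧ + ⟦ does (toℕ (c v) ≟ τ) ⟧
            same-cut u with matched t u v in m
            ... | false = z≤n
            ... | true  = ≤-trans (≤-reflexive (trans (cong ⟦_⟧ (sym m)) refl)) (≤-trans (S-at u v) (≤-reflexive
                (cong₂ (λ a b → ⟦ a ∧ not (cut u) ⟧ + ⟦ does (toℕ b ≟ τ) ⟧) m (sym (matched-colour m)))))

        κ : ℕ
        κ = suc (Δ / p)

        -- A vertex is a path end once for every edge that it lacks towards degree 2. Unmatched
        -- sides are counted by comparing Δ with the numbers of neighbours; cuts add at most `κ` on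
        -- either side.
        load : ∀ v → ∑[ t < Δ ] lsum (ends v) (forest-paths t) + (neighboursIn c v (shift s (c v)) + neighboursIn c v (shift (p ∸ s) (c v))) ≤ 2 * Δ + 2 * κ
        load v = lin 0 (+-mono-≤ (+-mono-≤ out-sum in-sum) (≤-reflexive per-forest)) (lem (∑[ t < Δ ] lsum (ends v) (forest-paths t))
            (neighboursIn c v (shift s (c v))) (neighboursIn c v (shift (p ∸ s) (c v))) outs ins κ Δ)
          where
          open ≤-Reasoning
          outs = ∑[ t < Δ ] ∑[ w < n ] ⟦ S t v w ⟧
          ins  = ∑[ t < Δ ] ∑[ u < n ] ⟦ S t u v ⟧
          lem : ∀ E x y o i k D → E + (x + y) + ((o + k) + (i + k) + D * 2) + 0 ≡ 2 * D + 2 * k + ((x + y) + (E + (i + o)))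
          lem = solve-∀
          per-forest : ∑[ t < Δ ] lsum (ends v) (forest-paths t) + (ins + outs) ≡ Δ * 2
          per-forest = trans (cong (∑[ t < Δ ] lsum (ends v) (forest-paths t) +_) (sym (∑-distrib-+ (λ t → ∑[ u < n ] ⟦ S t u v ⟧) _)))
            (trans (sym (∑-distrib-+ (λ t → lsum (ends v) (forest-paths t)) _)) (trans (sum-cong-≗ λ t → LinearForest.load (forest t) v) (∑-const Δ 2)))
          out-sum : neighboursIn c v (shift s (c v)) ≤ outs + κ
          out-sum = begin
            neighboursIn c v (shift s (c v))                           ≡⟨ row v ⟨
            ∑[ w < n ] ⟦ B v w ⟧                                       ≡⟨ sum-cong-≗ (λ w → matched-total v w) ⟨
            ∑[ w < n ] ∑[ t < Δ ] ⟦ matched t v w ⟧                    ≡⟨ ∑-comm (λ w t → ⟦ matched t v w ⟧) ⟩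
            ∑[ t < Δ ] ∑[ w < n ] ⟦ matched t v w ⟧                    ≤⟨ ∑-mono (λ t → out-lower t v) ⟩
            ∑[ t < Δ ] (∑[ w < n ] ⟦ S t v w ⟧ + ⟦ does (toℕ (shift s (c v)) ≟ τ t) ⟧) ≡⟨ ∑-distrib-+ (λ t → ∑[ w < n ] ⟦ S t v w ⟧) _ ⟩
            outs + ∑[ t < Δ ] ⟦ does (toℕ (shift s (c v)) ≟ toℕ t % p) ⟧ ≤⟨ +-monoʳ-≤ outs (residue-count p Δ (toℕ (shift s (c v)))) ⟩
            outs + κ                                                   ∎
          in-sum : neighboursIn c v (shift (p ∸ s) (c v)) ≤ ins + κ
          in-sum = begin
            neighboursIn c v (shift (p ∸ s) (c v))                     ≡⟨ column v ⟨
            ∑[ u < n ] ⟦ B u v ⟧                                       ≡⟨ sum-cong-≗ (λ u → matched-total u v) ⟨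
            ∑[ u < n ] ∑[ t < Δ ] ⟦ matched t u v ⟧                    ≡⟨ ∑-comm (λ u t → ⟦ matched t u v ⟧) ⟩
            ∑[ t < Δ ] ∑[ u < n ] ⟦ matched t u v ⟧                    ≤⟨ ∑-mono (λ t → in-lower t v) ⟩
            ∑[ t < Δ ] (∑[ u < n ] ⟦ S t u v ⟧ + ⟦ does (toℕ (c v) ≟ τ t) ⟧) ≡⟨ ∑-distrib-+ (λ t → ∑[ u < n ] ⟦ S t u v ⟧) _ ⟩
            ins + ∑[ t < Δ ] ⟦ does (toℕ (c v) ≟ toℕ t % p) ⟧          ≤⟨ +-monoʳ-≤ ins (residue-count p Δ (toℕ (c v))) ⟩
            ins + κ                                                    ∎

      -- A common edge has the same direction in both forests, because opposite directions
      -- contradict `no-return`. The colours of its ends then determine the difference, and an edge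
      -- lies in only one matching of that difference.
      forest-disjoint : ∀ {d t d′ t′ x y} → forest-edges d t x y ≡ true → forest-edges d′ t′ x y ≡ true → d ≡ d′ × t ≡ t′
      forest-disjoint {d} {t} {d′} {t′} {x} {y} e e′ = orient (∨-true {S d t x y} e) (∨-true {S d′ t′ x y} e′)
        where
        opposite : ∀ {d t d′ t′ x y} → S d t x y ≡ true → S d′ t′ y x ≡ true → ⊥
        opposite {d} {t} {d′} {t′} {x} {y} a b = no-return p (Fin.toℕ<n (c x))
            (trans (cong toℕ (matched-colour d (proj₁ (∧-true a)))) (toℕ-shift (s d) (c x)))
            (trans (cong toℕ (matched-colour d′ (proj₁ (∧-true b)))) (toℕ-shift (s d′) (c y))) (s≤s z≤n)
            (≤-<-trans (≤-trans (+-mono-≤ (Fin.toℕ<n d) (Fin.toℕ<n d′)) (≤-reflexive (cong (h +_) (sym (+-identityʳ h))))) 2h<p)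
        parallel : ∀ {d t d′ t′ x y} → S d t x y ≡ true → S d′ t′ x y ≡ true → d ≡ d′ × t ≡ t′
        parallel {d} {t} {d′} {t′} {x} {y} a b = d≡d′ , same-matching d≡d′ (proj₁ (∧-true a)) (proj₁ (∧-true b))
          where
          d≡d′ : d ≡ d′
          d≡d′ = Fin.toℕ-injective (suc-injective (shift-injectiveʳ p {toℕ (c x)} (Fin.toℕ<n (c x)) (s<p d) (s<p d′)
            (trans (sym (toℕ-shift (s d) (c x))) (trans (cong toℕ (trans (sym (matched-colour d (proj₁ (∧-true a)))) (matched-colour d′ (proj₁ (∧-true b))))) (toℕ-shift (s d′) (c x))))))
          same-matching : ∀ {d d′} → d ≡ d′ → Matchings.matched (matchings d) t x y ≡ true → Matchings.matched (matchings d′) t′ x y ≡ true → t ≡ t′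
          same-matching {d} refl m m′ with t Fin.≟ t′
          ... | yes eq = eq
          ... | no neq = ⊥-elim (<-irrefl refl (begin-strict
            1                                                       <⟨ s≤s (s≤s z≤n) ⟩
            2                                                       ≡⟨ cong₂ _+_ (sym (∑-δ-one t)) (sym (∑-δ-one t′)) ⟩
            ∑[ i < Δ ] δ t i + ∑[ i < Δ ] δ t′ i                    ≡⟨ ∑-distrib-+ (δ t) (δ t′) ⟨
            ∑[ i < Δ ] (δ t i + δ t′ i)                             ≤⟨ ∑-mono both ⟩
            ∑[ i < Δ ] ⟦ Matchings.matched (matchings d) i x y ⟧    ≡⟨ matched-total d x y ⟩
            ⟦ B d x y ⟧                                             ≤⟨ ⟦⟧≤1 (B d x y) ⟩
            1                                                       ∎))
            where
            open ≤-Reasoning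
            both : ∀ i → δ t i + δ t′ i ≤ ⟦ Matchings.matched (matchings d) i x y ⟧
            both i with t Fin.≟ i | t′ Fin.≟ i
            ... | yes refl | yes refl = ⊥-elim (neq refl)
            ... | yes refl | no _     = ≤-reflexive (sym (⟦⟧-true m))
            ... | no _     | yes refl = ≤-reflexive (sym (⟦⟧-true m′))
            ... | no _     | no _     = z≤n

        orient : S d t x y ≡ true ⊎ S d t y x ≡ true → S d′ t′ x y ≡ true ⊎ S d′ t′ y x ≡ true → d ≡ d′ × t ≡ t′
        orient (inj₁ a) (inj₁ b) = parallel a b
        orient (inj₂ a) (inj₂ b) = parallel a b
        orient (inj₁ a) (inj₂ b) = ⊥-elim (opposite a b)
        orient (inj₂ a) (inj₁ b) = ⊥-elim (opposite b a)

      forest-edges⊆F : ∀ d t {x y} → forest-edges d t x y ≡ true → F x y ≡ true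
      forest-edges⊆F d t {x} {y} e with ∨-true {S d t x y} e
      ... | inj₁ a = proj₁ (∧-true {F x y} (matched⊆B d (proj₁ (∧-true a))))
      ... | inj₂ a = trans (F-sym x y) (proj₁ (∧-true {F y x} (matched⊆B d (proj₁ (∧-true a)))))

      -- The upper and the lower bound of the colouring cancel `r`. Each difference contributes at
      -- most 4n/(Mp) + 2Δ/p + 2, and there are fewer than p/2 of them.
      total-load : ∀ v → M * (∑[ d < h ] ∑[ t < Δ ] lsum (ends v) (forest-paths d t)) ≤ 2 * n + M * Δ + M * p
      total-load v = *-cancelˡ-≤ (2 * p) {{>-nonZero (*-mono-≤ {1} {2} (s≤s z≤n) (>-nonZero⁻¹ p))}} (begin
        2 * p * (M * (∑[ d < h ] Y d))              ≡⟨ lem₁ p M (∑[ d < h ] Y d) ⟩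
        2 * (M * p * (∑[ d < h ] Y d))              ≡⟨ cong (2 *_) (*-distribˡ-sum (M * p) Y) ⟩
        2 * (∑[ d < h ] (M * p * Y d))              ≤⟨ *-monoʳ-≤ 2 (∑-≤-const (4 * n + 2 * (M * Δ) + 2 * (M * p)) single) ⟩
        2 * (h * (4 * n + 2 * (M * Δ) + 2 * (M * p))) ≡⟨ *-assoc 2 h _ ⟨
        2 * h * (4 * n + 2 * (M * Δ) + 2 * (M * p)) ≤⟨ *-monoˡ-≤ _ (<⇒≤ 2h<p) ⟩
        p * (4 * n + 2 * (M * Δ) + 2 * (M * p))     ≡⟨ lem₂ p n (M * Δ) (M * p) ⟩
        2 * p * (2 * n + M * Δ + M * p)             ∎)
        where
        open ≤-Reasoning
        Y : Fin h → ℕ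
        Y d = ∑[ t < Δ ] lsum (ends v) (forest-paths d t)
        lem₁ : ∀ p M y → 2 * p * (M * y) ≡ 2 * (M * p * y)
        lem₁ = solve-∀
        lem₂ : ∀ p n a b → p * (4 * n + 2 * a + 2 * b) ≡ 2 * p * (2 * n + a + b)
        lem₂ = solve-∀
        single : ∀ d → M * p * Y d ≤ 4 * n + 2 * (M * Δ) + 2 * (M * p)
        single d = lin 0 (+-mono-≤ (*-monoʳ-≤ (M * p) (load d v)) (+-mono-≤ (+-mono-≤ (lower v (shift (s d) (c v))) (lower v (shift (p ∸ s d) (c v))))
            (+-mono-≤ (*-monoʳ-≤ 2 MpΔ≤) (*-monoʳ-≤ (2 * M) pκ≤))))
            (lem M p (Y d) (neighboursIn c v (shift (s d) (c v))) (neighboursIn c v (shift (p ∸ s d) (c v))) Δ (Δ / p) r n)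
          where
          pκ≤ : p * (Δ / p) ≤ Δ
          pκ≤ = ≤-trans (≤-reflexive (*-comm p _)) (m/n*n≤m Δ p)
          lem : ∀ M p Y a b D k r n →
            M * p * Y + (M * p * (2 * D + 2 * suc k) + ((M * (p * a) + n + (M * (p * b) + n)) + (2 * (M * r + n) + 2 * M * D))) + 0
            ≡ 4 * n + 2 * (M * D) + 2 * (M * p) + (M * p * (Y + (a + b)) + ((M * r + M * r) + (2 * (M * p * D) + 2 * M * (p * k))))
          lem = solve-∀

  -- Grouping the forests and regrouping the cycles

  enumerate : ∀ N (b : Fin N → Bool) → ∃ λ K → ∃ λ (ι : Fin K → Fin N) →
    (∀ i j → ι i ≡ ι j → i ≡ j) × (∀ i → b (ι i) ≡ true) × K ≡ ∑[ k < N ] ⟦ b k ⟧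
  enumerate zero    b = 0 , (λ ()) , (λ ()) , (λ ()) , refl
  enumerate (suc N) b with b zero in eq | enumerate N (b ∘ suc)
  ... | false | K , ι , inj , good , size = K , suc ∘ ι , (λ i j e → inj i j (Fin.suc-injective e)) , good , size
  ... | true  | K , ι , inj , good , size = suc K , ι′ , inj′ , good′ , cong suc size
    where
    ι′ : Fin (suc K) → Fin (suc N)
    ι′ zero    = zero
    ι′ (suc i) = suc (ι i)
    inj′ : ∀ i j → ι′ i ≡ ι′ j → i ≡ j
    inj′ zero    zero    _ = refl
    inj′ (suc i) (suc j) e = cong suc (inj i j (Fin.suc-injective e))
    good′ : ∀ i → b (ι′ i) ≡ true
    good′ zero    = eq
    good′ (suc i) = good i

  module Embed {T q N : ℕ} (T*q≤N : T * q ≤ N) where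

    embed : Fin T → Fin q → Fin N
    embed g e = Fin.inject≤ (combine g e) T*q≤N

    embed-injective : ∀ {g e g′ e′} → embed g e ≡ embed g′ e′ → g ≡ g′ × e ≡ e′
    embed-injective {g} {e} {g′} {e′} eq = Fin.combine-injective g e g′ e′ (Fin.inject≤-injective T*q≤N T*q≤N _ _ eq)

    ∑-embed : ∀ f → ∑[ g < T ] ∑[ e < q ] f (embed g e) ≤ ∑[ k < N ] f k
    ∑-embed f = ≤-trans (≤-reflexive (sym (∑-combine T q (λ g e → f (embed g e)))))
      (∑-injective (λ k → uncurry embed (remQuot {T} q k)) injective f)
      where
      injective : ∀ k k′ → uncurry embed (remQuot {T} q k) ≡ uncurry embed (remQuot {T} q k′) → k ≡ k′
      injective k k′ eq with eq₁ , eq₂ ← embed-injective eq =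
        trans (sym (Fin.combine-remQuot {T} q k)) (trans (cong₂ combine eq₁ eq₂) (Fin.combine-remQuot {T} q k′))

  n≤[n/q]*q+q : ∀ n q .{{_ : NonZero q}} → n ≤ n / q * q + q
  n≤[n/q]*q+q n q = ≤-trans (≤-reflexive (trans (m≡m%n+[m/n]*n n q) (+-comm (n % q) _))) (+-monoʳ-≤ _ (<⇒≤ (m%n<n n q)))

  module _ {n : ℕ} (G : Graph n) where

    private
      V = Fin n

    module _ {N : ℕ} (paths : Fin N → List (List V)) (cover : ∀ k v → lsum (cnt v) (paths k) ≡ 1)
             (R : Fin N → V → V → Bool) (R-sym : ∀ k → Symmetric (R k)) (R⊆G : ∀ k {x y} → R k x y ≡ true → adj G x y ≡ true)
             (disjoint : ∀ {k k′ x y} → R k x y ≡ true → R k′ x y ≡ true → k ≡ k′)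
             (degree≤2 : ∀ k u → ∑[ x < n ] ⟦ R k u x ⟧ ≤ 2) (present : ∀ k → lsum (pairSum (missing (R k))) (paths k) ≡ 0) where

      -- Forests with more than `m` paths are discarded, and Markov's inequality bounds their number
      -- `bad`. The incomplete last group accounts for the loss of up to `q` more.
      group-paths : ∀ m q .{{_ : NonZero q}} → ∃₂ λ T (P : PathFamily G T q m) →
        (∀ v → PathFamily.endsLoad P v ≤ ∑[ k < N ] lsum (ends v) (paths k)) × T * q ≤ N ×
        ∃ λ bad → N ≤ T * q + q + bad × bad * suc m ≤ ∑[ k < N ] length (paths k)
      group-paths m q = arrange (enumerate N good)
        where
        good : Fin N → Bool
        good k = does (length (paths k) ≤? m)
        arrange : (∃ λ K → ∃ λ (ι : Fin K → Fin N) → (∀ i j → ι i ≡ ι j → i ≡ j) × (∀ i → good (ι i) ≡ true) × K ≡ ∑[ k < N ] ⟦ good k ⟧) → _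
        arrange (K , ι , inj , ι-good , size) = T , P ,
            (λ v → ≤-trans (∑-embed (λ i → lsum (ends v) (paths (ι i)))) (∑-injective ι inj (λ k → lsum (ends v) (paths k)))) ,
            ≤-trans (m/n*n≤m K q) K≤N , bad , split , heavy
          where
          T = K / q
          open Embed {T} {q} {K} (m/n*n≤m K q)
          index : Fin T → Fin q → Fin N
          index g e = ι (embed g e)
          P : PathFamily G T q m
          P = record
            { paths = λ g e → paths (index g e) ; cover = λ g e → cover (index g e) ; R = λ g e → R (index g e)
            ; R-sym = λ g e → R-sym (index g e) ; R⊆G = λ g e → R⊆G (index g e)
            ; disjoint = λ p p′ → embed-injective (inj _ _ (disjoint p p′))
            ; degree≤2 = λ g e → degree≤2 (index g e) ; present = λ g e → present (index g e)
            ; few = λ g e → does-true (length (paths (index g e)) ≤? m) (ι-good (embed g e)) }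
          bad : ℕ
          bad = ∑[ k < N ] ⟦ not (good k) ⟧
          K+bad : K + bad ≡ N
          K+bad = trans (cong (_+ bad) size) (trans (sym (∑-distrib-+ (λ k → ⟦ good k ⟧) _))
            (trans (sum-cong-≗ λ k → trans (+-comm ⟦ good k ⟧ _) (⟦not⟧ (good k))) (trans (∑-const N 1) (*-identityʳ N))))
          K≤N : K ≤ N
          K≤N = ≤-trans (m≤m+n K bad) (≤-reflexive K+bad)
          split : N ≤ T * q + q + bad
          split = ≤-trans (≤-reflexive (sym K+bad)) (+-monoˡ-≤ bad (n≤[n/q]*q+q K q))
          heavy : bad * suc m ≤ ∑[ k < N ] length (paths k)
          heavy = ≤-trans (≤-reflexive (*-distribʳ-sum (suc m) (λ k → ⟦ not (good k) ⟧))) (∑-mono λ k → long (length (paths k) ≤? m))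
            where
            long : ∀ {l} (d : Dec (l ≤ m)) → ⟦ not (does d) ⟧ * suc m ≤ l
            long (yes _) = z≤n
            long (no h)  = ≤-trans (≤-reflexive (+-identityʳ (suc m))) (≰⇒> h)

    -- Closing gaps takes larger groups than merging: their size must far exceed the number of gaps
    -- that merging leaves.
    regroup-cycles : ∀ {T q m} (F : CycleFamily G T q m) q′ .{{_ : NonZero q′}} → ∃₂ λ T′ (F′ : CycleFamily G T′ q′ m) →
      (∀ v → CycleFamily.gapLoad F′ v ≤ CycleFamily.gapLoad F v) × T′ * q′ ≤ T * q × T * q ≤ T′ * q′ + q′
    regroup-cycles {T} {q} {m} F q′ = T′ , F′ ,
        (λ v → ≤-trans (∑-embed (λ k → gaps (R (group k) (member k)) (at v) (l (group k) (member k))))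
                       (≤-reflexive (∑-combine T q (λ g e → gaps (R g e) (at v) (l g e))))) ,
        m/n*n≤m (T * q) q′ , n≤[n/q]*q+q (T * q) q′
      where
      open CycleFamily F
      T′ = T * q / q′
      open Embed {T′} {q′} {T * q} (m/n*n≤m (T * q) q′)
      group : Fin (T * q) → Fin T
      group k = proj₁ (remQuot {T} q k)
      member : Fin (T * q) → Fin q
      member k = proj₂ (remQuot {T} q k)
      same : ∀ {k k′} → group k ≡ group k′ × member k ≡ member k′ → k ≡ k′
      same {k} {k′} (eq₁ , eq₂) = trans (sym (Fin.combine-remQuot {T} q k)) (trans (cong₂ combine eq₁ eq₂) (Fin.combine-remQuot {T} q k′))
      F′ : CycleFamily G T′ q′ m
      F′ = record
        { l = λ g e → l (group (embed g e)) (member (embed g e)) ; order = λ g e → order (group (embed g e)) (member (embed g e))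
        ; R = λ g e → R (group (embed g e)) (member (embed g e)) ; R-sym = λ g e → R-sym (group (embed g e)) (member (embed g e))
        ; R⊆G = λ g e → R⊆G (group (embed g e)) (member (embed g e))
        ; disjoint = λ p p′ → embed-injective (same (disjoint p p′))
        ; few-gaps = λ g e → few-gaps (group (embed g e)) (member (embed g e)) }

  -- Hamilton cycles from orderings without gaps

  lookup-injective : ∀ {n} (l : List (Fin n)) → (∀ v → cnt v l ≤ 1) → ∀ i j → lookup l i ≡ lookup l j → i ≡ j
  lookup-injective (x ∷ l) h zero    zero    _  = refl
  lookup-injective (x ∷ l) h (suc i) (suc j) eq = cong suc (lookup-injective l (λ v → ≤-trans (m≤n+m _ _) (h v)) i j eq)
  lookup-injective (x ∷ l) h zero    (suc j) eq = ⊥-elim (repeated x l h j eq)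
    where
    occurs : ∀ {n} (l : List (Fin n)) j → 1 ≤ cnt (lookup l j) l
    occurs (x ∷ l) zero    = ≤-trans (≤-reflexive (sym (δ-refl x))) (m≤m+n _ _)
    occurs (x ∷ l) (suc j) = ≤-trans (occurs l j) (m≤n+m _ _)
    repeated : ∀ {n} (x : Fin n) l → (∀ v → cnt v (x ∷ l) ≤ 1) → ∀ j → x ≡ lookup l j → ⊥
    repeated x l h j refl = <-irrefl refl (≤-trans (+-mono-≤ (≤-reflexive (sym (δ-refl (lookup l j)))) (occurs l j)) (h (lookup l j)))
  lookup-injective (x ∷ l) h (suc i) zero    eq = sym (lookup-injective (x ∷ l) h zero (suc i) (sym eq))

  cycSum-lookup : ∀ {A : Set} (f : A → A → ℕ) l (i j : Fin (length l)) →
    toℕ j ≡ suc (toℕ i) ⊎ (toℕ i ≡ length l ∸ 1 × toℕ j ≡ 0) → f (lookup l i) (lookup l j) ≤ cycSum f l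
  cycSum-lookup f (x ∷ l) i j (inj₁ next) = ≤-trans (pairSum-lookup f (x ∷ l) i j next) (m≤n+m _ _)
  cycSum-lookup f (x ∷ l) i zero (inj₂ (last-i , _)) = ≤-trans (≤-reflexive (cong (λ z → f z x) (lookup-last x l i last-i))) (m≤m+n _ _)
    where
    lookup-last : ∀ x l (i : Fin (length (x ∷ l))) → toℕ i ≡ length l → lookup (x ∷ l) i ≡ lst x l
    lookup-last x []      zero    _ = refl
    lookup-last x (y ∷ l) (suc i) h = lookup-last y l i (suc-injective h)

  module _ {n} (G : Graph n) (3≤n : 3 ≤ n) (l : List (Fin n)) (order : VertexOrder l) (R : Fin n → Fin n → Bool) (R-sym : Symmetric R)
           (R⊆G : ∀ {x y} → R x y ≡ true → adj G x y ≡ true) (closed : gaps R unweighted l ≤ 0) where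

    private
      position : Fin n → Fin (length l)
      position = Fin.cast (sym (length-ordering {l = l} order))

      consecutive-R : ∀ (i j : Fin n) → toℕ j ≡ suc (toℕ i) ⊎ (toℕ i ≡ n ∸ 1 × toℕ j ≡ 0) → R (lookup l (position i)) (lookup l (position j)) ≡ true
      consecutive-R i j next = ⟦not⟧-zero (n≤0⇒n≡0 (≤-trans (≤-reflexive (sym (*-identityʳ _))) (≤-trans
        (cycSum-lookup (λ x y → missing R x y * 1) l (position i) (position j) (transport next)) closed)))
        where
        transport : toℕ j ≡ suc (toℕ i) ⊎ (toℕ i ≡ n ∸ 1 × toℕ j ≡ 0) →
          toℕ (position j) ≡ suc (toℕ (position i)) ⊎ (toℕ (position i) ≡ length l ∸ 1 × toℕ (position j) ≡ 0)
        transport (inj₁ e) = inj₁ (trans (Fin.toℕ-cast _ j) (trans e (cong suc (sym (Fin.toℕ-cast _ i)))))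
        transport (inj₂ (e , e′)) = inj₂ (trans (Fin.toℕ-cast _ i) (trans e (cong (_∸ 1) (sym (length-ordering {l = l} order)))) , trans (Fin.toℕ-cast _ j) e′)

    hamiltonCycle : HamiltonCycle G
    hamiltonCycle = record
      { three≤n = 3≤n
      ; σ = λ i → lookup l (position i)
      ; σ-inj = λ {i} {j} eq → Fin.toℕ-injective (trans (sym (Fin.toℕ-cast _ i)) (trans (cong toℕ
          (lookup-injective l (λ v → ≤-reflexive (order v)) (position i) (position j) eq)) (Fin.toℕ-cast _ j)))
      ; σ-adj = λ i j next → R⊆G (consecutive-R i j next) }

    cycleEdge-R : ∀ {u v} → CycleEdge hamiltonCycle u v → R u v ≡ true
    cycleEdge-R (i , j , next , inj₁ (refl , refl)) = consecutive-R i j next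
    cycleEdge-R (i , j , next , inj₂ (refl , refl)) = trans (R-sym _ _) (consecutive-R i j next)

  hamiltonCycles : ∀ {n T q} (G : Graph n) → 3 ≤ n → CycleFamily G T q 0 → Σ (Fin (T * q) → HamiltonCycle G) EdgeDisjoint
  hamiltonCycles {n} {T} {q} G 3≤n F = cycles , λ a b a≢b u v p p′ → a≢b (same a b (edge a p) (edge b p′))
    where
    open CycleFamily F
    cycle : Fin T × Fin q → HamiltonCycle G
    cycle (g , e) = hamiltonCycle G 3≤n (l g e) (order g e) (R g e) (R-sym g e) (R⊆G g e) (few-gaps g e)
    cycles : Fin (T * q) → HamiltonCycle G
    cycles k = cycle (remQuot q k)
    edge : ∀ k {u v} → CycleEdge (cycles k) u v → R (proj₁ (remQuot {T} q k)) (proj₂ (remQuot {T} q k)) u v ≡ true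
    edge k = cycleEdge-R G 3≤n (l g e) (order g e) (R g e) (R-sym g e) (R⊆G g e) (few-gaps g e)
      where
      g = proj₁ (remQuot {T} q k)
      e = proj₂ (remQuot {T} q k)
    same : ∀ a b {u v} → R (proj₁ (remQuot {T} q a)) (proj₂ (remQuot {T} q a)) u v ≡ true → R (proj₁ (remQuot {T} q b)) (proj₂ (remQuot {T} q b)) u v ≡ true → a ≡ b
    same a b p p′ with eq , eq′ ← disjoint p p′ =
      trans (sym (Fin.combine-remQuot {T} q a)) (trans (cong₂ combine eq eq′) (Fin.combine-remQuot {T} q b))

  -- Factors of small degree

  gain-exists : ∀ {n x y P} → n + 2 ≤ 2 * x → n + 2 ≤ 2 * y → x + y ≤ P + n + 1 → 0 < P
  gain-exists {n} {x} {y} {suc P} _ _ _ = s≤s z≤n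
  gain-exists {n} {x} {y} {zero} hx hy h = ⊥-elim (<-irrefl refl (lin {B = 0} 1 (+-mono-≤ (+-mono-≤ hx hy) (*-monoʳ-≤ 2 h)) (identity n x y)))
    where
    identity : ∀ n x y → 1 + (2 * x + 2 * y + 2 * (0 + n + 1)) + 1 ≡ 0 + (n + 2 + (n + 2) + 2 * (x + y))
    identity = solve-∀

  module _ {n : ℕ} (0<n : 0 < n) (H : Fin n → Fin n → Bool) (H-sym : Symmetric H)
           (dense : ∀ u → n + 2 ≤ 2 * (∑[ x < n ] ⟦ H u x ⟧)) where

    private
      V = Fin n

      nothing-new : ∀ es → (∀ {x y} → (x , y) ∈ es → H x y ≡ true) → ∀ {x y} → addEdges es H x y ≡ true → H x y ≡ true
      nothing-new es es⊆H {x} {y} h with addEdges-∈ es h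
      ... | inj₁ p        = p
      ... | inj₂ (inj₁ p) = es⊆H p
      ... | inj₂ (inj₂ p) = trans (H-sym x y) (es⊆H p)

    -- Any cyclic ordering of the vertices will do to start with: 2-opt moves within `H` close one
    -- gap after the other. The degree condition has n + 2 because `pigeonhole-pairs` costs n + 1.
    dirac : ∃ λ l → VertexOrder l × gaps H unweighted l ≤ 0
    dirac = improve (gaps H unweighted (allFin n)) (allFin n) (λ v → trans (lsum-allFin (λ x → δ x v)) (trans (sum-cong-≗ λ x → δ-sym x v) (∑-δ-one v))) ≤-refl
      where
      improve : ∀ m l → VertexOrder l → gaps H unweighted l ≤ m → ∃ λ l → VertexOrder l × gaps H unweighted l ≤ 0
      improve zero    l o few = l , o , few
      improve (suc m) l o few = by-closing closing
        where
        open Normalised (normalise H l o 0<n) renaming (order to order′)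
        b = first
        a = lst b rest
        positive : 0 < pairSum (gain H a b) (b ∷ rest)
        positive = gain-exists {n} {∑[ x < n ] ⟦ H a x ⟧} {∑[ x < n ] ⟦ H b x ⟧} (dense a) (dense b) (pigeonhole-pairs (H a) (H b) {b ∷ rest} order′)
        by-closing : missing H a b ≡ 1 ⊎ gaps H unweighted l ≡ 0 → ∃ λ l → VertexOrder l × gaps H unweighted l ≤ 0
        by-closing (inj₂ none) = l , o , ≤-reflexive none
        by-closing (inj₁ gap) = improve m route order″ (s≤s⁻¹ (begin
            suc (gaps H unweighted route)                                             ≤⟨ s≤s (cycSum-mono (λ x y → *-monoˡ-≤ 1 (missing-mono {R = addEdges used H} {S = H} (λ x y → nothing-new used used⊆H) x y)) route) ⟩
            suc (gaps (addEdges used H) unweighted route)                             ≡⟨ +-comm 1 _ ⟩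
            gaps (addEdges used H) unweighted route + 1                               ≡⟨ cong (λ z → gaps (addEdges used H) unweighted route + z * 1) (sym gap) ⟩
            gaps (addEdges used H) unweighted route + missing H a b * 1               ≤⟨ fewer unweighted (λ _ _ → refl) ⟩
            gaps H unweighted (b ∷ rest)                                              ≡⟨ same _ ⟩
            gaps H unweighted l                                                       ≤⟨ few ⟩
            suc m                                                              ∎))
          where
          open ≤-Reasoning
          open Rerouted (2-opt H H-sym {b} {rest} order′ positive) renaming (order to order″; ends to end-loads)

  -- Few cycles can be removed one after the other, because the rest still satisfies Dirac's condition.
  module _ {n : ℕ} (0<n : 0 < n) (G : Graph n) (ε⁻¹ : ℕ) (1≤ε⁻¹ : 1 ≤ ε⁻¹) (large-degrees : LargeDegrees G ε⁻¹) where

    private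
      V = Fin n

    dirac-packing : ∀ t → 2 * ε⁻¹ * t ≤ n → ∃ λ (F : CycleFamily G t 1 0) → ∀ g e u → ∑[ x < n ] ⟦ CycleFamily.R F g e u x ⟧ ≤ 2
    dirac-packing zero _ = record { l = λ () ; order = λ () ; R = λ () ; R-sym = λ () ; R⊆G = λ () ; disjoint = λ { {()} } ; few-gaps = λ () } , λ ()
    dirac-packing (suc t) small = extend (dirac-packing t (≤-trans (*-monoʳ-≤ (2 * ε⁻¹) (n≤1+n t)) small))
      where
      extend : (∃ λ (F : CycleFamily G t 1 0) → ∀ g e u → ∑[ x < n ] ⟦ CycleFamily.R F g e u x ⟧ ≤ 2) →
               ∃ λ (F : CycleFamily G (suc t) 1 0) → ∀ g e u → ∑[ x < n ] ⟦ CycleFamily.R F g e u x ⟧ ≤ 2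
      extend (F , degree≤2) = add (dirac 0<n H H-sym dense)
        where
        open CycleFamily F
        H : V → V → Bool
        H = Reserve G R
        H⇒ : ∀ {x y} → H x y ≡ true → adj G x y ≡ true × (∀ g e → R g e x y ≡ true → ⊥)
        H⇒ {x} {y} h with p , q ← ∧-true {adj G x y} h = p , λ g e r → contradiction (trans (sym q) (cong not (dec-true (occupied? R x y) (g , e , r)))) λ ()
        H-sym : Symmetric H
        H-sym x y = cong₂ _∧_ (adj-sym G x y) (cong not (≤-bool (occupied-sym x y) (occupied-sym y x)))
          where
          ≤-bool : ∀ {a b} → (a ≡ true → b ≡ true) → (b ≡ true → a ≡ true) → a ≡ b
          ≤-bool {true}  f g = sym (f refl)
          ≤-bool {false} {true} f g = g refl
          ≤-bool {false} {false} f g = refl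
          occupied-sym : ∀ x y → occupied R x y ≡ true → occupied R y x ≡ true
          occupied-sym x y h with g , e , r ← does-true (occupied? R x y) h = dec-true (occupied? R y x) (g , e , trans (R-sym g e y x) r)
        dense : ∀ u → n + 2 ≤ 2 * (∑[ x < n ] ⟦ H u x ⟧)
        dense u = *-cancelˡ-≤ ε⁻¹ {{>-nonZero 1≤ε⁻¹}} (lin (2 * ε⁻¹) (+-mono-≤ (large-degrees u) (+-mono-≤ (*-monoʳ-≤ (2 * ε⁻¹) degrees) (*-monoʳ-≤ 2 small)))
            (lem n ε⁻¹ t (∑[ x < n ] ⟦ adj G u x ⟧) (∑[ x < n ] ⟦ H u x ⟧)))
          where
          lem : ∀ n e t D h → e * (n + 2) + (2 * e * D + (2 * e * (h + 2 * t) + 2 * n)) + 2 * e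
                ≡ e * (2 * h) + ((e + 2) * n + (2 * e * D + 2 * (2 * e * suc t)))
          lem = solve-∀
          used-degree≤ : ∑[ x < n ] ∑[ g < t ] ⟦ R g zero u x ⟧ ≤ 2 * t
          used-degree≤ = ≤-trans (≤-reflexive (∑-comm (λ x g → ⟦ R g zero u x ⟧))) (≤-trans (∑-≤-const 2 (λ g → degree≤2 g zero u)) (≤-reflexive (*-comm t 2)))
          degrees : ∑[ x < n ] ⟦ adj G u x ⟧ ≤ ∑[ x < n ] ⟦ H u x ⟧ + 2 * t
          degrees = ≤-trans (∑-mono pointwise) (≤-trans (≤-reflexive (∑-distrib-+ (λ x → ⟦ H u x ⟧) _)) (+-monoʳ-≤ _ used-degree≤))
            where
            pointwise : ∀ x → ⟦ adj G u x ⟧ ≤ ⟦ H u x ⟧ + ∑[ g < t ] ⟦ R g zero u x ⟧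
            pointwise x with occupied? R u x
            ... | no _ = ≤-trans (≤-reflexive (cong ⟦_⟧ (sym (Bool.∧-identityʳ (adj G u x))))) (m≤m+n _ _)
            ... | yes (g , zero , r) = ≤-trans (⟦⟧≤1 (adj G u x)) (≤-trans (≤-trans (≤-reflexive (sym (⟦⟧-true r))) (term≤∑ (λ g → ⟦ R g zero u x ⟧) g)) (m≤n+m _ _))
        add : (∃ λ l → VertexOrder l × gaps H unweighted l ≤ 0) → _
        add (l₀ , o , closed) = record
            { l = l′ ; order = order′ ; R = R′ ; R-sym = R′-sym ; R⊆G = R′⊆G ; disjoint = disjoint′ ; few-gaps = few′ } , degree′
          where
          R₀ = trim H l₀
          l′ : Fin (suc t) → Fin 1 → List V
          l′ zero    _ = l₀
          l′ (suc g) e = l g e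
          order′ : ∀ g e → VertexOrder (l′ g e)
          order′ zero    _ = o
          order′ (suc g) e = order g e
          R′ : Fin (suc t) → Fin 1 → V → V → Bool
          R′ zero    _ = R₀
          R′ (suc g) e = R g e
          R′-sym : ∀ g e → Symmetric (R′ g e)
          R′-sym zero    _ = trim-sym H l₀ H-sym
          R′-sym (suc g) e = R-sym g e
          R′⊆G : ∀ g e {x y} → R′ g e x y ≡ true → adj G x y ≡ true
          R′⊆G zero    _ h = proj₁ (H⇒ (trim-⊆ H l₀ h))
          R′⊆G (suc g) e h = R⊆G g e h
          disjoint′ : EdgeDisjointFamily R′
          disjoint′ {zero}  {zero} {zero}   {zero} p p′ = refl , refl
          disjoint′ {zero}  {zero} {suc g′} {e′} p p′ = ⊥-elim (proj₂ (H⇒ (trim-⊆ H l₀ p)) g′ e′ p′)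
          disjoint′ {suc g} {e} {zero}  {zero} p p′ = ⊥-elim (proj₂ (H⇒ (trim-⊆ H l₀ p′)) g e p)
          disjoint′ {suc g} {e} {suc g′} {e′} p p′ with refl , eq ← disjoint p p′ = refl , eq
          few′ : ∀ g e → gaps (R′ g e) unweighted (l′ g e) ≤ 0
          few′ zero    _ = ≤-trans (trim-gaps H l₀ unweighted) closed
          few′ (suc g) e = few-gaps g e
          degree′ : ∀ g e u → ∑[ x < n ] ⟦ R′ g e u x ⟧ ≤ 2
          degree′ zero    _ u = trim-degree H {l₀} o u
          degree′ (suc g) e u = degree≤2 g e u

  -- Factors of large degree

  -- Each of seven kinds of loss will be at most n/Z; with Z ≥ 8(ε⁻¹)² and n ≤ ε⁻¹r their sum is at
  -- most r/ε⁻¹. For merging, groups have 2 + q₁ members, of which q₁ survive with at most N₁ gaps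
  -- each. For closing gaps they have `widen q₂ N₁` members, of which q₂ survive. The colouring uses
  -- `suc p′` colours with accuracy 8M, and h is the number of colour differences in use.
  module Dense {n : ℕ} (G : Graph n) (ε⁻¹ : ℕ) (1≤ε⁻¹ : 1 ≤ ε⁻¹) (large-degrees : LargeDegrees G ε⁻¹)
      (F : Fin n → Fin n → Bool) (F-sym : Symmetric F) (F⊆G : ∀ {x y} → F x y ≡ true → adj G x y ≡ true)
      (r : ℕ) (regular : ∀ u → ∑[ x < n ] ⟦ F u x ⟧ ≡ r) (n≤ε⁻¹r : n ≤ ε⁻¹ * r)
      (Z q₁ N₁ q₂ M p′ h : ℕ) (p-prime : Prime (suc p′))
      (Z-large : 8 * (ε⁻¹ * ε⁻¹) ≤ Z) (q₁-large : 4 * Z ≤ q₁) (N₁-def : N₁ ≡ 16 * richness ε⁻¹ (2 + q₁)) (q₂-large : 4 * Z * N₁ ≤ q₂)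
      (M-large₁ : 2 * Z * sparsity ε⁻¹ (2 + q₁) ≤ M) (M-large₂ : sparsity ε⁻¹ (widen q₂ N₁) ≤ M)
      (p-large : 8 * M + 4 * Z ≤ suc p′) (2h<p : 2 * h < suc p′) (p≤2h+2 : suc p′ ≤ 2 * h + 2)
      (n-large₁ : ∀ q → q ≤ 2 + q₁ → threshold q 2 (4 * ε⁻¹ * (2 + q₁)) < n)
      (n-large₂ : ∀ q → q ≤ widen q₂ N₁ → threshold q 2 (4 * ε⁻¹ * widen q₂ N₁) < n)
      (n-large₃ : threshold p′ 1 (8 * M) < n) (p≤n : suc p′ ≤ n) (8Mp≤n : 8 * M * suc p′ ≤ n)
      (2ZQ₁≤n : Z * (2 * (2 + q₁)) ≤ n) (2ZQ₂≤n : Z * (2 * widen q₂ N₁) ≤ n) (ε⁻¹≤n : ε⁻¹ ≤ n)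
      (C₁≤n : 16 * richness ε⁻¹ (2 + q₁) ≤ n) (C₂≤n : 16 * richness ε⁻¹ (widen q₂ N₁) ≤ n) (2-small : sparsity ε⁻¹ (widen q₂ N₁) * 2 ≤ n)
      (3≤n : 3 ≤ n) where

    private
      V = Fin n
      p = suc p′
      Q₁ = 2 + q₁
      Q₂ = widen q₂ N₁
      sp₁ = sparsity ε⁻¹ Q₁

    1≤Z : 1 ≤ Z
    1≤Z = ≤-trans (*-mono-≤ {1} {8} (s≤s z≤n) (*-mono-≤ 1≤ε⁻¹ 1≤ε⁻¹)) Z-large

    1≤sp₁ : 1 ≤ sp₁
    1≤sp₁ = *-mono-≤ {1} {512} (s≤s z≤n) (*-mono-≤ 1≤C 1≤C)
      where
      1≤C : 1 ≤ richness ε⁻¹ Q₁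
      1≤C = *-mono-≤ {1} {4 * ε⁻¹} (*-mono-≤ {1} {4} (s≤s z≤n) 1≤ε⁻¹) (s≤s z≤n)

    1≤M : 1 ≤ M
    1≤M = ≤-trans (*-mono-≤ {1} {2 * Z} (*-mono-≤ {1} {2} (s≤s z≤n) 1≤Z) 1≤sp₁) M-large₁

    Z≤8M : Z ≤ 8 * M
    Z≤8M = begin
      Z                  ≤⟨ m≤n*m Z 2 ⟩
      2 * Z              ≤⟨ m≤m*n (2 * Z) sp₁ {{>-nonZero 1≤sp₁}} ⟩
      2 * Z * sp₁        ≤⟨ M-large₁ ⟩
      M                  ≤⟨ m≤n*m M 8 ⟩
      8 * M              ∎
      where open ≤-Reasoning

    sp₁≤M : sp₁ ≤ M
    sp₁≤M = ≤-trans (m≤n*m sp₁ (2 * Z) {{>-nonZero (*-mono-≤ {1} {2} (s≤s z≤n) 1≤Z)}}) M-large₁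

    r≤n : ∀ (v : V) → r ≤ n
    r≤n v = ≤-trans (≤-reflexive (sym (regular v))) (≤-trans (∑-≤-const 1 (λ x → ⟦⟧≤1 (F v x))) (≤-reflexive (*-identityʳ n)))

    v₀ : V
    v₀ = fromℕ< {0} (≤-trans (s≤s z≤n) 3≤n)

    Result : Set
    Result = ∃ λ k → ε⁻¹ * r ≤ 2 * ε⁻¹ * k + r × Σ (Fin k → HamiltonCycle G) EdgeDisjoint

    module _ (c : V → Fin p) (upper : ∀ v j → 8 * M * (p * neighboursIn F F-sym r regular c v j) ≤ 8 * M * r + n)
             (lower : ∀ v j → 8 * M * r ≤ 8 * M * (p * neighboursIn F F-sym r regular c v j) + n) where

      open Coloured F F-sym r regular p p-prime (8 * M) (*-mono-≤ {1} {8} (s≤s z≤n) 1≤M) c upper lower h 2h<p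

      pΔ≤2n : p * Δ ≤ 2 * n
      pΔ≤2n = *-cancelˡ-≤ (8 * M) {{>-nonZero (*-mono-≤ {1} {8} (s≤s z≤n) 1≤M)}} (begin
        8 * M * (p * Δ)          ≡⟨ *-assoc (8 * M) p Δ ⟨
        8 * M * p * Δ            ≤⟨ MpΔ≤ ⟩
        8 * M * r + n            ≤⟨ +-mono-≤ (*-monoʳ-≤ (8 * M) (r≤n v₀)) (m≤n*m n (8 * M) {{>-nonZero (*-mono-≤ {1} {8} (s≤s z≤n) 1≤M)}}) ⟩
        8 * M * n + 8 * M * n    ≡⟨ lem (8 * M) n ⟩
        8 * M * (2 * n)          ∎)
        where
        open ≤-Reasoning
        lem : ∀ a n → a * n + a * n ≡ a * (2 * n)
        lem = solve-∀

      hΔ≤n : h * Δ ≤ n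
      hΔ≤n = *-cancelˡ-≤ 2 (begin
        2 * (h * Δ)     ≡⟨ *-assoc 2 h Δ ⟨
        2 * h * Δ       ≤⟨ *-monoˡ-≤ Δ (<⇒≤ 2h<p) ⟩
        p * Δ           ≤⟨ pΔ≤2n ⟩
        2 * n           ∎)
        where open ≤-Reasoning

      Z2Δ≤n : Z * (2 * Δ) ≤ n
      Z2Δ≤n = *-cancelˡ-≤ 2 (begin
        2 * (Z * (2 * Δ))     ≡⟨ lem Z Δ ⟩
        4 * Z * Δ             ≤⟨ *-monoˡ-≤ Δ (≤-trans (m≤n+m (4 * Z) (8 * M)) p-large) ⟩
        p * Δ                 ≤⟨ pΔ≤2n ⟩
        2 * n                 ∎)
        where
        open ≤-Reasoning
        lem : ∀ Z D → 2 * (Z * (2 * D)) ≡ 4 * Z * D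
        lem = solve-∀

      N : ℕ
      N = h * Δ

      paths : Fin N → List (List V)
      paths k = uncurry forest-paths (remQuot {h} Δ k)

      R : Fin N → V → V → Bool
      R k = uncurry forest-edges (remQuot {h} Δ k)

      forest-at : ∀ k → LinearForest _ _ _ _ _
      forest-at k = uncurry forest (remQuot {h} Δ k)

      loads : V → ℕ
      loads v = ∑[ k < N ] lsum (ends v) (paths k)

      -- As 8M ≤ p and pΔ ≤ 2n, `total-load` gives 8M · load ≤ 5n. The result meets the sparsity
      -- conditions of merging and of closing gaps, and it bounds the total number of paths.
      loads-small : ∀ v → M * loads v ≤ n
      loads-small v = *-cancelˡ-≤ 8 (begin
        8 * (M * loads v)                    ≡⟨ *-assoc 8 M _ ⟨
        8 * M * loads v                      ≡⟨ cong (8 * M *_) (∑-combine h Δ (λ d t → lsum (ends v) (forest-paths d t))) ⟩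
        8 * M * (∑[ d < h ] ∑[ t < Δ ] lsum (ends v) (forest-paths d t)) ≤⟨ total-load v ⟩
        2 * n + 8 * M * Δ + 8 * M * p        ≤⟨ +-mono-≤ (+-monoʳ-≤ (2 * n) (≤-trans (*-monoˡ-≤ Δ (≤-trans (m≤m+n (8 * M) (4 * Z)) p-large)) pΔ≤2n)) 8Mp≤n ⟩
        2 * n + 2 * n + n                    ≤⟨ m≤m+n _ (3 * n) ⟩
        2 * n + 2 * n + n + 3 * n            ≡⟨ lem n ⟩
        8 * n                                ∎)
        where
        open ≤-Reasoning
        lem : ∀ n → 2 * n + 2 * n + n + 3 * n ≡ 8 * n
        lem = solve-∀

      lengths-total : M * (2 * (∑[ k < N ] length (paths k))) ≤ n * n
      lengths-total = begin
        M * (2 * (∑[ k < N ] length (paths k)))           ≡⟨ cong (M *_) (trans (*-distribˡ-sum 2 (λ k → length (paths k))) (sum-cong-≗ λ k → sym (twice k))) ⟩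
        M * (∑[ k < N ] ∑[ v < n ] lsum (ends v) (paths k)) ≡⟨ cong (M *_) (∑-comm (λ k v → lsum (ends v) (paths k))) ⟩
        M * (∑[ v < n ] loads v)                          ≡⟨ *-distribˡ-sum M loads ⟩
        ∑[ v < n ] (M * loads v)                          ≤⟨ ∑-≤-const n loads-small ⟩
        n * n                                             ∎
        where
        open ≤-Reasoning
        twice : ∀ k → ∑[ v < n ] lsum (ends v) (paths k) ≡ 2 * length (paths k)
        twice k = ends-total _ _ _ _ _ (forest-at k)

      -- The differences ±1, ..., ±h account for `2 * N` of the degree, with Δ each, and `2 * Δ`
      -- pays for the at most two others. What may still be missing from `r` is due to the
      -- inaccuracy of the colouring.
      ν : ℕ
      ν = r ∸ (2 * N + 2 * Δ)

      r≤ : r ≤ 2 * N + 2 * Δ + ν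
      r≤ = m≤n+m∸n r (2 * N + 2 * Δ)

      Zν≤n : Z * ν ≤ n
      Zν≤n = ≤-trans (*-monoˡ-≤ ν Z≤8M) (≤-trans (≤-reflexive (*-distribˡ-∸ (8 * M) r _)) (m≤n+o⇒m∸n≤o _ _ (begin
        8 * M * r                                     ≤⟨ lower v₀ (c v₀) ⟩
        8 * M * (p * neighboursIn F F-sym r regular c v₀ (c v₀)) + n ≤⟨ +-monoˡ-≤ n (*-monoʳ-≤ (8 * M) (*-mono-≤ p≤2h+2 (neighbours≤Δ v₀ (c v₀)))) ⟩
        8 * M * ((2 * h + 2) * Δ) + n                 ≡⟨ cong (λ z → 8 * M * z + n) (lem h Δ) ⟩
        8 * M * (2 * N + 2 * Δ) + n                   ∎)))
        where
        open ≤-Reasoning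
        lem : ∀ h D → (2 * h + 2) * D ≡ 2 * (h * D) + 2 * D
        lem = solve-∀

      -- The largest number of paths in a forest that the sparsity condition of `merge-paths`
      -- admits.
      m₀ : ℕ
      m₀ = _/_ n (2 * sp₁) {{>-nonZero (*-mono-≤ {1} {2} (s≤s z≤n) 1≤sp₁)}}

      m₀-small : sp₁ * (2 * m₀) ≤ n
      m₀-small = ≤-trans (≤-reflexive (lem sp₁ m₀)) (m*[n/m]≤n (2 * sp₁) n {{_}})
        where
        lem : ∀ s m → s * (2 * m) ≡ 2 * s * m
        lem = solve-∀

      n≤2sp₁[m₀+1] : n ≤ 2 * sp₁ * suc m₀
      n≤2sp₁[m₀+1] = begin
        n                             ≤⟨ n≤[n/q]*q+q n (2 * sp₁) {{_}} ⟩
        m₀ * (2 * sp₁) + 2 * sp₁      ≡⟨ lem m₀ (2 * sp₁) ⟩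
        2 * sp₁ * suc m₀              ∎
        where
        open ≤-Reasoning
        lem : ∀ m s → m * s + s ≡ s * suc m
        lem = solve-∀

      -- A bad forest has at least n/(2 `sp₁`) paths, while all forests together have at most
      -- n²/(2M), where M ≥ 2 Z `sp₁`.
      bad-small : ∀ bad → bad * suc m₀ ≤ ∑[ k < N ] length (paths k) → Z * (2 * bad) ≤ n
      bad-small bad heavy = *-cancelˡ-≤ n {{>-nonZero (≤-trans (s≤s z≤n) 3≤n)}} (begin
        n * (Z * (2 * bad))                                   ≤⟨ *-monoˡ-≤ (Z * (2 * bad)) n≤2sp₁[m₀+1] ⟩
        2 * sp₁ * suc m₀ * (Z * (2 * bad))                    ≡⟨ lem sp₁ (suc m₀) Z bad ⟩
        2 * Z * sp₁ * (2 * (bad * suc m₀))                    ≤⟨ *-mono-≤ M-large₁ (*-monoʳ-≤ 2 heavy) ⟩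
        M * (2 * (∑[ k < N ] length (paths k)))               ≤⟨ lengths-total ⟩
        n * n                                                 ∎)
        where
        open ≤-Reasoning
        lem : ∀ s m Z b → 2 * s * m * (Z * (2 * b)) ≡ 2 * Z * s * (2 * (b * m))
        lem = solve-∀

      arithmetic : ∀ {T₁ T₂ bad} → N ≤ T₁ * Q₁ + Q₁ + bad → Z * (2 * bad) ≤ n → T₁ * Q₁ ≤ n → T₂ * Q₂ ≤ T₁ * q₁ → T₁ * q₁ ≤ T₂ * Q₂ + Q₂ →
                   ε⁻¹ * r ≤ 2 * ε⁻¹ * (T₂ * q₂) + r
      arithmetic {T₁} {T₂} {bad} N≤ bad≤ T₁Q₁≤n T₂Q₂≤ T₁q₁≤ = begin
        ε⁻¹ * r                                     ≤⟨ *-monoʳ-≤ ε⁻¹ main ⟩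
        ε⁻¹ * (2 * (T₂ * q₂) + loss)                ≡⟨ lem ε⁻¹ (T₂ * q₂) loss ⟩
        2 * ε⁻¹ * (T₂ * q₂) + ε⁻¹ * loss            ≤⟨ +-monoʳ-≤ (2 * ε⁻¹ * (T₂ * q₂)) loss≤r ⟩
        2 * ε⁻¹ * (T₂ * q₂) + r                     ∎
        where
        open ≤-Reasoning
        loss : ℕ
        -- Measured in degrees, two per cycle. In this order: members sacrificed for closing gaps,
        -- remainder of the regrouping, members sacrificed for merging, remainder of the first
        -- grouping, bad forests, colour differences not in use, inaccuracy of the colouring.
        loss = 4 * N₁ * T₂ + 2 * Q₂ + 4 * T₁ + 2 * Q₁ + 2 * bad + 2 * Δ + ν
        lem : ∀ e k l → e * (2 * k + l) ≡ 2 * e * k + e * l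
        lem = solve-∀
        main : r ≤ 2 * (T₂ * q₂) + loss
        main = lin 0 (+-mono-≤ r≤ (+-mono-≤ (*-monoʳ-≤ 2 N≤) (+-mono-≤ (*-monoʳ-≤ 2 T₁q₁≤) (≤-reflexive (cong (λ z → 2 * (T₂ * z)) (widen-def q₂ N₁))))))
          (identity r N Δ ν T₁ q₁ bad T₂ Q₂ N₁ q₂)
          where
          identity : ∀ r N D v T₁ q₁ b T₂ Q₂ N₁ q₂ →
            r + (2 * N + 2 * D + v + (2 * (T₁ * (2 + q₁) + (2 + q₁) + b) + (2 * (T₂ * Q₂ + Q₂) + 2 * (T₂ * (2 * N₁ + q₂))))) + 0
            ≡ 2 * (T₂ * q₂) + (4 * N₁ * T₂ + 2 * Q₂ + 4 * T₁ + 2 * (2 + q₁) + 2 * b + 2 * D + v)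
              + (r + (2 * N + (2 * (T₁ * q₁) + 2 * (T₂ * Q₂))))
          identity = solve-∀
        T₁-small : Z * (4 * T₁) ≤ n
        T₁-small = begin
          Z * (4 * T₁)         ≡⟨ lem′ Z T₁ ⟩
          T₁ * (4 * Z)         ≤⟨ *-monoʳ-≤ T₁ (≤-trans q₁-large (m≤n+m q₁ 2)) ⟩
          T₁ * Q₁              ≤⟨ T₁Q₁≤n ⟩
          n                    ∎
          where
          lem′ : ∀ Z T → Z * (4 * T) ≡ T * (4 * Z)
          lem′ = solve-∀
        T₂-small : Z * (4 * N₁ * T₂) ≤ n
        T₂-small = begin
          Z * (4 * N₁ * T₂)    ≡⟨ lem′ Z N₁ T₂ ⟩
          T₂ * (4 * Z * N₁)    ≤⟨ *-monoʳ-≤ T₂ (≤-trans q₂-large (≤-trans (m≤n+m q₂ (2 * N₁)) (≤-reflexive (sym (widen-def q₂ N₁))))) ⟩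
          T₂ * Q₂              ≤⟨ T₂Q₂≤ ⟩
          T₁ * q₁              ≤⟨ *-monoʳ-≤ T₁ (m≤n+m q₁ 2) ⟩
          T₁ * Q₁              ≤⟨ T₁Q₁≤n ⟩
          n                    ∎
          where
          lem′ : ∀ Z N T → Z * (4 * N * T) ≡ T * (4 * Z * N)
          lem′ = solve-∀
        Z-loss : Z * loss ≤ 8 * n
        Z-loss = begin
          Z * loss             ≡⟨ distribute Z (4 * N₁ * T₂) (2 * Q₂) (4 * T₁) (2 * Q₁) (2 * bad) (2 * Δ) ν ⟩
          Z * (4 * N₁ * T₂) + Z * (2 * Q₂) + Z * (4 * T₁) + Z * (2 * Q₁) + Z * (2 * bad) + Z * (2 * Δ) + Z * ν
            ≤⟨ +-mono-≤ (+-mono-≤ (+-mono-≤ (+-mono-≤ (+-mono-≤ (+-mono-≤ T₂-small 2ZQ₂≤n) T₁-small) 2ZQ₁≤n) bad≤) Z2Δ≤n) Zν≤n ⟩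
          n + n + n + n + n + n + n   ≤⟨ m≤m+n _ n ⟩
          n + n + n + n + n + n + n + n ≡⟨ eight n ⟩
          8 * n                ∎
          where
          distribute : ∀ Z a b c d e f g → Z * (a + b + c + d + e + f + g) ≡ Z * a + Z * b + Z * c + Z * d + Z * e + Z * f + Z * g
          distribute = solve-∀
          eight : ∀ n → n + n + n + n + n + n + n + n ≡ 8 * n
          eight = solve-∀
        loss≤r : ε⁻¹ * loss ≤ r
        loss≤r = *-cancelˡ-≤ (8 * ε⁻¹) {{>-nonZero (*-mono-≤ {1} {8} (s≤s z≤n) 1≤ε⁻¹)}} (begin
          8 * ε⁻¹ * (ε⁻¹ * loss)      ≡⟨ lem′ ε⁻¹ loss ⟩
          8 * (ε⁻¹ * ε⁻¹) * loss      ≤⟨ *-monoˡ-≤ loss Z-large ⟩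
          Z * loss                    ≤⟨ Z-loss ⟩
          8 * n                       ≤⟨ *-monoʳ-≤ 8 n≤ε⁻¹r ⟩
          8 * (ε⁻¹ * r)               ≡⟨ *-assoc 8 ε⁻¹ r ⟨
          8 * ε⁻¹ * r                 ∎)
          where
          lem′ : ∀ e l → 8 * e * (e * l) ≡ 8 * (e * e) * l
          lem′ = solve-∀

      pack-coloured : Result
      pack-coloured = from-paths (group-paths G paths (λ k → LinearForest.cover (forest-at k)) R
          (λ k → uncurry forest-edges-sym (remQuot {h} Δ k)) (λ k e → F⊆G (forest-edges⊆F (proj₁ (remQuot {h} Δ k)) (proj₂ (remQuot {h} Δ k)) e))
          (λ {k} {k′} e e′ → let d≡ , t≡ = forest-disjoint e e′ in
              trans (sym (Fin.combine-remQuot {h} Δ k)) (trans (cong₂ combine d≡ t≡) (Fin.combine-remQuot {h} Δ k′)))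
          (λ k → uncurry forest-edges-degree (remQuot {h} Δ k)) (λ k → LinearForest.present (forest-at k)) m₀ Q₁)
        where
        from-paths : (∃₂ λ T (P : PathFamily G T Q₁ m₀) →
            (∀ v → PathFamily.endsLoad P v ≤ loads v) × T * Q₁ ≤ N ×
            ∃ λ bad → N ≤ T * Q₁ + Q₁ + bad × bad * suc m₀ ≤ ∑[ k < N ] length (paths k)) → Result
        from-paths (T₁ , P , P-load , T₁Q₁≤N , bad , N≤ , heavy) = from-cycles
            (merge-paths G ε⁻¹ 1≤ε⁻¹ large-degrees Q₁ n-large₁ ε⁻¹≤n C₁≤n ≤-refl T₁Q₁≤n m₀-small P
              (λ v → ≤-trans (*-mono-≤ sp₁≤M (P-load v)) (loads-small v)))
          where
          T₁Q₁≤n : T₁ * Q₁ ≤ n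
          T₁Q₁≤n = ≤-trans T₁Q₁≤N hΔ≤n
          from-cycles : (∃ λ (C : CycleFamily G T₁ q₁ (16 * richness ε⁻¹ Q₁)) → ∀ v → CycleFamily.gapLoad C v ≤ PathFamily.endsLoad P v) → Result
          from-cycles (C , C-load) = finish (regroup-cycles G (subst (CycleFamily G T₁ q₁) (sym N₁-def) C) Q₂ {{Q₂≢0}})
            where
            Q₂≢0 : NonZero Q₂
            Q₂≢0 = >-nonZero (≤-trans 1≤Z (≤-trans Z≤q₂ (≤-trans (m≤n+m q₂ (2 * N₁)) (≤-reflexive (sym (widen-def q₂ N₁))))))
              where
              1≤N₁ : 1 ≤ N₁
              1≤N₁ = subst (1 ≤_) (sym N₁-def) (*-mono-≤ {1} {16} (s≤s z≤n) (*-mono-≤ {1} {4 * ε⁻¹} (*-mono-≤ {1} {4} (s≤s z≤n) 1≤ε⁻¹) (s≤s z≤n)))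
              Z≤q₂ : Z ≤ q₂
              Z≤q₂ = ≤-trans (m≤n*m Z 4) (≤-trans (m≤m*n (4 * Z) N₁ {{>-nonZero 1≤N₁}}) q₂-large)
            same-load : ∀ {m m′} (eq : m ≡ m′) (C : CycleFamily G T₁ q₁ m) v → CycleFamily.gapLoad (subst (CycleFamily G T₁ q₁) eq C) v ≤ CycleFamily.gapLoad C v
            same-load refl C v = ≤-refl
            finish : (∃₂ λ T′ (F′ : CycleFamily G T′ Q₂ N₁) →
                (∀ v → CycleFamily.gapLoad F′ v ≤ CycleFamily.gapLoad (subst (CycleFamily G T₁ q₁) (sym N₁-def) C) v) × T′ * Q₂ ≤ T₁ * q₁ × T₁ * q₁ ≤ T′ * Q₂ + Q₂) → Result
            finish (T₂ , C′ , C′-load , T₂Q₂≤ , T₁q₁≤) = T₂ * q₂ , arithmetic {T₁} {T₂} {bad} N≤ (bad-small bad heavy) T₁Q₁≤n T₂Q₂≤ T₁q₁≤ ,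
              hamiltonCycles G 3≤n (close-gaps G ε⁻¹ 1≤ε⁻¹ large-degrees Q₂ n-large₂ ε⁻¹≤n C₂≤n 2-small N₁ ≤-refl
                (≤-trans T₂Q₂≤ (≤-trans (*-monoʳ-≤ T₁ (m≤n+m q₁ 2)) T₁Q₁≤n)) C′
                (λ v → ≤-trans (*-mono-≤ M-large₂ (≤-trans (C′-load v) (≤-trans (same-load (sym N₁-def) C v) (≤-trans (C-load v) (P-load v))))) (loads-small v)))

    pack : Result
    pack = colour (balanced-colouring F F-sym r regular p′ (8 * M) p≤n n-large₃)
      where
      colour : (∃ λ (c : V → Fin p) → ∀ v j →
        8 * M * (p * neighboursIn F F-sym r regular c v j) ≤ 8 * M * r + n × 8 * M * r ≤ 8 * M * (p * neighboursIn F F-sym r regular c v j) + n) → Result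
      colour (c , balanced) = pack-coloured c (λ v j → proj₁ (balanced v j)) (λ v j → proj₂ (balanced v j))

  -- Small and large factors combined, and the choice of the constants

  degree-∑ : ∀ {n} (G : Graph n) v → degree G v ≡ ∑[ x < n ] ⟦ adj G v x ⟧
  degree-∑ {n} G v = trans (indicators (allFin n)) (lsum-allFin (λ x → ⟦ adj G v x ⟧))
    where
    indicator : ∀ b → (if b then 1 else 0) ≡ ⟦ b ⟧
    indicator true  = refl
    indicator false = refl
    indicators : ∀ l → ListAction.sum (map (λ w → if adj G v w then 1 else 0) l) ≡ lsum (λ x → ⟦ adj G v x ⟧) l
    indicators []      = refl
    indicators (x ∷ l) = cong₂ _+_ (indicator (adj G v x)) (indicators l)

  -- The bound k ≥ (1 - 1/ε⁻¹) r / 2, freed of fractions.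
  Packing : ∀ {n} → Graph n → ℕ → ℕ → Set
  Packing G ε⁻¹ r = ∃ λ k → ε⁻¹ * r ≤ 2 * ε⁻¹ * k + r × Σ (Fin k → HamiltonCycle G) EdgeDisjoint

  sparse-packing : ∀ {n} (G : Graph n) ε⁻¹ → 1 ≤ ε⁻¹ → LargeDegrees G ε⁻¹ → 3 ≤ n → ∀ r → Even r → ε⁻¹ * r ≤ n → Packing G ε⁻¹ r
  sparse-packing G ε⁻¹ 1≤ε⁻¹ large-degrees 3≤n r (divides t refl) small = finish
      (dirac-packing (≤-trans (s≤s z≤n) 3≤n) G ε⁻¹ 1≤ε⁻¹ large-degrees t (≤-trans (≤-reflexive (lem ε⁻¹ t)) small))
    where
    lem : ∀ e t → 2 * e * t ≡ e * (t * 2)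
    lem = solve-∀
    finish : (∃ λ (F : CycleFamily G t 1 0) → ∀ g e u → _) → Packing G ε⁻¹ (t * 2)
    finish (F , _) = t * 1 , ≤-trans (≤-reflexive (trans (sym (lem ε⁻¹ t)) (cong (2 * ε⁻¹ *_) (sym (*-identityʳ t))))) (m≤m+n _ _) , hamiltonCycles G 3≤n F

  -- The group size shrinks from round to round, so one bound has to cover every size up to `Q`; a
  -- sum dominates all its terms.
  thresholds : ℕ → ℕ → ℕ
  thresholds ε⁻¹ Q = ∑[ i < suc Q ] suc (threshold (toℕ i) 2 (4 * ε⁻¹ * Q))

  thresholds-bound : ∀ ε⁻¹ Q {n} → thresholds ε⁻¹ Q ≤ n → ∀ q → q ≤ Q → threshold q 2 (4 * ε⁻¹ * Q) < n
  thresholds-bound ε⁻¹ Q {n} h q q≤Q = ≤-trans (≤-reflexive (cong (λ z → suc (threshold z 2 (4 * ε⁻¹ * Q))) (sym (Fin.toℕ-fromℕ< (s≤s q≤Q)))))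
    (≤-trans (term≤∑ (λ i → suc (threshold (toℕ i) 2 (4 * ε⁻¹ * Q))) (fromℕ< (s≤s q≤Q))) h)

  all-bounded : ∀ bs {n} → lsum id bs ≤ n → All (_≤ n) bs
  all-bounded []       _ = All.[]
  all-bounded (b ∷ bs) h = ≤-trans (m≤m+n b _) h All.∷ all-bounded bs (≤-trans (m≤n+m _ b) h)

  module _ (ε⁻¹ : ℕ) (1≤ε⁻¹ : 1 ≤ ε⁻¹) (Z q₁ N₁ q₂ M p′ : ℕ) (p-prime : Prime (suc p′))
      (Z-large : 8 * (ε⁻¹ * ε⁻¹) ≤ Z) (q₁-large : 4 * Z ≤ q₁) (N₁-def : N₁ ≡ 16 * richness ε⁻¹ (2 + q₁)) (q₂-large : 4 * Z * N₁ ≤ q₂)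
      (M-large₁ : 2 * Z * sparsity ε⁻¹ (2 + q₁) ≤ M) (M-large₂ : sparsity ε⁻¹ (widen q₂ N₁) ≤ M)
      (p-large : 8 * M + 4 * Z ≤ suc p′) where

    private
      bounds : List ℕ
      bounds = thresholds ε⁻¹ (2 + q₁) ∷ thresholds ε⁻¹ (widen q₂ N₁) ∷ suc (threshold p′ 1 (8 * M)) ∷ suc p′ ∷ 8 * M * suc p′
             ∷ Z * (2 * (2 + q₁)) ∷ Z * (2 * widen q₂ N₁) ∷ ε⁻¹ ∷ 16 * richness ε⁻¹ (2 + q₁) ∷ 16 * richness ε⁻¹ (widen q₂ N₁)
             ∷ sparsity ε⁻¹ (widen q₂ N₁) * 2 ∷ 3 ∷ []

    packing-with : ∃ λ n₀ → ∀ n → n ≥ n₀ → (G : Graph n) → LargeDegrees G ε⁻¹ → ∀ r → Even r → HasFactor r G → Packing G ε⁻¹ r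
    -- The sum of all lower bounds on `n` that are needed exceeds none too little: it is at least
    -- each of them.
    packing-with = lsum id bounds , λ n n≥n₀ G large-degrees r r-even factor → dense n G large-degrees r r-even factor (all-bounded bounds n≥n₀)
      where
      dense : ∀ n (G : Graph n) → LargeDegrees G ε⁻¹ → ∀ r → Even r → HasFactor r G → All (_≤ n) bounds → Packing G ε⁻¹ r
      dense n G large-degrees r r-even (F , F⊆G , F-regular) (b₁ All.∷ b₂ All.∷ b₃ All.∷ b₄ All.∷ b₅ All.∷ b₆ All.∷ b₇ All.∷ b₈ All.∷ b₉ All.∷ b₁₀ All.∷ b₁₁ All.∷ b₁₂ All.∷ All.[])
        with ε⁻¹ * r ≤? n
      ... | yes small = sparse-packing G ε⁻¹ 1≤ε⁻¹ large-degrees b₁₂ r r-even small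
      ... | no large = Dense.pack G ε⁻¹ 1≤ε⁻¹ large-degrees (adj F) (adj-sym F) (λ {x} {y} → F⊆G x y) r
          (λ u → trans (sym (degree-∑ F u)) (F-regular u)) (≰⇒≥ large) Z q₁ N₁ q₂ M p′ (p′ / 2) p-prime
          Z-large q₁-large N₁-def q₂-large M-large₁ M-large₂ p-large
          (s≤s (≤-trans (≤-reflexive (*-comm 2 (p′ / 2))) (m/n*n≤m p′ 2)))
          (≤-trans (≤-reflexive (cong suc (m≡m%n+[m/n]*n p′ 2))) (≤-trans (+-monoˡ-≤ (p′ / 2 * 2) (m%n<n p′ 2)) (≤-reflexive (lem (p′ / 2)))))
          (thresholds-bound ε⁻¹ (2 + q₁) b₁) (thresholds-bound ε⁻¹ (widen q₂ N₁) b₂) b₃ b₄ b₅ b₆ b₇ b₈ b₉ b₁₀ b₁₁ b₁₂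
        where
        lem : ∀ k → 2 + k * 2 ≡ 2 * k + 2
        lem = solve-∀

  -- The constants are chosen in the order `Z`, `q₁`, `N₁`, `q₂`, `M`, prime, each depending on
  -- earlier ones only. In particular `N₁` depends on the first group size, and the second group
  -- size on `N₁`.
  packing : ∀ ε⁻¹ → 1 ≤ ε⁻¹ → ∃ λ n₀ → ∀ n → n ≥ n₀ → (G : Graph n) → LargeDegrees G ε⁻¹ → ∀ r → Even r → HasFactor r G → Packing G ε⁻¹ r
  packing ε⁻¹ 1≤ε⁻¹ = choose (large-prime (8 * M + 4 * Z))
    where
    Z = 8 * (ε⁻¹ * ε⁻¹)
    q₁ = 4 * Z
    N₁ = 16 * richness ε⁻¹ (2 + q₁)
    q₂ = 4 * Z * N₁
    M₁ = 2 * Z * sparsity ε⁻¹ (2 + q₁)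
    M₂ = sparsity ε⁻¹ (widen q₂ N₁)
    M = M₁ + M₂
    choose : (∃ λ p → Prime p × 8 * M + 4 * Z < p) → _
    choose (zero , p-prime , _) = ⊥-elim (≢-nonZero⁻¹ 0 {{prime⇒nonZero p-prime}} refl)
    choose (suc p′ , p-prime , large) =
      packing-with ε⁻¹ 1≤ε⁻¹ Z q₁ N₁ q₂ M p′ p-prime ≤-refl ≤-refl refl ≤-refl (m≤m+n M₁ M₂) (m≤n+m M₂ M₁) (<⇒≤ large)

open Rationals using (degree-bound; count-bound)
open HamiltonPacking using (packing; degree-∑)

open import Defs
open import Data.Nat using (ℕ; _≥_)
import Data.Nat as ℕ
open import Data.Fin using (Fin)
open import Data.Integer using (+_)
open import Data.Rational using (ℚ; 0ℚ; 1ℚ; ½; _/_; _+_; _-_; _*_; _≤_; _<_; ↧ₙ_)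
open import Data.Product using (Σ; _×_; _,_)
open import Relation.Binary.PropositionalEquality using (subst)

theorem1p3 : (ε : ℚ) → 0ℚ < ε →
    Σ ℕ λ n₀ → (n : ℕ) → n ≥ n₀ → (G : Graph n) →
    ((v : Fin n) → (½ + ε) * (+ n / 1) ≤ (+ degree G v / 1)) →
    (r : ℕ) → IsRegEven G r →
    Σ ℕ λ k → ((1ℚ - ε) * (+ r / 2) ≤ (+ k / 1)) ×
    Σ (Fin k → HamiltonCycle G) EdgeDisjoint
theorem1p3 ε 0<ε =
  let n₀ , packed = packing (↧ₙ ε) (ℕ.s≤s ℕ.z≤n) in
  n₀ , λ n n≥n₀ G degrees r (r-even , factor , _) →
    let large-degrees v = subst (λ d → (↧ₙ ε ℕ.+ 2) ℕ.* n ℕ.≤ 2 ℕ.* ↧ₙ ε ℕ.* d) (degree-∑ G v)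
                                (degree-bound ε 0<ε n (degree G v) (degrees v))
        k , enough , cycles = packed n n≥n₀ G large-degrees r r-even factor
    in k , count-bound ε 0<ε r k enough , cycles
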